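{- $f(n,4,3) = \frac{3}{25}\binom{n}{4} + O(n^3)$, and the minimum is achieved by a blow-up of $C_5$ whose five parts have roughly equal sizes (each part has $\frac{n}{5}+o(n)$ vertices). Moreover, the extremal structure is unique for sufficiently large $n$: there is $n_0$ such that for every $n\ge n_0$, up to isomorphism there is exactly one $n$-vertex graph $G$ with $\alpha(G)\le 2$ and $t_4(G)=f(n,4,3)$, and it is a blow-up of $C_5$.
   Context: For a graph $G$, $\alpha(G)$ denotes its independence number and $t_k(G)$ the number of $k$-vertex cliques ($K_k$) in $G$. For integers $k,l\ge 2$ and $n$, $f(n,k,l)$ is the minimum of $t_k(G)$ over all graphs $G$ on $n$ vertices with $\alpha(G)<l$ (equivalently, with no independent set of size $l$). A blow-up of the $5$-cycle $C_5$ is a graph whose vertex set is partitioned into five sets $V_1,\dots,V_5$ (indices taken modulo $5$) such that $V_i\cup V_{i+1}$ is a clique for every $i$ and there are no edges between $V_i$ and $V_{i+2}$ for every $i$. -}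

module Defs where

open import Data.Bool using (Bool; true; false)
open import Data.Bool.Properties using () renaming (_≟_ to _≟ᵇ_)
open import Data.Nat using (ℕ; zero; suc; _+_; _*_; _≤_)
open import Data.Nat.Properties using () renaming (_≟_ to _≟ℕ_)
open import Data.Fin using (Fin; zero; suc)
open import Data.Fin.Properties using (all?) renaming (_≟_ to _≟ᶠ_)
open import Data.Fin.Subset using (Subset; _∈_; ∣_∣)
open import Data.Fin.Subset.Properties using (_∈?_)
open import Data.List using (List; []; _∷_; map; _++_; length; filter; allFin)
open import Data.Vec using ([]; _∷_)
open import Data.Product using (Σ; _×_; _,_)
open import Data.Sum using (_⊎_)
open import Function.Bundles using (_↔_; Inverse)
open import Relation.Nullary using (¬_; Dec)
open import Relation.Nullary.Decidable using (_→-dec_; _×-dec_; ¬?)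
open import Relation.Binary.PropositionalEquality using (_≡_; _≢_)

record Graph (n : ℕ) : Set where
  field
    adj   : Fin n → Fin n → Bool
    sym   : ∀ i j → adj i j ≡ adj j i
    irrefl : ∀ i → adj i i ≡ false
open Graph public

IsClique : ∀ {n} → Graph n → Subset n → Set
IsClique G S = ∀ i j → i ∈ S → j ∈ S → i ≢ j → adj G i j ≡ true

IsIndependent : ∀ {n} → Graph n → Subset n → Set
IsIndependent G S = ∀ i j → i ∈ S → j ∈ S → i ≢ j → adj G i j ≡ false

isClique? : ∀ {n} (G : Graph n) (S : Subset n) → Dec (IsClique G S)
isClique? G S = all? λ i → all? λ j →
  (i ∈? S) →-dec ((j ∈? S) →-dec (¬? (i ≟ᶠ j) →-dec (adj G i j ≟ᵇ true)))

allSubsets : ∀ n → List (Subset n)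
allSubsets zero = [] ∷ []
allSubsets (suc n) = map (true ∷_) (allSubsets n) ++ map (false ∷_) (allSubsets n)

t : ∀ {n} → ℕ → Graph n → ℕ
t k G = length (filter (λ S → (∣ S ∣ ≟ℕ k) ×-dec isClique? G S) (allSubsets _))

αLess : ∀ {n} → Graph n → ℕ → Set
αLess {n} G l = ∀ (S : Subset n) → ∣ S ∣ ≡ l → ¬ IsIndependent G S

-- G attains f(n,k,l) = min { t_k(H) : H on n vertices, α(H) < l }
IsExtremal : ∀ {n} → ℕ → ℕ → Graph n → Set
IsExtremal {n} k l G = αLess G l × (∀ (H : Graph n) → αLess H l → t k G ≤ t k H)

_≅_ : ∀ {n} → Graph n → Graph n → Set
_≅_ {n} G H = Σ (Fin n ↔ Fin n) λ σ →
  ∀ i j → adj G i j ≡ adj H (Inverse.to σ i) (Inverse.to σ j)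

succ5 : Fin 5 → Fin 5
succ5 zero = suc zero
succ5 (suc zero) = suc (suc zero)
succ5 (suc (suc zero)) = suc (suc (suc zero))
succ5 (suc (suc (suc zero))) = suc (suc (suc (suc zero)))
succ5 (suc (suc (suc (suc zero)))) = zero

IsC5BlowupPartition : ∀ {n} → Graph n → (Fin n → Fin 5) → Set
IsC5BlowupPartition G part =
  (∀ u v → u ≢ v →
     (part v ≡ part u ⊎ part v ≡ succ5 (part u) ⊎ part u ≡ succ5 (part v)) →
     adj G u v ≡ true)
  × (∀ u v → part v ≡ succ5 (succ5 (part u)) → adj G u v ≡ false)

IsC5Blowup : ∀ {n} → Graph n → Set
IsC5Blowup {n} G = Σ (Fin n → Fin 5) λ part → IsC5BlowupPartition G part

partSize : ∀ {n} → (Fin n → Fin 5) → Fin 5 → ℕ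
partSize {n} part i = length (filter (λ u → part u ≟ᶠ i) (allFin n))

{-# OPTIONS --safe #-}
-- The complement H of a graph with α < 3 is triangle-free, and t₄ counts the
-- independent 4-sets of H.  A flag-algebra certificate on 5-vertex patterns,
-- summed over all 5-tuples with repetitions so that no error term appears,
-- gives 25 · I₄ ≥ 3 n⁴ for the number I₄ of independent 4-tuples, with slack
-- that counts the patterns absent from C₅ and the squared deviations of the
-- degrees from 2n/5.  A second certificate forces many induced paths P₄.
--
-- In a minimiser the slack is O(n³), so some induced P₄ has O(n) faults, and
-- the adjacencies to its vertices colour all but boundedly many vertices by
-- the vertices of a pentagon, nearly properly.  Replacing a vertex by a clone
-- of another one bounds the independent triples at each vertex; this forces
-- every vertex to see more than half of exactly two colour classes, so that H
-- is homomorphic to C₅ and, by minimality, is its full blow-up.  Among the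
-- blow-ups, with part sizes n/5 plus small yᵢ, minimising t₄ amounts to
-- minimising the integral quadratic form 4 ∑ (yᵢ + yᵢ₊₁)² − ∑ yᵢ², whose
-- minimiser for each residue of n modulo 5 is unique up to dihedral symmetry.
module Submission where

open import Defs renaming (sym to adj-sym)
import Data.Bool as Bool
open import Data.Bool using (Bool; true; false; not; _∧_; _∨_; if_then_else_)
open import Data.Bool.Properties using (∧-comm; ∧-assoc; ∧-zeroʳ; ∧-identityʳ; ∨-comm) renaming (_≟_ to _≟ᵇ_)
open import Data.Empty using (⊥; ⊥-elim)
open import Data.Fin using (Fin; zero; suc; _↑ˡ_; _↑ʳ_; splitAt; toℕ; fromℕ<; punchIn; combine; remQuot)
open import Data.Fin.Patterns using (0F; 1F; 2F; 3F; 4F; 5F)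
open import Data.Fin.Permutation using (insert; insert-punchIn; _⟨$⟩ʳ_)
open import Data.Fin.Properties using (all?; splitAt-↑ˡ; splitAt-↑ʳ; toℕ-fromℕ<; remQuot-combine) renaming (_≟_ to _≟ᶠ_)
open import Data.Fin.Subset using (Subset; _∈_) renaming (∣_∣ to ∥_∥)
open import Data.Fin.Subset.Properties using (_∈?_; anySubset?)
open import Data.Integer using (ℤ; +_; -[1+_]; _+_; _*_; _-_; -_; _≤_; _<_; +≤+; -≤+; -≤-; +<+; _≤?_; _≤ᵇ_; ∣_∣; _^_)
open import Data.Integer.Properties
open import Data.Integer.Tactic.RingSolver using (solve-∀)
import Data.List as List
open import Data.List.Properties using (length-++)
open import Data.Nat as ℕ using (ℕ; zero; suc)
open import Data.Nat.Combinatorics using (_C_; nC1≡n; nCk+nC[k+1]≡[n+1]C[k+1])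
import Data.Nat.DivMod as DivMod
import Data.Nat.Properties as ℕₚ
import Data.Nat.Tactic.RingSolver as ℕSolver
open import Data.Product using (Σ; ∃; _×_; _,_; proj₁; proj₂)
open import Data.Sum using (_⊎_; inj₁; inj₂; [_,_]′)
import Data.Vec as Vec
open import Data.Vec using ([]; _∷_; here; there)
open import Data.Vec.Properties using (lookup∘tabulate)
open import Function using (_∘_)
open import Function.Bundles using (_↔_; Inverse)
open import Function.Construct.Identity using (↔-id)
open import Relation.Binary.PropositionalEquality using (_≡_; _≢_; refl; sym; trans; cong; cong₂; subst; module ≡-Reasoning)
open import Relation.Nullary using (Dec; yes; no; does)
open import Relation.Nullary.Decidable using (_×-dec_; _→-dec_; ¬?; ⌊_⌋)
open import Relation.Unary using (Decidable)

-- Tightness dictates the certificate: on the balanced blow-up of C₅ every squared function must sum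
-- to zero at each choice of roots, and only patterns absent from C₅ can be left over as slack.
-- Tuples with repetitions do no harm, because an irreflexive adjacency makes equal vertices look
-- like non-adjacent twins, which keeps the pattern triangle-free. The decisive margin is 139
-- against 120. If κ is half a part of the balanced blow-up, the non-neighbours of a vertex span 120
-- κ³ ordered independent triples; a vertex that also misses half of one further part has 139 κ³.
-- This gap tolerates part sizes known only to within a few percent. The end is delicate because the
-- best sizes are not always as equal as possible. For n ≡ 1 modulo 5 the deviations (-1, 1, 0, 0,
-- 1) give the quadratic form the value 5, while (1, 0, 0, 0, 0) gives 7; for n ≡ 4, (0, 1, 1, 0, 2)
-- gives 50 and (1, 1, 1, 1, 0) gives 52. The exact clique count is therefore expanded, and the form
-- is minimised with a margin that survives the cubic and quartic terms.

-- Integer inequalities and finite sums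

-- The standard device for polynomial inequalities below: the ring solver rewrites the difference of
-- the two sides as an expression whose summands are visibly nonnegative.
≤-from-diff : ∀ {a b e} → b - a ≡ e → + 0 ≤ e → a ≤ b
≤-from-diff {a} {b} eq p = 0≤i-j⇒j≤i (subst (+ 0 ≤_) (sym eq) p)

0≤+ : ∀ {a b} → + 0 ≤ a → + 0 ≤ b → + 0 ≤ a + b
0≤+ p q = +-mono-≤ p q

0≤* : ∀ {a b} → + 0 ≤ a → + 0 ≤ b → + 0 ≤ a * b
0≤* {+ m} {+ n} _ _ = subst (+ 0 ≤_) (pos-* m n) (+≤+ ℕ.z≤n)

0≤sq : ∀ a → + 0 ≤ a * a
0≤sq (+ n) = 0≤* {+ n} {+ n} (+≤+ ℕ.z≤n) (+≤+ ℕ.z≤n)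
0≤sq -[1+ n ] = +≤+ ℕ.z≤n

*-monoˡ : ∀ {c a b} → + 0 ≤ c → a ≤ b → c * a ≤ c * b
*-monoˡ {c} {a} {b} p q = ≤-from-diff (eq c a b) (0≤* p (i≤j⇒0≤j-i q))
  where
  eq : ∀ c a b → c * b - c * a ≡ c * (b - a)
  eq = solve-∀

*-mono : ∀ {a b c d} → + 0 ≤ a → + 0 ≤ c → a ≤ b → c ≤ d → a * c ≤ b * d
*-mono {a} {b} {c} {d} p q r s =
  ≤-from-diff (eq a b c d) (0≤+ (0≤* p (i≤j⇒0≤j-i s)) (0≤* (i≤j⇒0≤j-i r) (≤-trans q s)))
  where
  eq : ∀ a b c d → b * d - a * c ≡ a * (d - c) + (b - a) * d
  eq = solve-∀

ι : Bool → ℤ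
ι true = + 1
ι false = + 0

0≤ι : ∀ b → + 0 ≤ ι b
0≤ι true = +≤+ ℕ.z≤n
0≤ι false = +≤+ ℕ.z≤n

ι≤1 : ∀ b → ι b ≤ + 1
ι≤1 true = ≤-refl
ι≤1 false = +≤+ ℕ.z≤n

ι-∧ : ∀ a b → ι (a ∧ b) ≡ ι a * ι b
ι-∧ true true = refl
ι-∧ true false = refl
ι-∧ false b = refl

∑ : ∀ {n} → (Fin n → ℤ) → ℤ
∑ {zero} f = + 0
∑ {suc n} f = f zero + ∑ (λ i → f (suc i))

∑-cong : ∀ {n} {f g : Fin n → ℤ} → (∀ i → f i ≡ g i) → ∑ f ≡ ∑ g
∑-cong {zero} p = refl
∑-cong {suc n} p = cong₂ _+_ (p zero) (∑-cong (λ i → p (suc i)))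

∑-mono : ∀ {n} {f g : Fin n → ℤ} → (∀ i → f i ≤ g i) → ∑ f ≤ ∑ g
∑-mono {zero} p = ≤-refl
∑-mono {suc n} p = +-mono-≤ (p zero) (∑-mono (λ i → p (suc i)))

∑-*ˡ : ∀ {n} c (f : Fin n → ℤ) → ∑ (λ i → c * f i) ≡ c * ∑ f
∑-*ˡ {zero} c f = sym (*-zeroʳ c)
∑-*ˡ {suc n} c f =
  trans (cong (λ x → c * f zero + x) (∑-*ˡ c (λ i → f (suc i)))) (sym (*-distribˡ-+ c (f zero) _))

∑-*ʳ : ∀ {n} c (f : Fin n → ℤ) → ∑ (λ i → f i * c) ≡ ∑ f * c
∑-*ʳ c f = trans (∑-cong (λ i → *-comm (f i) c)) (trans (∑-*ˡ c f) (*-comm c (∑ f)))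

∑-+ : ∀ {n} (f g : Fin n → ℤ) → ∑ (λ i → f i + g i) ≡ ∑ f + ∑ g
∑-+ {zero} f g = refl
∑-+ {suc n} f g =
  trans (cong (λ x → (f zero + g zero) + x) (∑-+ (λ i → f (suc i)) (λ i → g (suc i))))
    (eq (f zero) (g zero) _ _)
  where
  eq : ∀ a b c d → (a + b) + (c + d) ≡ (a + c) + (b + d)
  eq = solve-∀

∑-const : ∀ n c → ∑ {n} (λ _ → c) ≡ + n * c
∑-const zero c = refl
∑-const (suc n) c = trans (cong (λ x → c + x) (∑-const n c)) (eq (+ n) c)
  where
  eq : ∀ n c → c + n * c ≡ (+ 1 + n) * c
  eq = solve-∀

∑-zero : ∀ n → ∑ {n} (λ _ → + 0) ≡ + 0
∑-zero n = trans (∑-const n (+ 0)) (*-zeroʳ (+ n))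

∑-nonneg : ∀ {n} {f : Fin n → ℤ} → (∀ i → + 0 ≤ f i) → + 0 ≤ ∑ f
∑-nonneg {n} p = ≤-trans (≤-reflexive (sym (∑-zero n))) (∑-mono p)

∑-comm : ∀ {m n} (f : Fin m → Fin n → ℤ) → ∑ (λ i → ∑ λ j → f i j) ≡ ∑ (λ j → ∑ λ i → f i j)
∑-comm {zero} {n} f = sym (∑-zero n)
∑-comm {suc m} f =
  trans (cong (λ x → ∑ (f zero) + x) (∑-comm (λ i → f (suc i)))) (sym (∑-+ (f zero) _))

∑-bound : ∀ {n} {f : Fin n → ℤ} {c} → (∀ i → f i ≤ c) → ∑ f ≤ + n * c
∑-bound {n} {c = c} p = ≤-trans (∑-mono p) (≤-reflexive (∑-const n c))

∑-minus : ∀ {n} (f g : Fin n → ℤ) → ∑ (λ i → f i - g i) ≡ ∑ f - ∑ g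
∑-minus {zero} f g = refl
∑-minus {suc n} f g =
  trans (cong (λ x → (f zero - g zero) + x) (∑-minus (λ i → f (suc i)) (λ i → g (suc i))))
    (eq (f zero) (g zero) _ _)
  where
  eq : ∀ a b c d → (a - b) + (c - d) ≡ (a + c) - (b + d)
  eq = solve-∀

∑-strict : ∀ {n} {f g : Fin n → ℤ} → (∀ i → f i ≤ g i) → ∀ j → f j < g j → ∑ f < ∑ g
∑-strict {suc n} p zero q = +-mono-<-≤ q (∑-mono (λ i → p (suc i)))
∑-strict {suc n} p (suc j) q = +-mono-≤-< (p zero) (∑-strict (λ i → p (suc i)) j q)

∑-pos⇒∃ : ∀ {n} (f : Fin n → ℤ) → + 0 < ∑ f → ∃ λ i → + 0 < f i
∑-pos⇒∃ {zero} f (+<+ ())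
∑-pos⇒∃ {suc n} f p with f zero ≤? + 0
... | no q = zero , ≰⇒> q
... | yes q with ∑-pos⇒∃ (λ i → f (suc i)) (<-≤-trans p (≤-trans (+-monoˡ-≤ _ q) (≤-reflexive (+-identityˡ _))))
... | i , r = suc i , r

∑-neg⇒∃ : ∀ {n} (f : Fin n → ℤ) → ∑ f < + 0 → ∃ λ i → f i < + 0
∑-neg⇒∃ {zero} f (+<+ ())
∑-neg⇒∃ {suc n} f p with + 0 ≤? f zero
... | no q = zero , ≰⇒> q
... | yes q with ∑-neg⇒∃ (λ i → f (suc i)) (≤-<-trans (≤-trans (≤-reflexive (sym (+-identityˡ _))) (+-monoˡ-≤ _ q)) p)
... | i , r = suc i , r

∑-product : ∀ {m n} (f : Fin m → ℤ) (g : Fin n → ℤ) → ∑ (λ i → ∑ λ j → f i * g j) ≡ ∑ f * ∑ g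
∑-product f g = trans (∑-cong (λ i → ∑-*ˡ (f i) g)) (∑-*ʳ (∑ g) f)

term≤∑ : ∀ {n} (f : Fin n → ℤ) → (∀ i → + 0 ≤ f i) → ∀ i → f i ≤ ∑ f
term≤∑ f p zero = ≤-trans (≤-reflexive (sym (+-identityʳ _))) (+-monoʳ-≤ (f zero) (∑-nonneg (λ i → p (suc i))))
term≤∑ f p (suc i) =
  ≤-trans (≤-reflexive (sym (+-identityˡ _))) (+-mono-≤ (p zero) (term≤∑ (λ i → f (suc i)) (λ i → p (suc i)) i))

_≡ᵇ_ : ∀ {n} → Fin n → Fin n → Bool
zero ≡ᵇ zero = true
zero ≡ᵇ suc j = false
suc i ≡ᵇ zero = false
suc i ≡ᵇ suc j = i ≡ᵇ j

≡ᵇ-refl : ∀ {n} (i : Fin n) → (i ≡ᵇ i) ≡ true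
≡ᵇ-refl zero = refl
≡ᵇ-refl (suc i) = ≡ᵇ-refl i

≡ᵇ⇒≡ : ∀ {n} (i j : Fin n) → (i ≡ᵇ j) ≡ true → i ≡ j
≡ᵇ⇒≡ zero zero _ = refl
≡ᵇ⇒≡ (suc i) (suc j) p = cong suc (≡ᵇ⇒≡ i j p)

≢⇒≡ᵇ : ∀ {n} {i j : Fin n} → i ≢ j → (i ≡ᵇ j) ≡ false
≢⇒≡ᵇ {i = i} {j} p with i ≡ᵇ j in eq
... | true = ⊥-elim (p (≡ᵇ⇒≡ i j eq))
... | false = refl

≡ᵇ-sym : ∀ {n} (i j : Fin n) → (i ≡ᵇ j) ≡ (j ≡ᵇ i)
≡ᵇ-sym zero zero = refl
≡ᵇ-sym zero (suc j) = refl
≡ᵇ-sym (suc i) zero = refl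
≡ᵇ-sym (suc i) (suc j) = ≡ᵇ-sym i j

∑-δ : ∀ {n} v (f : Fin n → ℤ) → ∑ (λ i → ι (i ≡ᵇ v) * f i) ≡ f v
∑-δ {suc n} zero f =
  trans (cong₂ _+_ (*-identityˡ (f zero)) (∑-zero n)) (+-identityʳ (f zero))
∑-δ {suc n} (suc v) f = trans (+-identityˡ _) (∑-δ v (λ i → f (suc i)))

∑-push : ∀ {n k} (c : Fin n → Fin k) (ψ : Fin n → ℤ) (g : Fin k → ℤ) →
  ∑ (λ p → ψ p * g (c p)) ≡ ∑ (λ i → ∑ (λ p → ι (i ≡ᵇ c p) * ψ p) * g i)
∑-push c ψ g = begin
  ∑ (λ p → ψ p * g (c p))
    ≡⟨ ∑-cong (λ p → sym (∑-δ (c p) (λ i → ψ p * g i))) ⟩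
  ∑ (λ p → ∑ λ i → ι (i ≡ᵇ c p) * (ψ p * g i))
    ≡⟨ ∑-comm (λ p i → ι (i ≡ᵇ c p) * (ψ p * g i)) ⟩
  ∑ (λ i → ∑ λ p → ι (i ≡ᵇ c p) * (ψ p * g i))
    ≡⟨ ∑-cong (λ i → trans (∑-cong (λ p → sym (*-assoc (ι (i ≡ᵇ c p)) (ψ p) (g i)))) (∑-*ʳ (g i) (λ p → ι (i ≡ᵇ c p) * ψ p))) ⟩
  ∑ (λ i → ∑ (λ p → ι (i ≡ᵇ c p) * ψ p) * g i) ∎
  where open ≡-Reasoning

-- Counting ordered cliques

Adj : ℕ → Set
Adj n = Fin n → Fin n → Bool

Symm : ∀ {n} → Adj n → Set
Symm A = ∀ i j → A i j ≡ A j i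

Irrefl : ∀ {n} → Adj n → Set
Irrefl A = ∀ i → A i i ≡ false

-- The number of ordered `k`-cliques inside `Φ`: choosing a vertex shrinks `Φ` to its neighbourhood.
-- Distinctness is not imposed, so for an adjacency that contains the diagonal the same function
-- counts tuples with repetitions.
T : ∀ {n} → Adj n → ℕ → (Fin n → Bool) → ℤ
T A zero Φ = + 1
T A (suc k) Φ = ∑ λ v → ι (Φ v) * T A k (λ w → Φ w ∧ A v w)

everything : ∀ {n} → Fin n → Bool
everything _ = true

_∖_ : ∀ {n} → (Fin n → Bool) → Fin n → Fin n → Bool
(Φ ∖ v) w = Φ w ∧ not (w ≡ᵇ v)

0≤T : ∀ {n} (A : Adj n) k Φ → + 0 ≤ T A k Φ
0≤T A zero Φ = +≤+ ℕ.z≤n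
0≤T A (suc k) Φ = ∑-nonneg λ v → 0≤* (0≤ι (Φ v)) (0≤T A k _)

T-cong : ∀ {n} {A B : Adj n} k {Φ Ψ} → (∀ i j → A i j ≡ B i j) → (∀ i → Φ i ≡ Ψ i) → T A k Φ ≡ T B k Ψ
T-cong zero p q = refl
T-cong (suc k) p q =
  ∑-cong λ v → cong₂ (λ x y → ι x * y) (q v) (T-cong k p (λ w → cong₂ _∧_ (q w) (p v w)))

T-congˢ : ∀ {n} (A : Adj n) k {Φ Ψ} → (∀ i → Φ i ≡ Ψ i) → T A k Φ ≡ T A k Ψ
T-congˢ A k = T-cong {A = A} {B = A} k (λ _ _ → refl)

∑-split : ∀ {n} v (f : Fin n → ℤ) → ∑ f ≡ f v + ∑ (λ w → ι (not (w ≡ᵇ v)) * f w)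
∑-split v f = begin
  ∑ f
    ≡⟨ ∑-cong (λ w → split (w ≡ᵇ v) (f w)) ⟩
  ∑ (λ w → ι (w ≡ᵇ v) * f w + ι (not (w ≡ᵇ v)) * f w)
    ≡⟨ ∑-+ (λ w → ι (w ≡ᵇ v) * f w) (λ w → ι (not (w ≡ᵇ v)) * f w) ⟩
  ∑ (λ w → ι (w ≡ᵇ v) * f w) + ∑ (λ w → ι (not (w ≡ᵇ v)) * f w)
    ≡⟨ cong (λ x → x + ∑ (λ w → ι (not (w ≡ᵇ v)) * f w)) (∑-δ v f) ⟩
  f v + ∑ (λ w → ι (not (w ≡ᵇ v)) * f w) ∎
  where
  open ≡-Reasoning
  split : ∀ b x → x ≡ ι b * x + ι (not b) * x
  split true x = sym (trans (cong (λ y → y + + 0) (*-identityˡ x)) (+-identityʳ x))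
  split false x = sym (trans (+-identityˡ _) (*-identityˡ x))

-- A k-clique avoids v or has v in one of its k places.
T-remove : ∀ {n} (A : Adj n) → Symm A → Irrefl A → ∀ k Φ v →
  T A (suc k) Φ ≡ T A (suc k) (Φ ∖ v) + + suc k * (ι (Φ v) * T A k (λ w → Φ w ∧ A v w))
T-remove A sy ir zero Φ v = begin
  ∑ (λ w → ι (Φ w) * + 1)
    ≡⟨ ∑-split v (λ w → ι (Φ w) * + 1) ⟩
  ι (Φ v) * + 1 + ∑ (λ w → ι (not (w ≡ᵇ v)) * (ι (Φ w) * + 1))
    ≡⟨ cong (λ x → ι (Φ v) * + 1 + x) (∑-cong (λ w → aux (Φ w) (w ≡ᵇ v))) ⟩
  ι (Φ v) * + 1 + ∑ (λ w → ι (Φ w ∧ not (w ≡ᵇ v)) * + 1)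
    ≡⟨ fin (ι (Φ v)) _ ⟩
  ∑ (λ w → ι (Φ w ∧ not (w ≡ᵇ v)) * + 1) + + 1 * (ι (Φ v) * + 1) ∎
  where
  open ≡-Reasoning
  aux : ∀ a b → ι (not b) * (ι a * + 1) ≡ ι (a ∧ not b) * + 1
  aux true true = refl
  aux true false = refl
  aux false true = refl
  aux false false = refl
  fin : ∀ a s → a * + 1 + s ≡ s + + 1 * (a * + 1)
  fin = solve-∀
T-remove {n} A sy ir (suc k) Φ v = begin
  ∑ (λ w → ι (Φ w) * T A (suc k) (Φ ∩ w))
    ≡⟨ ∑-cong (λ w → trans (cong (λ x → ι (Φ w) * x) (T-remove A sy ir k (Φ ∩ w) v)) (step w)) ⟩
  ∑ (λ w → ι (Φ w) * R w + + suc k * ι (Φ v) * (ι (Φ w ∧ A v w) * T A k (λ u → (Φ ∩ v) u ∧ A w u)))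
    ≡⟨ ∑-+ (λ w → ι (Φ w) * R w) _ ⟩
  ∑ (λ w → ι (Φ w) * R w) + ∑ (λ w → + suc k * ι (Φ v) * (ι (Φ w ∧ A v w) * T A k (λ u → (Φ ∩ v) u ∧ A w u)))
    ≡⟨ cong₂ _+_ first (∑-*ˡ {n} (+ suc k * ι (Φ v)) _) ⟩
  (ι (Φ v) * X + T A (suc (suc k)) (Φ ∖ v)) + + suc k * ι (Φ v) * X
    ≡⟨ fin (ι (Φ v)) X (T A (suc (suc k)) (Φ ∖ v)) (+ suc k) ⟩
  T A (suc (suc k)) (Φ ∖ v) + + suc (suc k) * (ι (Φ v) * X) ∎
  where
  open ≡-Reasoning
  _∩_ : (Fin _ → Bool) → Fin _ → Fin _ → Bool
  (Ψ ∩ w) u = Ψ u ∧ A w u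
  R : Fin _ → ℤ
  R w = T A (suc k) ((Φ ∩ w) ∖ v)
  X = T A (suc k) (Φ ∩ v)
  fin : ∀ a x t s → (a * x + t) + s * a * x ≡ t + (+ 1 + s) * (a * x)
  fin = solve-∀
  rearr : ∀ a r s b y → a * (r + s * (b * y)) ≡ a * r + s * (a * b * y)
  rearr = solve-∀
  rearr₂ : ∀ s a b y → s * (a * b * y) ≡ s * a * (b * y)
  rearr₂ = solve-∀
  swap∧ : ∀ a b c → (a ∧ b) ∧ c ≡ (a ∧ c) ∧ b
  swap∧ a b c = trans (∧-assoc a b c) (trans (cong (a ∧_) (∧-comm b c)) (sym (∧-assoc a c b)))
  ι-swap : ∀ a b c → ι a * ι (b ∧ c) ≡ ι b * ι (a ∧ c)
  ι-swap true true c = refl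
  ι-swap true false c = refl
  ι-swap false true c = refl
  ι-swap false false c = refl
  step : ∀ w → ι (Φ w) * (R w + + suc k * (ι ((Φ ∩ w) v) * T A k (λ u → (Φ ∩ w) u ∧ A v u)))
    ≡ ι (Φ w) * R w + + suc k * ι (Φ v) * (ι (Φ w ∧ A v w) * T A k (λ u → (Φ ∩ v) u ∧ A w u))
  step w = trans (rearr (ι (Φ w)) (R w) (+ suc k) (ι (Φ v ∧ A w v)) _)
    (cong (λ x → ι (Φ w) * R w + x)
      (trans
        (cong₂ (λ x y → + suc k * (x * y))
          (trans (ι-swap (Φ w) (Φ v) (A w v)) (cong (λ z → ι (Φ v) * ι (Φ w ∧ z)) (sy w v)))
          (T-congˢ A k (λ u → swap∧ (Φ u) (A w u) (A v u))))
        (rearr₂ (+ suc k) (ι (Φ v)) (ι (Φ w ∧ A v w)) _)))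
  first : ∑ (λ w → ι (Φ w) * R w) ≡ ι (Φ v) * X + T A (suc (suc k)) (Φ ∖ v)
  first = trans (∑-split v (λ w → ι (Φ w) * R w)) (cong₂ _+_
    (cong (λ x → ι (Φ v) * x) (T-congˢ A (suc k) removed))
    (∑-cong λ w → trans (sym (*-assoc (ι (not (w ≡ᵇ v))) (ι (Φ w)) (R w)))
      (cong₂ _*_ (ι-not (w ≡ᵇ v) (Φ w)) (T-congˢ A (suc k) (λ u → swap∧ (Φ u) (A w u) (not (u ≡ᵇ v)))))))
    where
    ι-not : ∀ a b → ι (not a) * ι b ≡ ι (b ∧ not a)
    ι-not true true = refl
    ι-not true false = refl
    ι-not false true = refl
    ι-not false false = refl
    removed : ∀ u → ((Φ ∩ v) ∖ v) u ≡ (Φ ∩ v) u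
    removed u with u ≡ᵇ v in eq
    ... | false = ∧-identityʳ _
    ... | true rewrite ≡ᵇ⇒≡ u v eq | ir v | ∧-zeroʳ (Φ v) = refl

T-tail : ∀ {n} (A : Adj (suc n)) k Φ → Φ zero ≡ false →
  T A k Φ ≡ T (λ i j → A (suc i) (suc j)) k (λ i → Φ (suc i))
T-tail A zero Φ p = refl
T-tail A (suc k) Φ p =
  trans (cong₂ _+_ (cong (λ b → ι b * T A k (λ w → Φ w ∧ A zero w)) p) (∑-cong λ v → cong (λ x → ι (Φ (suc v)) * x)
    (T-tail A k (λ w → Φ w ∧ A (suc v) w) (cong (λ b → b ∧ A (suc v) zero) p)))) (+-identityˡ _)

-- A clique test by recursion on the subset, so that its two branches match the removal of vertex
-- `zero` in `T-remove`.
isCliqueᵇ : ∀ {n} → Adj n → (Fin n → Bool) → ℕ → Subset n → Bool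
isCliqueᵇ A Φ k (false ∷ S) = isCliqueᵇ (λ i j → A (suc i) (suc j)) (λ i → Φ (suc i)) k S
isCliqueᵇ A Φ zero [] = true
isCliqueᵇ A Φ (suc k) [] = false
isCliqueᵇ A Φ zero (true ∷ S) = false
isCliqueᵇ A Φ (suc k) (true ∷ S) =
  Φ zero ∧ isCliqueᵇ (λ i j → A (suc i) (suc j)) (λ i → Φ (suc i) ∧ A zero (suc i)) k S

count : ∀ {n} → (Subset n → Bool) → ℤ
count {zero} p = ι (p [])
count {suc n} p = count (λ S → p (true ∷ S)) + count (λ S → p (false ∷ S))

count-cong : ∀ {n} {p q : Subset n → Bool} → (∀ S → p S ≡ q S) → count p ≡ count q
count-cong {zero} e = cong ι (e [])
count-cong {suc n} e = cong₂ _+_ (count-cong (λ S → e (true ∷ S))) (count-cong (λ S → e (false ∷ S)))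

count-false : ∀ {n} → count {n} (λ _ → false) ≡ + 0
count-false {zero} = refl
count-false {suc n} = cong₂ _+_ (count-false {n}) (count-false {n})

count-∧ : ∀ {n} b (p : Subset n → Bool) → count (λ S → b ∧ p S) ≡ ι b * count p
count-∧ true p = sym (*-identityˡ _)
count-∧ {n} false p = count-false {n}

0≤count : ∀ {n} (p : Subset n → Bool) → + 0 ≤ count p
0≤count {zero} p = 0≤ι (p [])
0≤count {suc n} p = 0≤+ (0≤count (λ S → p (true ∷ S))) (0≤count (λ S → p (false ∷ S)))

count-pos : ∀ {n} (p : Subset n → Bool) S → p S ≡ true → + 1 ≤ count p
count-pos p [] e = ≤-reflexive (sym (cong ι e))
count-pos p (true ∷ S) e =
  ≤-trans (count-pos (λ S → p (true ∷ S)) S e) (≤-trans (≤-reflexive (sym (+-identityʳ _)))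
    (+-monoʳ-≤ (count (λ S → p (true ∷ S))) (0≤count (λ S → p (false ∷ S)))))
count-pos p (false ∷ S) e =
  ≤-trans (count-pos (λ S → p (false ∷ S)) S e) (≤-trans (≤-reflexive (sym (+-identityˡ _)))
    (+-monoˡ-≤ (count (λ S → p (false ∷ S))) (0≤count (λ S → p (true ∷ S)))))

factorial : ℕ → ℤ
factorial zero = + 1
factorial (suc k) = + suc k * factorial k

-- Induction on the number of vertices. `T-remove` at vertex `zero` splits off the cliques through
-- it, and its factor `suc k` builds up the factorial.
T≡count : ∀ {n} (A : Adj n) → Symm A → Irrefl A → ∀ k Φ → T A k Φ ≡ factorial k * count (isCliqueᵇ A Φ k)
T≡count {zero} A sy ir zero Φ = refl
T≡count {zero} A sy ir (suc k) Φ = sym (*-zeroʳ (factorial (suc k)))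
T≡count {suc n} A sy ir zero Φ =
  trans (T≡count (λ i j → A (suc i) (suc j)) (λ i j → sy (suc i) (suc j)) (λ i → ir (suc i)) zero (λ i → Φ (suc i)))
    (cong (λ x → + 1 * x) (sym (trans (cong (λ x → x + count (isCliqueᵇ (λ i j → A (suc i) (suc j)) (λ i → Φ (suc i)) zero)) (count-false {n}))
      (+-identityˡ _))))
T≡count {suc n} A sy ir (suc k) Φ = begin
  T A (suc k) Φ
    ≡⟨ T-remove A sy ir k Φ zero ⟩
  T A (suc k) (Φ ∖ zero) + + suc k * (ι (Φ zero) * T A k (λ w → Φ w ∧ A zero w))
    ≡⟨ cong₂ (λ x y → x + + suc k * (ι (Φ zero) * y)) lhs rhs ⟩
  factorial (suc k) * c₁ + + suc k * (ι (Φ zero) * (factorial k * c₂))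
    ≡⟨ fin (+ suc k) (factorial k) c₁ (ι (Φ zero)) c₂ ⟩
  factorial (suc k) * (ι (Φ zero) * c₂ + c₁)
    ≡⟨ cong (λ x → factorial (suc k) * (x + c₁)) (sym (count-∧ (Φ zero) (isCliqueᵇ A′ (λ i → Φ (suc i) ∧ A zero (suc i)) k))) ⟩
  factorial (suc k) * count (isCliqueᵇ A Φ (suc k)) ∎
  where
  open ≡-Reasoning
  A′ : Adj n
  A′ i j = A (suc i) (suc j)
  c₁ = count (isCliqueᵇ A′ (λ i → Φ (suc i)) (suc k))
  c₂ = count (isCliqueᵇ A′ (λ i → Φ (suc i) ∧ A zero (suc i)) k)
  IH : ∀ k Ψ → T A′ k Ψ ≡ factorial k * count (isCliqueᵇ A′ Ψ k)
  IH = T≡count A′ (λ i j → sy (suc i) (suc j)) (λ i → ir (suc i))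
  lhs : T A (suc k) (Φ ∖ zero) ≡ factorial (suc k) * c₁
  lhs = trans (T-tail A (suc k) (Φ ∖ zero) (∧-zeroʳ (Φ zero)))
    (trans (T-congˢ A′ (suc k) (λ i → ∧-identityʳ (Φ (suc i)))) (IH (suc k) (λ i → Φ (suc i))))
  rhs : T A k (λ w → Φ w ∧ A zero w) ≡ factorial k * c₂
  rhs = trans (T-tail A k (λ w → Φ w ∧ A zero w) (trans (cong (Φ zero ∧_) (ir zero)) (∧-zeroʳ (Φ zero)))) (IH k _)
  fin : ∀ s f c a d → s * f * c + s * (a * (f * d)) ≡ s * f * (a * d + c)
  fin = solve-∀

∧-true : ∀ {a b} → a ∧ b ≡ true → a ≡ true × b ≡ true
∧-true {true} {true} _ = refl , refl

isCliqueᵇ-sound : ∀ {n} (A : Adj n) → Symm A → ∀ Φ k S → isCliqueᵇ A Φ k S ≡ true →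
  ∥ S ∥ ≡ k × (∀ i → i ∈ S → Φ i ≡ true) × (∀ i j → i ∈ S → j ∈ S → i ≢ j → A i j ≡ true)
isCliqueᵇ-sound A sy Φ zero [] e = refl , (λ _ ()) , (λ _ _ ())
isCliqueᵇ-sound A sy Φ k (false ∷ S) e
  with isCliqueᵇ-sound (λ i j → A (suc i) (suc j)) (λ i j → sy (suc i) (suc j)) (λ i → Φ (suc i)) k S e
... | s , p , q = s , p′ , q′
  where
  p′ : ∀ i → i ∈ (false ∷ S) → Φ i ≡ true
  p′ (suc i) (there m) = p i m
  q′ : ∀ i j → i ∈ (false ∷ S) → j ∈ (false ∷ S) → i ≢ j → A i j ≡ true
  q′ (suc i) (suc j) (there m) (there l) i≢j = q i j m l (i≢j ∘ cong suc)
isCliqueᵇ-sound A sy Φ (suc k) (true ∷ S) e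
  with ∧-true e
... | e₁ , e₂
  with isCliqueᵇ-sound (λ i j → A (suc i) (suc j)) (λ i j → sy (suc i) (suc j)) _ k S e₂
... | s , p , q = cong suc s , p′ , q′
  where
  p′ : ∀ i → i ∈ (true ∷ S) → Φ i ≡ true
  p′ zero here = e₁
  p′ (suc i) (there m) = proj₁ (∧-true (p i m))
  q′ : ∀ i j → i ∈ (true ∷ S) → j ∈ (true ∷ S) → i ≢ j → A i j ≡ true
  q′ zero zero _ _ i≢j = ⊥-elim (i≢j refl)
  q′ zero (suc j) _ (there l) _ = proj₂ (∧-true (p j l))
  q′ (suc i) zero (there m) _ _ = trans (sy (suc i) zero) (proj₂ (∧-true (p i m)))
  q′ (suc i) (suc j) (there m) (there l) i≢j = q i j m l (i≢j ∘ cong suc)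

isCliqueᵇ-complete : ∀ {n} (A : Adj n) Φ k S → ∥ S ∥ ≡ k → (∀ i → i ∈ S → Φ i ≡ true) →
  (∀ i j → i ∈ S → j ∈ S → i ≢ j → A i j ≡ true) → isCliqueᵇ A Φ k S ≡ true
isCliqueᵇ-complete A Φ _ [] refl p q = refl
isCliqueᵇ-complete A Φ k (false ∷ S) e p q =
  isCliqueᵇ-complete _ _ k S e (λ i m → p (suc i) (there m))
    (λ i j m l i≢j → q (suc i) (suc j) (there m) (there l) (λ { refl → i≢j refl }))
isCliqueᵇ-complete A Φ _ (true ∷ S) refl p q =
  cong₂ _∧_ (p zero here) (isCliqueᵇ-complete _ _ ∥ S ∥ S refl
    (λ i m → cong₂ _∧_ (p (suc i) (there m)) (q zero (suc i) here (there m) λ ()))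
    (λ i j m l i≢j → q (suc i) (suc j) (there m) (there l) (λ { refl → i≢j refl })))

length-filter : ∀ {n} {P : Subset n → Set} (P? : Decidable P) →
  + List.length (List.filter P? (allSubsets n)) ≡ count (λ S → does (P? S))
length-filter {zero} P? with does (P? [])
... | true = refl
... | false = refl
length-filter {suc n} P? =
  trans (cong (λ xs → + List.length xs) (filter-++ (List.map (true ∷_) (allSubsets n)) _))
    (trans (cong +_ (length-++ (List.filter P? (List.map (true ∷_) (allSubsets n)))))
      (trans (pos-+ (List.length (List.filter P? (List.map (true ∷_) (allSubsets n)))) (List.length (List.filter P? (List.map (false ∷_) (allSubsets n))))) (cong₂ _+_ (part true) (part false))))
  where
  filter-++ : ∀ xs ys → List.filter P? (xs List.++ ys) ≡ List.filter P? xs List.++ List.filter P? ys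
  filter-++ List.[] ys = refl
  filter-++ (x List.∷ xs) ys with does (P? x)
  ... | true = cong (x List.∷_) (filter-++ xs ys)
  ... | false = filter-++ xs ys
  filter-map : ∀ b xs → List.length (List.filter P? (List.map (b ∷_) xs)) ≡ List.length (List.filter (λ S → P? (b ∷ S)) xs)
  filter-map b List.[] = refl
  filter-map b (x List.∷ xs) with does (P? (b ∷ x))
  ... | true = cong suc (filter-map b xs)
  ... | false = filter-map b xs
  part : ∀ b → + List.length (List.filter P? (List.map (b ∷_) (allSubsets n))) ≡ count (λ S → does (P? (b ∷ S)))
  part b = trans (cong +_ (filter-map b (allSubsets n))) (length-filter (λ S → P? (b ∷ S)))

does-≡ : ∀ {P : Set} (d : Dec P) b → (P → b ≡ true) → (b ≡ true → P) → does d ≡ b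
does-≡ (yes p) b f g = sym (f p)
does-≡ (no ¬p) true f g = ⊥-elim (¬p (g refl))
does-≡ (no ¬p) false f g = refl

T≡t : ∀ {n} (G : Graph n) k → T (adj G) k everything ≡ factorial k * + t k G
T≡t {n} G k = trans (T≡count (adj G) (adj-sym G) (irrefl G) k everything)
  (cong (factorial k *_) (sym (trans (length-filter {n} (λ S → (∥ S ∥ ℕₚ.≟ k) ×-dec isClique? G S)) (count-cong λ S → does-≡ ((∥ S ∥ ℕₚ.≟ k) ×-dec isClique? G S) _
    (λ (s , c) → isCliqueᵇ-complete (adj G) everything k S s (λ _ _ → refl) c)
    (λ e → let (s , _ , c) = isCliqueᵇ-sound (adj G) (adj-sym G) everything k S e in s , c)))))

-- Triangles in the complement

-- The complement of G, in which "α(G) < 3" becomes "triangle-free".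
cmpl : ∀ {n} → Graph n → Adj n
cmpl G i j = not (i ≡ᵇ j) ∧ not (adj G i j)

cmpl-symm : ∀ {n} (G : Graph n) → Symm (cmpl G)
cmpl-symm G i j = cong₂ (λ a b → not a ∧ not b) (≡ᵇ-sym i j) (adj-sym G i j)

cmpl-irrefl : ∀ {n} (G : Graph n) → Irrefl (cmpl G)
cmpl-irrefl G i rewrite ≡ᵇ-refl i = refl

TriFree : ∀ {n} → Adj n → Set
TriFree A = ∀ a b c → A a b ≡ true → A b c ≡ true → A a c ≡ true → ⊥

∑-pos-ι : ∀ {n} (p : Fin n → Bool) (f : Fin n → ℤ) → + 0 < ∑ (λ i → ι (p i) * f i) → ∃ λ i → p i ≡ true × + 0 < f i
∑-pos-ι p f q with ∑-pos⇒∃ (λ i → ι (p i) * f i) q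
... | i , r with p i in eq
... | true = i , eq , subst (+ 0 <_) (*-identityˡ (f i)) r
... | false = ⊥-elim (<-irrefl refl r)

term-ι : ∀ {n} (p : Fin n → Bool) (f : Fin n → ℤ) → (∀ i → + 0 ≤ f i) → ∀ i → p i ≡ true → f i ≤ ∑ (λ i → ι (p i) * f i)
term-ι p f q i e = ≤-trans (≤-reflexive (sym (trans (cong (λ b → ι b * f i) e) (*-identityˡ (f i)))))
  (term≤∑ (λ i → ι (p i) * f i) (λ i → 0≤* (0≤ι (p i)) (q i)) i)

cmpl-true : ∀ {n} (G : Graph n) i j → adj G i j ≡ false → i ≢ j → cmpl G i j ≡ true
cmpl-true G i j e i≢j = cong₂ (λ a b → not a ∧ not b) (≢⇒≡ᵇ i≢j) e

cmpl-adj : ∀ {n} (G : Graph n) i j → cmpl G i j ≡ true → adj G i j ≡ false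
cmpl-adj G i j e with adj G i j | proj₂ (∧-true {not (i ≡ᵇ j)} e)
... | false | _ = refl

T₃-pos : ∀ {n} (A : Adj n) → + 0 < T A 3 everything →
  ∃ λ a → ∃ λ b → ∃ λ c → A a b ≡ true × A b c ≡ true × A a c ≡ true
T₃-pos A p
  with ∑-pos-ι everything (λ v → T A 2 (λ w → true ∧ A v w)) p
... | a , _ , p₁ with ∑-pos-ι (λ w → true ∧ A a w) (λ v → T A 1 (λ w → (true ∧ A a w) ∧ A v w)) p₁
... | b , ab , p₂ with ∑-pos-ι (λ w → (true ∧ A a w) ∧ A b w) (λ v → T A 0 (λ w → ((true ∧ A a w) ∧ A b w) ∧ A v w)) p₂
... | c , abc , _ = a , b , c , ab , proj₂ (∧-true {true ∧ A a c} abc) , proj₁ (∧-true {true ∧ A a c} abc)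

triangle⇒T₃ : ∀ {n} (A : Adj n) a b c → A a b ≡ true → A b c ≡ true → A a c ≡ true → + 1 ≤ T A 3 everything
triangle⇒T₃ A a b c ab bc ac =
  ≤-trans (term-ι (λ w → (true ∧ A a w) ∧ A b w) (λ v → T A 0 (λ w → ((true ∧ A a w) ∧ A b w) ∧ A v w)) (λ _ → +≤+ ℕ.z≤n) c (cong₂ _∧_ ac bc))
    (≤-trans (term-ι (λ w → true ∧ A a w) (λ v → T A 1 (λ w → (true ∧ A a w) ∧ A v w)) (λ v → 0≤T A 1 (λ w → (true ∧ A a w) ∧ A v w)) b ab)
      (term-ι everything (λ v → T A 2 (λ w → true ∧ A v w)) (λ v → 0≤T A 2 (λ w → true ∧ A v w)) a refl))

αLess⇒TriFree : ∀ {n} (G : Graph n) → αLess G 3 → TriFree (cmpl G)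
αLess⇒TriFree {n} G α a b c ab bc ac =
  <-irrefl refl (<-≤-trans (+<+ (ℕ.s≤s ℕ.z≤n)) (≤-trans (triangle⇒T₃ (cmpl G) a b c ab bc ac) (≤-reflexive T≡0)))
  where
  none : ∀ S → isCliqueᵇ (cmpl G) everything 3 S ≡ false
  none S with isCliqueᵇ (cmpl G) everything 3 S in eq
  ... | false = refl
  ... | true with isCliqueᵇ-sound (cmpl G) (cmpl-symm G) everything 3 S eq
  ... | s , _ , q = ⊥-elim (α S s (λ i j m l i≢j → cmpl-adj G i j (q i j m l i≢j)))
  T≡0 : T (cmpl G) 3 everything ≡ + 0
  T≡0 = trans (T≡count (cmpl G) (cmpl-symm G) (cmpl-irrefl G) 3 everything)
    (cong (factorial 3 *_) (trans (count-cong none) (count-false {n})))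

TriFree⇒αLess : ∀ {n} (G : Graph n) → TriFree (cmpl G) → αLess G 3
TriFree⇒αLess {n} G tf S s ind = excluded (T₃-pos (cmpl G) pos)
  where
  c : ℤ
  c = count (isCliqueᵇ (cmpl G) everything 3)
  1≤c : + 1 ≤ c
  1≤c = count-pos (isCliqueᵇ (cmpl G) everything 3) S
    (isCliqueᵇ-complete (cmpl G) everything 3 S s (λ _ _ → refl) (λ i j m l i≢j → cmpl-true G i j (ind i j m l i≢j) i≢j))
  6≤6c : + 6 ≤ factorial 3 * c
  6≤6c = *-monoˡ {+ 6} {+ 1} {c} (+≤+ ℕ.z≤n) 1≤c
  pos : + 0 < T (cmpl G) 3 everything
  pos = <-≤-trans {+ 0} {+ 6} (+<+ (ℕ.s≤s ℕ.z≤n))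
    (≤-trans 6≤6c (≤-reflexive (sym (T≡count (cmpl G) (cmpl-symm G) (cmpl-irrefl G) 3 everything))))
  excluded : (∃ λ a → ∃ λ b → ∃ λ c → cmpl G a b ≡ true × cmpl G b c ≡ true × cmpl G a c ≡ true) → ⊥
  excluded (a , b , c , ab , bc , ac) = tf a b c ab bc ac

-- Proofs by exhaustive evaluation

allᵇ : (Bool → Bool) → Bool
allᵇ p = p true ∧ p false

allᵇ-sound : ∀ p → allᵇ p ≡ true → ∀ b → p b ≡ true
allᵇ-sound p e true = proj₁ (∧-true e)
allᵇ-sound p e false = proj₂ (∧-true {p true} e)

∨-true : ∀ {a b} → a ∨ b ≡ true → a ≡ true ⊎ b ≡ true
∨-true {true} _ = inj₁ refl
∨-true {false} e = inj₂ e

allF anyF : ∀ {n} → (Fin n → Bool) → Bool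
allF {zero} p = true
allF {suc n} p = p zero ∧ allF (λ i → p (suc i))
anyF {zero} p = false
anyF {suc n} p = p zero ∨ anyF (λ i → p (suc i))

allF-sound : ∀ {n} (p : Fin n → Bool) → allF p ≡ true → ∀ i → p i ≡ true
allF-sound p e zero = proj₁ (∧-true e)
allF-sound p e (suc i) = allF-sound (λ i → p (suc i)) (proj₂ (∧-true {p zero} e)) i

allF-complete : ∀ {n} (p : Fin n → Bool) → (∀ i → p i ≡ true) → allF p ≡ true
allF-complete {zero} p h = refl
allF-complete {suc n} p h = cong₂ _∧_ (h zero) (allF-complete (λ i → p (suc i)) (λ i → h (suc i)))

anyF-sound : ∀ {n} (p : Fin n → Bool) → anyF p ≡ true → ∃ λ i → p i ≡ true
anyF-sound {suc n} p e with ∨-true {p zero} e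
... | inj₁ h = zero , h
... | inj₂ h with anyF-sound (λ i → p (suc i)) h
... | i , h′ = suc i , h′

-- Statements about finitely many elements of a finite type are proved by evaluating them everywhere.
module Exhaustive {D : Set} (all : (D → Bool) → Bool) (sound : ∀ p → all p ≡ true → ∀ x → p x ≡ true) where

  Test : ℕ → Set
  Test zero = Bool
  Test (suc n) = D → Test n

  Holds : ∀ n → Test n → Set
  Holds zero b = b ≡ true
  Holds (suc n) f = ∀ x → Holds n (f x)

  exhaust : ∀ n → Test n → Bool
  exhaust zero b = b
  exhaust (suc n) f = all λ x → exhaust n (f x)

  check : ∀ n (f : Test n) → exhaust n f ≡ true → Holds n f
  check zero b e = e
  check (suc n) f e x = check n (f x) (sound (λ x → exhaust n (f x)) e x)

open Exhaustive allᵇ allᵇ-sound using () renaming (exhaust to exhaustᵇ; check to checkᵇ)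

module ExhaustiveFin {k : ℕ} = Exhaustive (allF {k}) allF-sound
open ExhaustiveFin using () renaming (exhaust to exhaustF; check to checkF)

-- Five-vertex patterns and the two certificates

-- A quantity attached to five labelled vertices, as a function of the adjacencies 01, 02, 03, 04, 12, 13, 14, 23, 24, 34.
Pattern : Set → Set
Pattern R = Bool → Bool → Bool → Bool → Bool → Bool → Bool → Bool → Bool → Bool → R

at : ∀ {X R : Set} → Pattern R → (X → X → Bool) → X → X → X → X → X → R
at g A a b c d e = g (A a b) (A a c) (A a d) (A a e) (A b c) (A b d) (A b e) (A c d) (A c e) (A d e)

-- A function of a 3-vertex flag with one root x: the values for no edge, only yz, one edge at x, a path ending in x, a path centred at x.
flag : ℤ → ℤ → ℤ → ℤ → ℤ → Bool → Bool → Bool → ℤ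
flag k₀ k₁ k₂ k₃ k₄ false false false = k₀
flag k₀ k₁ k₂ k₃ k₄ false false true = k₁
flag k₀ k₁ k₂ k₃ k₄ true false false = k₂
flag k₀ k₁ k₂ k₃ k₄ false true false = k₂
flag k₀ k₁ k₂ k₃ k₄ true false true = k₃
flag k₀ k₁ k₂ k₃ k₄ false true true = k₃
flag k₀ k₁ k₂ k₃ k₄ true true false = k₄
flag k₀ k₁ k₂ k₃ k₄ true true true = + 0

-- Normalised so that its sum over y and z is a multiple of deg x - 2n/5.
degreeFlag edgeFlag : Bool → Bool → Bool → ℤ
degreeFlag xy xz yz = (+ 2 - + 5 * ι xy) + (+ 2 - + 5 * ι xz)
edgeFlag = flag (+ 0) (+ 4) (+ 0) (- + 1) (+ 0)

square : (Bool → Bool → Bool → ℤ) → Pattern ℤ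
square φ b01 b02 b03 b04 b12 b13 b14 b23 b24 b34 = φ b01 b02 b12 * φ b03 b04 b34

-- Squares with three roots: τ tests the graph on the roots, φ evaluates the adjacencies of a fourth vertex.
square₃ : (Bool → Bool → Bool → Bool) → (Bool → Bool → Bool → ℤ) → Pattern ℤ
square₃ τ φ b01 b02 b03 b04 b12 b13 b14 b23 b24 b34 = ι (τ b01 b02 b12) * (φ b03 b13 b23 * φ b04 b14 b24)

emptyRoots edgeRoots pathRoots : Bool → Bool → Bool → Bool
emptyRoots b01 b02 b12 = not b01 ∧ not b02 ∧ not b12
edgeRoots b01 b02 b12 = not b01 ∧ not b02 ∧ b12
pathRoots b01 b02 b12 = b01 ∧ b02 ∧ not b12

parity difference weight : Bool → Bool → Bool → ℤ
parity true false false = + 1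
parity false true false = + 1
parity false false true = + 1
parity true true false = - + 1
parity true false true = - + 1
parity false true true = - + 1
parity _ _ _ = + 0
difference r s t = ι t - ι s
weight true _ _ = - + 3
weight false true _ = + 1
weight false false true = + 1
weight false false false = + 4

infixl 6 _⊕_
infixr 7 _⊛_

_⊕_ : Pattern ℤ → Pattern ℤ → Pattern ℤ
(g ⊕ h) b01 b02 b03 b04 b12 b13 b14 b23 b24 b34 = g b01 b02 b03 b04 b12 b13 b14 b23 b24 b34 + h b01 b02 b03 b04 b12 b13 b14 b23 b24 b34

_⊛_ : ℤ → Pattern ℤ → Pattern ℤ
(k ⊛ g) b01 b02 b03 b04 b12 b13 b14 b23 b24 b34 = k * g b01 b02 b03 b04 b12 b13 b14 b23 b24 b34

⟦_⟧ : Pattern Bool → Pattern ℤ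
⟦ p ⟧ b01 b02 b03 b04 b12 b13 b14 b23 b24 b34 = ι (p b01 b02 b03 b04 b12 b13 b14 b23 b24 b34)

one : Pattern ℤ
one _ _ _ _ _ _ _ _ _ _ = + 1

infixl 6 _⊞_

-- Syntax for nonnegative combinations of squares, so that nonnegativity of the sum over all tuples
-- is one induction.
data Squares : Set where
  sq : ℕ → (Bool → Bool → Bool → ℤ) → Squares
  sq₃ : ℕ → (Bool → Bool → Bool → Bool) → (Bool → Bool → Bool → ℤ) → Squares
  _⊞_ : Squares → Squares → Squares

squares : Squares → Pattern ℤ
squares (sq k φ) = + k ⊛ square φ
squares (sq₃ k τ φ) = + k ⊛ square₃ τ φ
squares (s ⊞ s′) = squares s ⊕ squares s′

-- The multipliers need no derivation, since `defect-check` verifies them. Each function occurring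
-- here sums to zero at every admissible choice of roots in the balanced blow-up of C₅: for instance
-- `difference` compares two degrees there, and `parity` cancels because independent roots occupy at
-- most two parts.
restSquares : Squares
restSquares =
  sq 1530 (flag (+ 0) (+ 2) (- + 1) (+ 2) (- + 4))
  ⊞ sq 740 (flag (+ 4) (+ 2) (- + 3) (- + 1) (- + 3))
  ⊞ sq 5 (flag (+ 6) (- + 1) (- + 3) (- + 3) (- + 1))
  ⊞ sq 255 (flag (+ 6) (+ 1) (- + 4) (- + 2) (- + 3))
  ⊞ sq₃ 2340 emptyRoots parity
  ⊞ sq₃ 25400 edgeRoots difference
  ⊞ sq₃ 1670 edgeRoots weight
  ⊞ sq₃ 11130 pathRoots difference

-- Path 1-0-2 and edge 34;  path 0-1-2-3 and isolated vertex 4;  path 0-1-2-3-4;  path 0-1-2-3.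
isP₃K₂ isP₄K₁ isP₅ : Pattern Bool
isP₃K₂ b01 b02 b03 b04 b12 b13 b14 b23 b24 b34 = b01 ∧ b02 ∧ not b03 ∧ not b04 ∧ not b12 ∧ not b13 ∧ not b14 ∧ not b23 ∧ not b24 ∧ b34
isP₄K₁ b01 b02 b03 b04 b12 b13 b14 b23 b24 b34 = b01 ∧ not b02 ∧ not b03 ∧ not b04 ∧ b12 ∧ not b13 ∧ not b14 ∧ b23 ∧ not b24 ∧ not b34
isP₅ b01 b02 b03 b04 b12 b13 b14 b23 b24 b34 = b01 ∧ not b02 ∧ not b03 ∧ not b04 ∧ b12 ∧ not b13 ∧ not b14 ∧ b23 ∧ not b24 ∧ b34

isP₄ : Bool → Bool → Bool → Bool → Bool → Bool → Bool
isP₄ b01 b02 b03 b12 b13 b23 = b01 ∧ b12 ∧ b23 ∧ not b02 ∧ not b03 ∧ not b13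

-- The paths 1-3-4-2 and 1-4-3-2.
isP₄′ isP₄″ : Pattern Bool
isP₄′ b01 b02 b03 b04 b12 b13 b14 b23 b24 b34 = isP₄ b13 b14 b12 b34 b23 b24
isP₄″ b01 b02 b03 b04 b12 b13 b14 b23 b24 b34 = isP₄ b14 b13 b12 b34 b24 b23

independent₄ : Bool → Bool → Bool → Bool → Bool → Bool → Bool
independent₄ b01 b02 b03 b12 b13 b23 = not b01 ∧ ((not b02 ∧ not b12) ∧ ((not b03 ∧ not b13) ∧ not b23))

isIndependent₄ : Pattern Bool
isIndependent₄ b01 b02 b03 b04 b12 b13 b14 b23 b24 b34 = independent₄ b12 b13 b14 b23 b24 b34

-- The inequality 25 · I₄ ≥ 3 n⁴, multiplied by 1000. The fifty copies of each of the two normalised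
-- squares and the three induced patterns are kept out of `restSquares` because their sums are used
-- later as upper bounds.
defect : Pattern ℤ
defect = + 25000 ⊛ ⟦ isIndependent₄ ⟧
  ⊕ (- + 1) ⊛ (+ 3000 ⊛ one ⊕ squares restSquares ⊕ + 50 ⊛ square degreeFlag ⊕ + 50 ⊛ square edgeFlag
    ⊕ ⟦ isP₃K₂ ⟧ ⊕ ⟦ isP₄K₁ ⟧ ⊕ ⟦ isP₅ ⟧)

-- Every term but the paths P₄ and the constant also occurs in `defect` with a positive multiple.
-- Where the defect is small, the constant can thus be balanced only by many induced P₄.
richness : Pattern ℤ
richness = square degreeFlag ⊕ + 8 ⊛ square edgeFlag
  ⊕ + 1000 ⊛ (⟦ isP₃K₂ ⟧ ⊕ ⟦ isP₄′ ⟧ ⊕ ⟦ isP₄″ ⟧) ⊕ (- + 1) ⊛ one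

pairings : ∀ {X : Set} → (X → X → X → X → X → ℤ) → X → X → X → X → X → ℤ
pairings f x a b c d =
  f x a b c d + (f x a c b d + (f x a d b c + (f x b c a d + (f x b d a c + f x c d a b))))

-- Representatives of S₅ modulo the transpositions (1 2) and (3 4), under which defect and richness are invariant up to slack.
symmetrise : ∀ {X : Set} → (X → X → X → X → X → ℤ) → X → X → X → X → X → ℤ
symmetrise f a b c d e =
  pairings f a b c d e + (pairings f b a c d e + (pairings f c a b d e + (pairings f d a b c e + pairings f e a b c d)))

matrix : Pattern (Adj 5)
matrix _ _ _ _ _ _ _ _ _ _ 0F 0F = false
matrix b01 _ _ _ _ _ _ _ _ _ 0F 1F = b01
matrix _ b02 _ _ _ _ _ _ _ _ 0F 2F = b02
matrix _ _ b03 _ _ _ _ _ _ _ 0F 3F = b03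
matrix _ _ _ b04 _ _ _ _ _ _ 0F 4F = b04
matrix b01 _ _ _ _ _ _ _ _ _ 1F 0F = b01
matrix _ _ _ _ _ _ _ _ _ _ 1F 1F = false
matrix _ _ _ _ b12 _ _ _ _ _ 1F 2F = b12
matrix _ _ _ _ _ b13 _ _ _ _ 1F 3F = b13
matrix _ _ _ _ _ _ b14 _ _ _ 1F 4F = b14
matrix _ b02 _ _ _ _ _ _ _ _ 2F 0F = b02
matrix _ _ _ _ b12 _ _ _ _ _ 2F 1F = b12
matrix _ _ _ _ _ _ _ _ _ _ 2F 2F = false
matrix _ _ _ _ _ _ _ b23 _ _ 2F 3F = b23
matrix _ _ _ _ _ _ _ _ b24 _ 2F 4F = b24
matrix _ _ b03 _ _ _ _ _ _ _ 3F 0F = b03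
matrix _ _ _ _ _ b13 _ _ _ _ 3F 1F = b13
matrix _ _ _ _ _ _ _ b23 _ _ 3F 2F = b23
matrix _ _ _ _ _ _ _ _ _ _ 3F 3F = false
matrix _ _ _ _ _ _ _ _ _ b34 3F 4F = b34
matrix _ _ _ b04 _ _ _ _ _ _ 4F 0F = b04
matrix _ _ _ _ _ _ b14 _ _ _ 4F 1F = b14
matrix _ _ _ _ _ _ _ _ b24 _ 4F 2F = b24
matrix _ _ _ _ _ _ _ _ _ b34 4F 3F = b34
matrix _ _ _ _ _ _ _ _ _ _ 4F 4F = false

hasTriangle : Pattern Bool
hasTriangle b01 b02 b03 b04 b12 b13 b14 b23 b24 b34 = (b01 ∧ b12 ∧ b02) ∨ (b01 ∧ b13 ∧ b03) ∨ (b01 ∧ b14 ∧ b04) ∨ (b02 ∧ b23 ∧ b03) ∨ (b02 ∧ b24 ∧ b04) ∨ (b03 ∧ b34 ∧ b04) ∨ (b12 ∧ b23 ∧ b13) ∨ (b12 ∧ b24 ∧ b14) ∨ (b13 ∧ b34 ∧ b14) ∨ (b23 ∧ b34 ∧ b24)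

nonneg-on : Pattern ℤ → Pattern Bool
nonneg-on g b01 b02 b03 b04 b12 b13 b14 b23 b24 b34 =
  hasTriangle b01 b02 b03 b04 b12 b13 b14 b23 b24 b34 ∨ (+ 0 ≤ᵇ symmetrise (at g (matrix b01 b02 b03 b04 b12 b13 b14 b23 b24 b34)) 0F 1F 2F 3F 4F)

all-patterns : Pattern Bool → Bool
all-patterns = exhaustᵇ 10

defect-check : all-patterns (nonneg-on defect) ≡ true
defect-check = refl

richness-check : all-patterns (nonneg-on richness) ≡ true
richness-check = refl

-- Sums over five-tuples and symmetrisation

Fun₅ : ℕ → Set
Fun₅ n = Fin n → Fin n → Fin n → Fin n → Fin n → ℤ

∑³ : ∀ {n} → (Fin n → Fin n → Fin n → ℤ) → ℤ
∑³ f = ∑ λ a → ∑ λ b → ∑ λ c → f a b c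

∑⁴ : ∀ {n} → (Fin n → Fin n → Fin n → Fin n → ℤ) → ℤ
∑⁴ f = ∑ λ a → ∑³ (f a)

∑⁵ : ∀ {n} → Fun₅ n → ℤ
∑⁵ f = ∑ λ a → ∑⁴ (f a)

∑³-cong : ∀ {n} {f g : Fin n → Fin n → Fin n → ℤ} → (∀ a b c → f a b c ≡ g a b c) → ∑³ f ≡ ∑³ g
∑³-cong p = ∑-cong λ a → ∑-cong λ b → ∑-cong λ c → p a b c

∑⁴-cong : ∀ {n} {f g : Fin n → Fin n → Fin n → Fin n → ℤ} → (∀ a b c d → f a b c d ≡ g a b c d) → ∑⁴ f ≡ ∑⁴ g
∑⁴-cong p = ∑-cong λ a → ∑³-cong (p a)

∑⁵-cong : ∀ {n} {f g : Fun₅ n} → (∀ a b c d e → f a b c d e ≡ g a b c d e) → ∑⁵ f ≡ ∑⁵ g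
∑⁵-cong p = ∑-cong λ a → ∑⁴-cong (p a)

∑³-mono : ∀ {n} {f g : Fin n → Fin n → Fin n → ℤ} → (∀ a b c → f a b c ≤ g a b c) → ∑³ f ≤ ∑³ g
∑³-mono p = ∑-mono λ a → ∑-mono λ b → ∑-mono λ c → p a b c

∑⁴-mono : ∀ {n} {f g : Fin n → Fin n → Fin n → Fin n → ℤ} → (∀ a b c d → f a b c d ≤ g a b c d) → ∑⁴ f ≤ ∑⁴ g
∑⁴-mono p = ∑-mono λ a → ∑³-mono (p a)

∑³-+ : ∀ {n} (f g : Fin n → Fin n → Fin n → ℤ) → ∑³ (λ a b c → f a b c + g a b c) ≡ ∑³ f + ∑³ g
∑³-+ f g = trans (∑-cong λ a → trans (∑-cong λ b → ∑-+ (f a b) (g a b)) (∑-+ (λ b → ∑ (f a b)) (λ b → ∑ (g a b))))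
  (∑-+ (λ a → ∑ λ b → ∑ (f a b)) (λ a → ∑ λ b → ∑ (g a b)))

∑⁴-+ : ∀ {n} (f g : Fin n → Fin n → Fin n → Fin n → ℤ) → ∑⁴ (λ a b c d → f a b c d + g a b c d) ≡ ∑⁴ f + ∑⁴ g
∑⁴-+ f g = trans (∑-cong λ a → ∑³-+ (f a) (g a)) (∑-+ (λ a → ∑³ (f a)) (λ a → ∑³ (g a)))

∑⁵-+ : ∀ {n} (f g : Fun₅ n) → ∑⁵ (λ a b c d e → f a b c d e + g a b c d e) ≡ ∑⁵ f + ∑⁵ g
∑⁵-+ f g = trans (∑-cong λ a → ∑⁴-+ (f a) (g a)) (∑-+ (λ a → ∑⁴ (f a)) (λ a → ∑⁴ (g a)))

∑³-*ˡ : ∀ {n} k (f : Fin n → Fin n → Fin n → ℤ) → ∑³ (λ a b c → k * f a b c) ≡ k * ∑³ f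
∑³-*ˡ k f = trans (∑-cong λ a → trans (∑-cong λ b → ∑-*ˡ k (f a b)) (∑-*ˡ k (λ b → ∑ (f a b))))
  (∑-*ˡ k (λ a → ∑ λ b → ∑ (f a b)))

∑⁴-*ˡ : ∀ {n} k (f : Fin n → Fin n → Fin n → Fin n → ℤ) → ∑⁴ (λ a b c d → k * f a b c d) ≡ k * ∑⁴ f
∑⁴-*ˡ k f = trans (∑-cong λ a → ∑³-*ˡ k (f a)) (∑-*ˡ k (λ a → ∑³ (f a)))

∑⁵-*ˡ : ∀ {n} k (f : Fun₅ n) → ∑⁵ (λ a b c d e → k * f a b c d e) ≡ k * ∑⁵ f
∑⁵-*ˡ k f = trans (∑-cong λ a → ∑⁴-*ˡ k (f a)) (∑-*ˡ k (λ a → ∑⁴ (f a)))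

∑⁵-const : ∀ n k → ∑⁵ {n} (λ _ _ _ _ _ → k) ≡ + n * (+ n * (+ n * (+ n * (+ n * k))))
∑⁵-const n k =
  trans (∑-cong {n} λ _ → trans (∑-cong {n} λ _ → trans (∑-cong {n} λ _ → trans (∑-cong {n} λ _ → ∑-const n k)
    (∑-const n (+ n * k))) (∑-const n (+ n * (+ n * k)))) (∑-const n (+ n * (+ n * (+ n * k)))))
    (∑-const n (+ n * (+ n * (+ n * (+ n * k)))))

module _ {n : ℕ} where
  σ₁ σ₂ σ₃ σ₄ : Fun₅ n → Fun₅ n
  σ₁ f a b c d e = f b a c d e
  σ₂ f a b c d e = f a c b d e
  σ₃ f a b c d e = f a b d c e
  σ₄ f a b c d e = f a b c e d

  ∑⁵-σ₁ : ∀ f → ∑⁵ (σ₁ f) ≡ ∑⁵ f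
  ∑⁵-σ₁ f = ∑-comm (λ a b → ∑³ (f b a))

  ∑⁵-σ₂ : ∀ f → ∑⁵ (σ₂ f) ≡ ∑⁵ f
  ∑⁵-σ₂ f = ∑-cong λ a → ∑-comm (λ b c → ∑ λ d → ∑ λ e → f a c b d e)

  ∑⁵-σ₃ : ∀ f → ∑⁵ (σ₃ f) ≡ ∑⁵ f
  ∑⁵-σ₃ f = ∑-cong λ a → ∑-cong λ b → ∑-comm (λ c d → ∑ λ e → f a b d c e)

  ∑⁵-σ₄ : ∀ f → ∑⁵ (σ₄ f) ≡ ∑⁵ f
  ∑⁵-σ₄ f = ∑-cong λ a → ∑-cong λ b → ∑-cong λ c → ∑-comm (λ d e → f a b c e d)

  ∑⁵-plus : ∀ (f g : Fun₅ n) {x y} → ∑⁵ f ≡ x → ∑⁵ g ≡ y → ∑⁵ (λ a b c d e → f a b c d e + g a b c d e) ≡ x + y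
  ∑⁵-plus f g p q = trans (∑⁵-+ f g) (cong₂ _+_ p q)

  ∑⁵-pairings : ∀ f → ∑⁵ (pairings f) ≡ + 6 * ∑⁵ f
  ∑⁵-pairings f = trans
    (∑⁵-plus f _ refl (∑⁵-plus (σ₃ f) _ (∑⁵-σ₃ f) (∑⁵-plus (σ₄ (σ₃ f)) _ e₁
      (∑⁵-plus (σ₂ (σ₃ f)) _ (trans (∑⁵-σ₂ (σ₃ f)) (∑⁵-σ₃ f))
        (∑⁵-plus (σ₂ (σ₄ (σ₃ f))) (σ₃ (σ₂ (σ₄ (σ₃ f)))) e₂ (trans (∑⁵-σ₃ (σ₂ (σ₄ (σ₃ f)))) e₂))))))
    (six (∑⁵ f))
    where
    e₁ : ∑⁵ (σ₄ (σ₃ f)) ≡ ∑⁵ f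
    e₁ = trans (∑⁵-σ₄ (σ₃ f)) (∑⁵-σ₃ f)
    e₂ : ∑⁵ (σ₂ (σ₄ (σ₃ f))) ≡ ∑⁵ f
    e₂ = trans (∑⁵-σ₂ (σ₄ (σ₃ f))) e₁
    six : ∀ x → x + (x + (x + (x + (x + x)))) ≡ + 6 * x
    six = solve-∀

  -- Each of the 30 summands is `f` with permuted arguments, a composite of the adjacent
  -- transpositions `σ₁`, ..., `σ₄`, none of which changes the sum over all tuples.
  ∑⁵-symmetrise : ∀ f → ∑⁵ (symmetrise f) ≡ + 30 * ∑⁵ f
  ∑⁵-symmetrise f = trans
    (∑⁵-plus P _ refl (∑⁵-plus (σ₁ P) _ (∑⁵-σ₁ P) (∑⁵-plus (σ₂ (σ₁ P)) _ e₁
      (∑⁵-plus (σ₃ (σ₂ (σ₁ P))) (σ₄ (σ₃ (σ₂ (σ₁ P)))) e₂ (trans (∑⁵-σ₄ (σ₃ (σ₂ (σ₁ P)))) e₂)))))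
    (trans (cong (λ x → x + (x + (x + (x + x)))) (∑⁵-pairings f)) (thirty (∑⁵ f)))
    where
    P = pairings f
    e₁ : ∑⁵ (σ₂ (σ₁ P)) ≡ ∑⁵ P
    e₁ = trans (∑⁵-σ₂ (σ₁ P)) (∑⁵-σ₁ P)
    e₂ : ∑⁵ (σ₃ (σ₂ (σ₁ P))) ≡ ∑⁵ P
    e₂ = trans (∑⁵-σ₃ (σ₂ (σ₁ P))) e₁
    thirty : ∀ x → + 6 * x + (+ 6 * x + (+ 6 * x + (+ 6 * x + + 6 * x))) ≡ + 30 * x
    thirty = solve-∀

pairings-cong : ∀ {X : Set} {f g : X → X → X → X → X → ℤ} → (∀ a b c d e → f a b c d e ≡ g a b c d e) →
  ∀ a b c d e → pairings f a b c d e ≡ pairings g a b c d e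
pairings-cong p x a b c d = cong₂ _+_ (p x a b c d) (cong₂ _+_ (p x a c b d) (cong₂ _+_ (p x a d b c)
  (cong₂ _+_ (p x b c a d) (cong₂ _+_ (p x b d a c) (p x c d a b)))))

symmetrise-cong : ∀ {X : Set} {f g : X → X → X → X → X → ℤ} → (∀ a b c d e → f a b c d e ≡ g a b c d e) →
  ∀ a b c d e → symmetrise f a b c d e ≡ symmetrise g a b c d e
symmetrise-cong p a b c d e = cong₂ _+_ (pairings-cong p a b c d e) (cong₂ _+_ (pairings-cong p b a c d e)
  (cong₂ _+_ (pairings-cong p c a b d e) (cong₂ _+_ (pairings-cong p d a b c e) (pairings-cong p e a b c d))))

at-cong : ∀ {X : Set} (g : Pattern ℤ) {A A′ : X → X → Bool} → (∀ i j → A i j ≡ A′ i j) →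
  ∀ a b c d e → at g A a b c d e ≡ at g A′ a b c d e
at-cong g p a b c d e
  rewrite p a b | p a c | p a d | p a e | p b c | p b d | p b e | p c d | p c e | p d e = refl

module Certificate {n} (A : Adj n) (sy : Symm A) (ir : Irrefl A) (tf : TriFree A) where

  hasTriangle-false : ∀ a b c d e → at hasTriangle A a b c d e ≡ false
  hasTriangle-false a b c d e = go refl
    where
    no-triangle : ∀ {x y z} → A x y ∧ A y z ∧ A x z ≡ true → ⊥
    no-triangle {x} {y} {z} h with ∧-true h
    ... | h₁ , h₂ = tf x y z h₁ (proj₁ (∧-true h₂)) (proj₂ (∧-true {A y z} h₂))
    _⟨or⟩_ : ∀ {x y} → (x ≡ true → ⊥) → (y ≡ true → ⊥) → x ∨ y ≡ true → ⊥
    (f ⟨or⟩ g) h with ∨-true h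
    ... | inj₁ h₁ = f h₁
    ... | inj₂ h₂ = g h₂
    infixr 5 _⟨or⟩_
    refute : at hasTriangle A a b c d e ≡ true → ⊥
    refute = no-triangle {a} {b} {c} ⟨or⟩ no-triangle {a} {b} {d} ⟨or⟩ no-triangle {a} {b} {e} ⟨or⟩ no-triangle {a} {c} {d} ⟨or⟩ no-triangle {a} {c} {e} ⟨or⟩ no-triangle {a} {d} {e} ⟨or⟩ no-triangle {b} {c} {d} ⟨or⟩ no-triangle {b} {c} {e} ⟨or⟩ no-triangle {b} {d} {e} ⟨or⟩ no-triangle {c} {d} {e}
    go : ∀ {x} → at hasTriangle A a b c d e ≡ x → x ≡ false
    go {true} h = ⊥-elim (refute h)
    go {false} h = refl

  entry : Fin n → Fin n → Fin n → Fin n → Fin n → Fin 5 → Fin n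
  entry a b c d e 0F = a
  entry a b c d e 1F = b
  entry a b c d e 2F = c
  entry a b c d e 3F = d
  entry a b c d e 4F = e

  matrix-entry : ∀ a b c d e i j → A (entry a b c d e i) (entry a b c d e j) ≡ at matrix A a b c d e i j
  matrix-entry a b c d e 0F 0F = ir a
  matrix-entry a b c d e 0F 1F = refl
  matrix-entry a b c d e 0F 2F = refl
  matrix-entry a b c d e 0F 3F = refl
  matrix-entry a b c d e 0F 4F = refl
  matrix-entry a b c d e 1F 0F = sy b a
  matrix-entry a b c d e 1F 1F = ir b
  matrix-entry a b c d e 1F 2F = refl
  matrix-entry a b c d e 1F 3F = refl
  matrix-entry a b c d e 1F 4F = refl
  matrix-entry a b c d e 2F 0F = sy c a
  matrix-entry a b c d e 2F 1F = sy c b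
  matrix-entry a b c d e 2F 2F = ir c
  matrix-entry a b c d e 2F 3F = refl
  matrix-entry a b c d e 2F 4F = refl
  matrix-entry a b c d e 3F 0F = sy d a
  matrix-entry a b c d e 3F 1F = sy d b
  matrix-entry a b c d e 3F 2F = sy d c
  matrix-entry a b c d e 3F 3F = ir d
  matrix-entry a b c d e 3F 4F = refl
  matrix-entry a b c d e 4F 0F = sy e a
  matrix-entry a b c d e 4F 1F = sy e b
  matrix-entry a b c d e 4F 2F = sy e c
  matrix-entry a b c d e 4F 3F = sy e d
  matrix-entry a b c d e 4F 4F = ir e

  -- The vertices `a`, ..., `e` may coincide. As `A` is irreflexive, the adjacencies of such a tuple
  -- are still one of the triangle-free patterns that were evaluated on `Fin 5`.
  symmetrise-nonneg : ∀ g → all-patterns (nonneg-on g) ≡ true → ∀ a b c d e → + 0 ≤ symmetrise (at g A) a b c d e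
  symmetrise-nonneg g chk a b c d e with checkᵇ 10 (nonneg-on g) chk (A a b) (A a c) (A a d) (A a e) (A b c) (A b d) (A b e) (A c d) (A c e) (A d e)
  ... | h rewrite hasTriangle-false a b c d e =
    ≤-trans (≤ᵇ⇒≤ (subst-T h)) (≤-reflexive (symmetrise-cong (at-cong g (λ i j → sym (matrix-entry a b c d e i j))) 0F 1F 2F 3F 4F))
    where
    subst-T : ∀ {b} → b ≡ true → Bool.T b
    subst-T refl = _

  ∑⁵-nonneg-by-symmetry : ∀ g → all-patterns (nonneg-on g) ≡ true → + 0 ≤ ∑⁵ (at g A)
  ∑⁵-nonneg-by-symmetry g chk = *-cancelˡ-≤-pos (+ 0) (∑⁵ (at g A)) (+ 30)
    (≤-trans (∑-nonneg λ a → ∑-nonneg λ b → ∑-nonneg λ c → ∑-nonneg λ d → ∑-nonneg λ e → symmetrise-nonneg g chk a b c d e)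
      (≤-reflexive (∑⁵-symmetrise (at g A))))

0≤k : ∀ {k} → + 0 ≤ + k
0≤k = +≤+ ℕ.z≤n

-- Consequences of the certificates

module Density {n} (A : Adj n) (sy : Symm A) (ir : Irrefl A) (tf : TriFree A) where
  open Certificate A sy ir tf

  ⟪_⟫ : Pattern ℤ → ℤ
  ⟪ g ⟫ = ∑⁵ (at g A)

  ⟪⟫-⊕ : ∀ g h → ⟪ g ⊕ h ⟫ ≡ ⟪ g ⟫ + ⟪ h ⟫
  ⟪⟫-⊕ g h = ∑⁵-+ (at g A) (at h A)

  ⟪⟫-⊛ : ∀ k g → ⟪ k ⊛ g ⟫ ≡ k * ⟪ g ⟫
  ⟪⟫-⊛ k g = ∑⁵-*ˡ k (at g A)

  ⟪⟫-one : ⟪ one ⟫ ≡ + n * (+ n * (+ n * (+ n * + n)))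
  ⟪⟫-one = trans (∑⁵-const n (+ 1)) (cong (λ x → + n * (+ n * (+ n * (+ n * x)))) (*-identityʳ (+ n)))

  0≤⟪⟦⟧⟫ : ∀ p → + 0 ≤ ⟪ ⟦ p ⟧ ⟫
  0≤⟪⟦⟧⟫ p = ∑-nonneg λ a → ∑-nonneg λ b → ∑-nonneg λ c → ∑-nonneg λ d → ∑-nonneg λ e → 0≤ι (at p A a b c d e)

  -- Once the root is fixed, the pairs `(y , z)` and `(u , w)` vary independently and the sum
  -- factors.
  ⟪square⟫ : ∀ φ → ⟪ square φ ⟫ ≡ ∑ λ x → (∑ λ y → ∑ λ z → φ (A x y) (A x z) (A y z)) * (∑ λ y → ∑ λ z → φ (A x y) (A x z) (A y z))
  ⟪square⟫ φ = ∑-cong λ x → begin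
    (∑ λ y → ∑ λ z → ∑ λ u → ∑ λ w → Φ x y z * Φ x u w)
      ≡⟨ ∑-cong (λ y → ∑-cong λ z → ∑-cong λ u → ∑-*ˡ (Φ x y z) (Φ x u)) ⟩
    (∑ λ y → ∑ λ z → ∑ λ u → Φ x y z * ∑ (Φ x u))
      ≡⟨ ∑-cong (λ y → ∑-product (Φ x y) (λ u → ∑ (Φ x u))) ⟩
    (∑ λ y → ∑ (Φ x y) * ∑ (λ u → ∑ (Φ x u)))
      ≡⟨ ∑-*ʳ (∑ λ u → ∑ (Φ x u)) (λ y → ∑ (Φ x y)) ⟩
    ∑ (λ y → ∑ (Φ x y)) * ∑ (λ u → ∑ (Φ x u)) ∎
    where
    open ≡-Reasoning
    Φ : Fin n → Fin n → Fin n → ℤ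
    Φ x y z = φ (A x y) (A x z) (A y z)

  0≤⟪square⟫ : ∀ φ → + 0 ≤ ⟪ square φ ⟫
  0≤⟪square⟫ φ = ≤-trans (∑-nonneg λ x → 0≤sq (∑ λ y → ∑ λ z → φ (A x y) (A x z) (A y z))) (≤-reflexive (sym (⟪square⟫ φ)))

  0≤⟪square₃⟫ : ∀ τ φ → + 0 ≤ ⟪ square₃ τ φ ⟫
  0≤⟪square₃⟫ τ φ = ∑-nonneg λ x → ∑-nonneg λ y → ∑-nonneg λ z → ≤-trans
    (0≤* (0≤ι (τ (A x y) (A x z) (A y z))) (0≤sq (∑ (ψ x y z))))
    (≤-reflexive (sym (trans (∑-cong λ u → ∑-*ˡ (ι (τ (A x y) (A x z) (A y z))) (λ w → ψ x y z u * ψ x y z w))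
      (trans (∑-*ˡ (ι (τ (A x y) (A x z) (A y z))) (λ u → ∑ λ w → ψ x y z u * ψ x y z w))
        (cong (ι (τ (A x y) (A x z) (A y z)) *_) (∑-product (ψ x y z) (ψ x y z)))))))
    where
    ψ : Fin n → Fin n → Fin n → Fin n → ℤ
    ψ x y z w = φ (A x w) (A y w) (A z w)

  0≤⟪squares⟫ : ∀ s → + 0 ≤ ⟪ squares s ⟫
  0≤⟪squares⟫ (sq k φ) = ≤-trans (0≤* {+ k} {⟪ square φ ⟫} 0≤k (0≤⟪square⟫ φ)) (≤-reflexive (sym (⟪⟫-⊛ (+ k) (square φ))))
  0≤⟪squares⟫ (sq₃ k τ φ) = ≤-trans (0≤* {+ k} {⟪ square₃ τ φ ⟫} 0≤k (0≤⟪square₃⟫ τ φ)) (≤-reflexive (sym (⟪⟫-⊛ (+ k) (square₃ τ φ))))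
  0≤⟪squares⟫ (s ⊞ s′) = ≤-trans (0≤+ (0≤⟪squares⟫ s) (0≤⟪squares⟫ s′)) (≤-reflexive (sym (⟪⟫-⊕ (squares s) (squares s′))))

  deg : Fin n → ℤ
  deg x = ∑ λ y → ι (A x y)

  -- Deviation of the degree from 2n/5, scaled by 5.
  dev : Fin n → ℤ
  dev x = + 2 * + n - + 5 * deg x

  I₄ : ℤ
  I₄ = ∑⁴ λ a b c d → ι (independent₄ (A a b) (A a c) (A a d) (A b c) (A b d) (A c d))

  P₄ : Fin n → Fin n → Fin n → Fin n → Bool
  P₄ a b c d = isP₄ (A a b) (A a c) (A a d) (A b c) (A b d) (A c d)

  N₄ : ℤ
  N₄ = ∑⁴ λ a b c d → ι (P₄ a b c d)

  ⟪degreeFlag⟫ : ⟪ square degreeFlag ⟫ ≡ + 4 * (+ n * + n) * ∑ (λ x → dev x * dev x)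
  ⟪degreeFlag⟫ = trans (⟪square⟫ degreeFlag) (trans (∑-cong λ x → trans (cong₂ _*_ (inner x) (inner x)) (eq (+ n) (dev x)))
    (∑-*ˡ (+ 4 * (+ n * + n)) (λ x → dev x * dev x)))
    where
    eq : ∀ n d → + 2 * n * d * (+ 2 * n * d) ≡ + 4 * (n * n) * (d * d)
    eq = solve-∀
    fin : ∀ n d → n * d + n * d ≡ + 2 * n * d
    fin = solve-∀
    eq₁ : ∀ n → n * + 2 ≡ + 2 * n
    eq₁ = solve-∀
    one-sided : ∀ x → ∑ (λ y → + 2 - + 5 * ι (A x y)) ≡ dev x
    one-sided x = trans (∑-minus (λ _ → + 2) (λ y → + 5 * ι (A x y)))
      (cong₂ _-_ (trans (∑-const n (+ 2)) (eq₁ (+ n))) (∑-*ˡ (+ 5) (λ y → ι (A x y))))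
    inner : ∀ x → ∑ (λ y → ∑ λ z → degreeFlag (A x y) (A x z) (A y z)) ≡ + 2 * + n * dev x
    inner x = trans (∑-cong λ y → trans (∑-+ (λ _ → + 2 - + 5 * ι (A x y)) (λ z → + 2 - + 5 * ι (A x z)))
        (cong₂ _+_ (∑-const n (+ 2 - + 5 * ι (A x y))) (one-sided x)))
      (trans (∑-+ (λ y → + n * (+ 2 - + 5 * ι (A x y))) (λ _ → dev x))
        (trans (cong₂ _+_ (trans (∑-*ˡ (+ n) (λ y → + 2 - + 5 * ι (A x y))) (cong (+ n *_) (one-sided x))) (∑-const n (dev x)))
          (fin (+ n) (dev x))))

  ⟪independent⟫ : ⟪ ⟦ isIndependent₄ ⟧ ⟫ ≡ + n * I₄
  ⟪independent⟫ = ∑-const n I₄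

  ⟪P₄′⟫ : ⟪ ⟦ isP₄′ ⟧ ⟫ ≡ + n * N₄
  ⟪P₄′⟫ = trans (cong (λ x → ∑ {n} (λ _ → x)) perm) (∑-const n N₄)
    where
    f : Fin n → Fin n → Fin n → Fin n → ℤ
    f b c d e = ι (isP₄ (A b d) (A b e) (A b c) (A d e) (A c d) (A c e))
    f′ : Fin n → Fin n → Fin n → Fin n → ℤ
    f′ b c d e = ι (isP₄ (A b d) (A b e) (A b c) (A d e) (A d c) (A e c))
    perm : ∑⁴ f ≡ N₄
    perm = trans (∑⁴-cong {f = f} {f′} λ b c d e → cong₂ (λ p q → ι (isP₄ (A b d) (A b e) (A b c) (A d e) p q)) (sy c d) (sy c e))
      (∑-cong λ b → trans (∑-comm (λ c d → ∑ λ e → f′ b c d e)) (∑-cong λ d → ∑-comm (λ c e → f′ b c d e)))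

  ⟪P₄″⟫ : ⟪ ⟦ isP₄″ ⟧ ⟫ ≡ + n * N₄
  ⟪P₄″⟫ = trans (trans (∑⁵-cong {f = at ⟦ isP₄″ ⟧ A} {σ₄ (at ⟦ isP₄′ ⟧ A)} λ a b c d e →
      cong (λ p → ι (isP₄ (A b e) (A b d) (A b c) p (A c e) (A c d))) (sy d e)) (∑⁵-σ₄ (at ⟦ isP₄′ ⟧ A))) ⟪P₄′⟫

  Δ : ℤ
  Δ = + 25000 * I₄ - + 3000 * (+ n * (+ n * (+ n * + n)))

  private
    N = + n
    rest = ⟪ squares restSquares ⟫
    dg = ⟪ square degreeFlag ⟫
    eg = ⟪ square edgeFlag ⟫
    p₃ = ⟪ ⟦ isP₃K₂ ⟧ ⟫
    p₄ = ⟪ ⟦ isP₄K₁ ⟧ ⟫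
    p₅ = ⟪ ⟦ isP₅ ⟧ ⟫

  defect-sum : rest + + 50 * dg + + 50 * eg + p₃ + p₄ + p₅ ≤ N * Δ
  defect-sum = ≤-from-diff (sym (trans expand (fin N I₄ rest dg eg p₃ p₄ p₅))) (∑⁵-nonneg-by-symmetry defect defect-check)
    where
    g₁ = + 3000 ⊛ one ⊕ squares restSquares
    g₂ = g₁ ⊕ + 50 ⊛ square degreeFlag
    g₃ = g₂ ⊕ + 50 ⊛ square edgeFlag
    g₄ = g₃ ⊕ ⟦ isP₃K₂ ⟧
    g₅ = g₄ ⊕ ⟦ isP₄K₁ ⟧
    expand : ⟪ defect ⟫ ≡ + 25000 * (N * I₄)
      + (- + 1) * (+ 3000 * (N * (N * (N * (N * N)))) + rest + + 50 * dg + + 50 * eg + p₃ + p₄ + p₅)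
    expand = trans (⟪⟫-⊕ (+ 25000 ⊛ ⟦ isIndependent₄ ⟧) ((- + 1) ⊛ (g₅ ⊕ ⟦ isP₅ ⟧)))
      (cong₂ _+_ (trans (⟪⟫-⊛ (+ 25000) ⟦ isIndependent₄ ⟧) (cong (+ 25000 *_) ⟪independent⟫))
        (trans (⟪⟫-⊛ (- + 1) (g₅ ⊕ ⟦ isP₅ ⟧)) (cong ((- + 1) *_)
          (trans (⟪⟫-⊕ g₅ ⟦ isP₅ ⟧) (cong (_+ p₅)
            (trans (⟪⟫-⊕ g₄ ⟦ isP₄K₁ ⟧) (cong (_+ p₄)
              (trans (⟪⟫-⊕ g₃ ⟦ isP₃K₂ ⟧) (cong (_+ p₃)
                (trans (⟪⟫-⊕ g₂ (+ 50 ⊛ square edgeFlag)) (cong₂ _+_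
                  (trans (⟪⟫-⊕ g₁ (+ 50 ⊛ square degreeFlag)) (cong₂ _+_
                    (trans (⟪⟫-⊕ (+ 3000 ⊛ one) (squares restSquares)) (cong (_+ rest)
                      (trans (⟪⟫-⊛ (+ 3000) one) (cong (+ 3000 *_) ⟪⟫-one))))
                    (⟪⟫-⊛ (+ 50) (square degreeFlag))))
                  (⟪⟫-⊛ (+ 50) (square edgeFlag)))))))))))))
    fin : ∀ N I r d e p q s → + 25000 * (N * I)
      + (- + 1) * (+ 3000 * (N * (N * (N * (N * N)))) + r + + 50 * d + + 50 * e + p + q + s)
      ≡ N * (+ 25000 * I - + 3000 * (N * (N * (N * N)))) - (r + + 50 * d + + 50 * e + p + q + s)
    fin = solve-∀

  richness-sum : N * (N * (N * (N * N))) ≤ dg + + 8 * eg + + 1000 * (p₃ + N * N₄ + N * N₄)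
  richness-sum = ≤-from-diff (sym (trans expand (fin (dg + + 8 * eg + + 1000 * (p₃ + N * N₄ + N * N₄)) (N * (N * (N * (N * N))))))) (∑⁵-nonneg-by-symmetry richness richness-check)
    where
    h₁ = square degreeFlag ⊕ + 8 ⊛ square edgeFlag
    h₂ = ⟦ isP₃K₂ ⟧ ⊕ ⟦ isP₄′ ⟧
    expand : ⟪ richness ⟫ ≡ dg + + 8 * eg + + 1000 * (p₃ + N * N₄ + N * N₄) + (- + 1) * (N * (N * (N * (N * N))))
    expand = trans (⟪⟫-⊕ (h₁ ⊕ + 1000 ⊛ (h₂ ⊕ ⟦ isP₄″ ⟧)) ((- + 1) ⊛ one)) (cong₂ _+_
      (trans (⟪⟫-⊕ h₁ (+ 1000 ⊛ (h₂ ⊕ ⟦ isP₄″ ⟧))) (cong₂ _+_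
        (trans (⟪⟫-⊕ (square degreeFlag) (+ 8 ⊛ square edgeFlag)) (cong (λ x → dg + x) (⟪⟫-⊛ (+ 8) (square edgeFlag))))
        (trans (⟪⟫-⊛ (+ 1000) (h₂ ⊕ ⟦ isP₄″ ⟧)) (cong (+ 1000 *_)
          (trans (⟪⟫-⊕ h₂ ⟦ isP₄″ ⟧) (cong₂ _+_
            (trans (⟪⟫-⊕ ⟦ isP₃K₂ ⟧ ⟦ isP₄′ ⟧) (cong (λ x → p₃ + x) ⟪P₄′⟫)) ⟪P₄″⟫))))))
      (trans (⟪⟫-⊛ (- + 1) one) (cong ((- + 1) *_) ⟪⟫-one)))
    fin : ∀ x y → x + (- + 1) * y ≡ x - y
    fin = solve-∀

  0≤dg = 0≤⟪square⟫ degreeFlag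
  0≤eg = 0≤⟪square⟫ edgeFlag

  0≤NΔ : + 0 ≤ N * Δ
  0≤NΔ = ≤-trans (0≤+ (0≤+ (0≤+ (0≤+ (0≤+ (0≤⟪squares⟫ restSquares) (0≤* {+ 50} 0≤k 0≤dg)) (0≤* {+ 50} 0≤k 0≤eg))
    (0≤⟪⟦⟧⟫ isP₃K₂)) (0≤⟪⟦⟧⟫ isP₄K₁)) (0≤⟪⟦⟧⟫ isP₅)) defect-sum

  P₄K₁≤ : p₄ ≤ N * Δ
  P₄K₁≤ = ≤-trans (≤-from-diff (eq rest dg eg p₃ p₄ p₅) (0≤+ (0≤+ (0≤+ (0≤+ (0≤⟪squares⟫ restSquares) (0≤* {+ 50} 0≤k 0≤dg))
    (0≤* {+ 50} 0≤k 0≤eg)) (0≤⟪⟦⟧⟫ isP₃K₂)) (0≤⟪⟦⟧⟫ isP₅))) defect-sum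
    where
    eq : ∀ r d e p q s → r + + 50 * d + + 50 * e + p + q + s - q ≡ r + + 50 * d + + 50 * e + p + s
    eq = solve-∀

  P₅≤ : p₅ ≤ N * Δ
  P₅≤ = ≤-trans (≤-from-diff (eq rest dg eg p₃ p₄ p₅) (0≤+ (0≤+ (0≤+ (0≤+ (0≤⟪squares⟫ restSquares) (0≤* {+ 50} 0≤k 0≤dg))
    (0≤* {+ 50} 0≤k 0≤eg)) (0≤⟪⟦⟧⟫ isP₃K₂)) (0≤⟪⟦⟧⟫ isP₄K₁))) defect-sum
    where
    eq : ∀ r d e p q s → r + + 50 * d + + 50 * e + p + q + s - s ≡ r + + 50 * d + + 50 * e + p + q
    eq = solve-∀

  dev²≤ : N * N * ∑ (λ x → dev x * dev x) ≤ N * Δ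
  dev²≤ = ≤-trans (≤-from-diff (eq₁ (N * N) S) (0≤* {+ 3} {N * N * S} 0≤k (0≤* {N * N} {S} (0≤* {N} {N} 0≤k 0≤k) (∑-nonneg λ x → 0≤sq (dev x)))))
    (≤-trans (≤-reflexive (sym ⟪degreeFlag⟫)) (≤-trans (≤-from-diff (eq rest dg eg p₃ p₄ p₅)
      (0≤+ (0≤+ (0≤+ (0≤+ (0≤+ (0≤⟪squares⟫ restSquares) (0≤* {+ 49} 0≤k 0≤dg)) (0≤* {+ 50} 0≤k 0≤eg)) (0≤⟪⟦⟧⟫ isP₃K₂)) (0≤⟪⟦⟧⟫ isP₄K₁)) (0≤⟪⟦⟧⟫ isP₅)))
      defect-sum))
    where
    S = ∑ (λ x → dev x * dev x)
    eq₁ : ∀ m s → + 4 * m * s - m * s ≡ + 3 * (m * s)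
    eq₁ = solve-∀
    eq : ∀ r d e p q s → r + + 50 * d + + 50 * e + p + q + s - d ≡ r + + 49 * d + + 50 * e + p + q + s
    eq = solve-∀

  -- Start from `richness-sum` and replace its degree square, edge square and P₃ + K₂ terms by 1000
  -- times `defect-sum`, which contains each of them with ample multiplicity.
  many-P₄ : N * (N * (N * (N * N))) ≤ + 1000 * (N * Δ) + + 2000 * (N * N₄)
  many-P₄ = ≤-trans richness-sum (≤-from-diff (eq (N * Δ) rest dg eg p₃ p₄ p₅ (N * N₄))
    (0≤+ (0≤* {+ 1000} 0≤k (i≤j⇒0≤j-i defect-sum))
      (0≤+ (0≤* {+ 1000} 0≤k (0≤⟪squares⟫ restSquares)) (0≤+ (0≤* {+ 49999} 0≤k 0≤dg) (0≤+ (0≤* {+ 49992} 0≤k 0≤eg)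
        (0≤+ (0≤* {+ 1000} 0≤k (0≤⟪⟦⟧⟫ isP₄K₁)) (0≤* {+ 1000} 0≤k (0≤⟪⟦⟧⟫ isP₅))))))))
    where
    eq : ∀ D r d e p q s m → + 1000 * D + + 2000 * m - (d + + 8 * e + + 1000 * (p + m + m))
      ≡ + 1000 * (D - (r + + 50 * d + + 50 * e + p + q + s)) + (+ 1000 * r + (+ 49999 * d + (+ 49992 * e + (+ 1000 * q + + 1000 * s))))
    eq = solve-∀

-- Comparing clique counts of two graphs

T-mono-term : ∀ {n} {A B : Adj n} k {Φ Ψ : Fin n → Bool} → (∀ i → Φ i ≡ true → Ψ i ≡ true) →
  (∀ v → (∀ i → Φ i ∧ A v i ≡ true → Ψ i ∧ B v i ≡ true) → T A k (λ w → Φ w ∧ A v w) ≤ T B k (λ w → Ψ w ∧ B v w)) →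
  (∀ i j → A i j ≡ true → B i j ≡ true) →
  ∀ v → ι (Φ v) * T A k (λ w → Φ w ∧ A v w) ≤ ι (Ψ v) * T B k (λ w → Ψ w ∧ B v w)
T-mono-term {n} {A} {B} k {Φ} {Ψ} q IH p v with Φ v in eq
... | false = 0≤* {ι (Ψ v)} (0≤ι (Ψ v)) (0≤T B k (λ w → Ψ w ∧ B v w))
... | true rewrite q v eq = *-monoˡ {+ 1} 0≤k (IH v
  (λ i h → cong₂ _∧_ (q i (proj₁ (∧-true h))) (p v i (proj₂ (∧-true {Φ i} h)))))

T-mono : ∀ {n} {A B : Adj n} k {Φ Ψ : Fin n → Bool} → (∀ i j → A i j ≡ true → B i j ≡ true) →
  (∀ i → Φ i ≡ true → Ψ i ≡ true) → T A k Φ ≤ T B k Ψ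
T-mono zero p q = ≤-refl
T-mono {n} {A} {B} (suc k) {Φ} {Ψ} p q = ∑-mono (T-mono-term {A = A} {B} k {Φ} {Ψ} q (λ v → T-mono k p) p)

T-mono-at : ∀ {n} {A B : Adj n} k {Φ Ψ : Fin n → Bool} → (∀ i j → A i j ≡ true → B i j ≡ true) →
  (∀ i → Φ i ≡ true → Ψ i ≡ true) → ∀ v → ι (Φ v) * T A k (λ w → Φ w ∧ A v w) ≤ ι (Ψ v) * T B k (λ w → Ψ w ∧ B v w)
T-mono-at {n} {A} {B} k {Φ} {Ψ} p q = T-mono-term {A = A} {B} k {Φ} {Ψ} q (λ v → T-mono k p) p

T₂-pos : ∀ {n} (A : Adj n) Φ x y → Φ x ≡ true → Φ y ≡ true → A x y ≡ true → + 1 ≤ T A 2 Φ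
T₂-pos A Φ x y p q r =
  ≤-trans (term-ι (λ w → Φ w ∧ A x w) (λ v → T A 0 (λ w → (Φ w ∧ A x w) ∧ A v w)) (λ _ → 0≤k) y (cong₂ _∧_ q r))
    (term-ι Φ (λ v → T A 1 (λ w → Φ w ∧ A v w)) (λ v → 0≤T A 1 (λ w → Φ w ∧ A v w)) x p)

-- No term of the nested sum decreases, and the ordered clique `u`, `v`, `x`, `y` is new in `B`.
T₄-strict : ∀ {n} (A B : Adj n) → (∀ i j → A i j ≡ true → B i j ≡ true) → ∀ u v x y → A u v ≡ false →
  B u v ≡ true → B u x ≡ true → B u y ≡ true → B v x ≡ true → B v y ≡ true → B x y ≡ true →
  T A 4 everything < T B 4 everything
T₄-strict A B A⊆B u v x y ¬uv uv ux uy vx vy xy =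
  ∑-strict (T-mono-at {A = A} {B} 3 {everything} {everything} A⊆B (λ _ h → h)) u
    (<-≤-trans (≤-<-trans (≤-reflexive (*-identityˡ (T A 3 (A u)))) inner) (≤-reflexive (sym (*-identityˡ (T B 3 (B u))))))
  where
  at-v : ι (A u v) * T A 2 (λ w → A u w ∧ A v w) < ι (B u v) * T B 2 (λ w → B u w ∧ B v w)
  at-v = <-≤-trans (≤-<-trans (≤-reflexive (cong (λ b → ι b * T A 2 (λ w → A u w ∧ A v w)) ¬uv)) (+<+ (ℕ.s≤s ℕ.z≤n)))
    (≤-trans (T₂-pos B (λ w → B u w ∧ B v w) x y (cong₂ _∧_ ux vx) (cong₂ _∧_ uy vy) xy)
      (≤-reflexive (sym (trans (cong (λ b → ι b * T B 2 (λ w → B u w ∧ B v w)) uv) (*-identityˡ (T B 2 (λ w → B u w ∧ B v w)))))))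
  inner : T A 3 (A u) < T B 3 (B u)
  inner = ∑-strict (T-mono-at {A = A} {B} 2 {A u} {B u} A⊆B (A⊆B u)) v at-v

T-agree : ∀ {n} {A B : Adj n} k {Φ : Fin n → Bool} →
  (∀ i j → Φ i ≡ true → Φ j ≡ true → A i j ≡ B i j) → T A k Φ ≡ T B k Φ
T-agree zero p = refl
T-agree {n} {A} {B} (suc k) {Φ} p = ∑-cong term
  where
  restrict : ∀ v → Φ v ≡ true → ∀ w → Φ w ∧ A v w ≡ Φ w ∧ B v w
  restrict v e w with Φ w in eq
  ... | true = p v w e eq
  ... | false = refl
  term : ∀ v → ι (Φ v) * T A k (λ w → Φ w ∧ A v w) ≡ ι (Φ v) * T B k (λ w → Φ w ∧ B v w)
  term v with Φ v in eq
  ... | false = refl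
  ... | true = cong (+ 1 *_) (trans (T-agree k (λ i j h h′ → p i j (proj₁ (∧-true h)) (proj₁ (∧-true h′))))
    (T-congˢ B k (restrict v eq)))

T-bound : ∀ {n} (A : Adj n) k Φ → T A k Φ ≤ (+ n) ^ k
T-bound A zero Φ = ≤-refl
T-bound {n} A (suc k) Φ = ∑-bound λ v → ≤-trans
  (*-mono {ι (Φ v)} {+ 1} (0≤ι (Φ v)) (0≤T A k _) (ι≤1 (Φ v)) (T-bound A k (λ w → Φ w ∧ A v w)))
  (≤-reflexive (*-identityˡ _))

0≤^ : ∀ n k → + 0 ≤ (+ n) ^ k
0≤^ n zero = 0≤k
0≤^ n (suc k) = 0≤* {+ n} 0≤k (0≤^ n k)

-- The adjacency R allows repeated vertices in a clique: it adds the diagonal to A.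
T-insert : ∀ {n} (A : Adj n) → Symm A → Irrefl A → ∀ k Φ Ψ v → (∀ w → Φ w ≡ true → w ≢ v → Ψ w ≡ true) →
  T A k Φ ≤ T A k Ψ + + k * (+ n) ^ (k ℕ.∸ 1)
T-insert A sy ir zero Φ Ψ v p = ≤-refl
T-insert {n} A sy ir (suc k) Φ Ψ v p =
  ≤-trans (≤-reflexive (T-remove A sy ir k Φ v))
    (+-mono-≤ (T-mono (suc k) (λ _ _ h → h) sub) (*-monoˡ {+ suc k} 0≤k small))
  where
  sub : ∀ w → (Φ ∖ v) w ≡ true → Ψ w ≡ true
  sub w h = p w (proj₁ (∧-true h)) (λ { refl → different (proj₂ (∧-true {Φ w} h)) })
    where
    different : not (w ≡ᵇ w) ≡ true → ⊥
    different h′ rewrite ≡ᵇ-refl w with h′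
    ... | ()
  small : ι (Φ v) * T A k (λ w → Φ w ∧ A v w) ≤ (+ n) ^ k
  small = ≤-trans (*-mono {ι (Φ v)} {+ 1} (0≤ι (Φ v)) (0≤T A k _) (ι≤1 (Φ v)) (T-bound A k (λ w → Φ w ∧ A v w)))
    (≤-reflexive (*-identityˡ _))

triangular : ℕ → ℕ
triangular zero = 0
triangular (suc k) = triangular k ℕ.+ k

-- Vertices are chosen one at a time; a repetition makes two of the `k` places equal, which can
-- happen at `triangular k` = k(k-1)/2 pairs of places, and the other entries leave at most n^(k-1)
-- tuples.
T-reflexive : ∀ {n} (A R : Adj n) → Symm A → Irrefl A → (∀ i j → R i j ≡ true → i ≢ j → A i j ≡ true) →
  ∀ k Φ → T R k Φ ≤ T A k Φ + + triangular k * (+ n) ^ (k ℕ.∸ 1)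
T-reflexive A R sy ir p zero Φ = ≤-refl
T-reflexive {n} A R sy ir p (suc k) Φ = ≤-trans (∑-mono step) (≤-reflexive total)
  where
  E : ℤ
  E = + triangular k * (+ n) ^ (k ℕ.∸ 1) + + k * (+ n) ^ (k ℕ.∸ 1)
  0≤E : + 0 ≤ E
  0≤E = 0≤+ (0≤* {+ triangular k} 0≤k (0≤^ n (k ℕ.∸ 1))) (0≤* {+ k} 0≤k (0≤^ n (k ℕ.∸ 1)))
  inner : ∀ v → T R k (λ w → Φ w ∧ R v w) ≤ T A k (λ w → Φ w ∧ A v w) + E
  inner v = ≤-trans (T-reflexive A R sy ir p k (λ w → Φ w ∧ R v w))
    (≤-trans (+-monoˡ-≤ (+ triangular k * (+ n) ^ (k ℕ.∸ 1))
      (T-insert A sy ir k (λ w → Φ w ∧ R v w) (λ w → Φ w ∧ A v w) v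
        (λ w h w≢v → cong₂ _∧_ (proj₁ (∧-true h)) (p v w (proj₂ (∧-true {Φ w} h)) (w≢v ∘ sym)))))
      (≤-reflexive (eq (T A k (λ w → Φ w ∧ A v w)) _ _)))
    where
    eq : ∀ a b c → a + b + c ≡ a + (c + b)
    eq = solve-∀
  step : ∀ v → ι (Φ v) * T R k (λ w → Φ w ∧ R v w) ≤ ι (Φ v) * T A k (λ w → Φ w ∧ A v w) + E
  step v = ≤-trans (*-monoˡ {ι (Φ v)} (0≤ι (Φ v)) (inner v)) (≤-from-diff (eq (ι (Φ v)) _ E)
    (0≤* {+ 1 - ι (Φ v)} (i≤j⇒0≤j-i (ι≤1 (Φ v))) 0≤E))
    where
    eq : ∀ i x e → i * x + e - i * (x + e) ≡ (+ 1 - i) * e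
    eq = solve-∀
  power : ∀ k → + n * (+ triangular k * (+ n) ^ (k ℕ.∸ 1) + + k * (+ n) ^ (k ℕ.∸ 1)) ≡ + triangular (suc k) * (+ n) ^ k
  power zero = *-zeroʳ (+ n)
  power (suc k) = trans (eq (+ n) (+ triangular (suc k)) (+ suc k) ((+ n) ^ k))
    (cong (_* (+ n) ^ suc k) (sym (pos-+ (triangular (suc k)) (suc k))))
    where
    eq : ∀ n a b x → n * (a * x + b * x) ≡ (a + b) * (n * x)
    eq = solve-∀
  total : ∑ (λ v → ι (Φ v) * T A k (λ w → Φ w ∧ A v w) + E) ≡ T A (suc k) Φ + + triangular (suc k) * (+ n) ^ k
  total = trans (∑-+ (λ v → ι (Φ v) * T A k (λ w → Φ w ∧ A v w)) (λ _ → E))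
    (cong (λ x → T A (suc k) Φ + x) (trans (∑-const n E) (power k)))

∁ : ∀ {n} → Adj n → Adj n
∁ A i j = not (A i j)

cmpl-cover : ∀ {n} (G : Graph n) i j → ∁ (cmpl G) i j ≡ true → i ≢ j → adj G i j ≡ true
cmpl-cover G i j h i≢j with adj G i j | ≢⇒≡ᵇ i≢j
... | true | _ = refl
... | false | e rewrite e with h
... | ()

-- Blow-ups, cloning and independent triples at a vertex

module _ {m n} (B : Graph m) (φ : Fin n → Fin m) where

  -- Blow-up of the complement of B: vertices with the same image become adjacent.
  pullback : Graph n
  pullback .adj i j = not (i ≡ᵇ j) ∧ ∁ (cmpl B) (φ i) (φ j)
  pullback .adj-sym i j = cong₂ (λ a b → not a ∧ not b) (≡ᵇ-sym i j) (cmpl-symm B (φ i) (φ j))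
  pullback .irrefl i rewrite ≡ᵇ-refl i = refl

  cmpl-pullback : ∀ i j → cmpl pullback i j ≡ true → cmpl B (φ i) (φ j) ≡ true
  cmpl-pullback i j h with i ≡ᵇ j | cmpl B (φ i) (φ j)
  ... | false | true = refl

  pullback-αLess : TriFree (cmpl B) → αLess pullback 3
  pullback-αLess tf = TriFree⇒αLess pullback λ a b c p q r →
    tf (φ a) (φ b) (φ c) (cmpl-pullback a b p) (cmpl-pullback b c q) (cmpl-pullback a c r)

T₄-mono-t : ∀ {n} {G H : Graph n} → t 4 G ℕ.≤ t 4 H → T (adj G) 4 everything ≤ T (adj H) 4 everything
T₄-mono-t {G = G} {H} p = ≤-trans (≤-reflexive (T≡t G 4))
  (≤-trans (*-monoˡ {+ 24} 0≤k (+≤+ p)) (≤-reflexive (sym (T≡t H 4))))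

-- Replacing v by a twin of u cannot decrease the number of 4-cliques.
module Cloning {n} (G : Graph n) (ext : IsExtremal 4 3 G) (u v : Fin n) where

  φ : Fin n → Fin n
  φ w = if w ≡ᵇ v then u else w

  φ-other : ∀ w → (w ≡ᵇ v) ≡ false → φ w ≡ w
  φ-other w e rewrite e = refl

  G′ : Graph n
  G′ = pullback G φ

  T₄≤ : T (adj G) 4 everything ≤ T (adj G′) 4 everything
  T₄≤ = T₄-mono-t {G = G} {G′} (proj₂ ext G′ (pullback-αLess G φ (αLess⇒TriFree G (proj₁ ext))))

  adj≡ : ∀ i j → (i ≡ᵇ v) ≡ false → (j ≡ᵇ v) ≡ false → adj G′ i j ≡ adj G i j
  adj≡ i j p q rewrite p | q with i ≡ᵇ j in eq
  ... | true rewrite ≡ᵇ⇒≡ i j eq = sym (irrefl G j)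
  ... | false with adj G i j
  ... | true = refl
  ... | false = refl

  not-false : ∀ {b} → not b ≡ true → b ≡ false
  not-false {false} _ = refl

  away : T (adj G′) 4 (everything ∖ v) ≡ T (adj G) 4 (everything ∖ v)
  away = T-agree 4 λ i j p q → adj≡ i j (not-false p) (not-false q)

  N′ : Fin n → Bool
  N′ w = true ∧ adj G′ v w

  N′-avoids : ∀ w → N′ w ≡ true → (w ≡ᵇ v) ≡ false
  N′-avoids w h = trans (≡ᵇ-sym w v) (not-false (proj₁ (∧-true h)))

  N′⊆ : ∀ w → N′ w ≡ true → w ≢ u → adj G u w ≡ true
  N′⊆ w h w≢u = cmpl-cover G u w (subst (λ x → ∁ (cmpl G) x w ≡ true) φv
    (subst (λ x → ∁ (cmpl G) (φ v) x ≡ true) (φ-other w (N′-avoids w h)) (proj₂ (∧-true {not (v ≡ᵇ w)} h)))) (w≢u ∘ sym)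
    where
    φv : φ v ≡ u
    φv rewrite ≡ᵇ-refl v = refl

  -- The 4-cliques avoiding `v` are the same in both graphs, so minimality compares only the
  -- triangles in the neighbourhood of `v` with those in the new neighbourhood. The latter is that
  -- of `u` together with possibly `u` itself, since twins are adjacent; this is the error 3 n².
  cloning : T (adj G) 3 (adj G v) ≤ T (adj G) 3 (adj G u) + + 3 * (+ n) ^ 2
  cloning = ≤-trans compare (≤-trans (≤-reflexive (T-agree {A = adj G′} {adj G} 3 λ i j p q → adj≡ i j (N′-avoids i p) (N′-avoids j q)))
    (T-insert (adj G) (adj-sym G) (irrefl G) 3 N′ (adj G u) u N′⊆))
    where
    X = T (adj G) 4 (everything ∖ v)
    a = T (adj G) 3 (adj G v)
    b = T (adj G′) 3 N′
    four : X + + 4 * (+ 1 * a) ≤ X + + 4 * (+ 1 * b)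
    four = ≤-trans (≤-reflexive (sym (T-remove (adj G) (adj-sym G) (irrefl G) 3 everything v)))
      (≤-trans T₄≤ (≤-reflexive (trans (T-remove (adj G′) (adj-sym G′) (irrefl G′) 3 everything v) (cong (_+ + 4 * (+ 1 * b)) away))))
    compare : a ≤ b
    compare = *-cancelˡ-≤-pos a b (+ 4) (≤-from-diff (eq X a b) (i≤j⇒0≤j-i four))
      where
      eq : ∀ x a b → + 4 * b - + 4 * a ≡ x + + 4 * (+ 1 * b) - (x + + 4 * (+ 1 * a))
      eq = solve-∀

module Extremal {n} (G : Graph n) (ext : IsExtremal 4 3 G) where
  A : Adj n
  A = cmpl G

  R : Adj n
  R = ∁ A

  tf : TriFree A
  tf = αLess⇒TriFree G (proj₁ ext)

  open Density A (cmpl-symm G) (cmpl-irrefl G) tf public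

  24t : ℤ
  24t = + 24 * + t 4 G

  T₄≡24t : T (adj G) 4 everything ≡ 24t
  T₄≡24t = T≡t G 4

  I₄≡T : I₄ ≡ T R 4 everything
  I₄≡T = ∑-cong λ a → trans (trans (∑-cong λ b → trans (∑-cong λ c → trans (∑-cong λ d → point (R a b) (R a c ∧ R b c) ((R a d ∧ R b d) ∧ R c d))
        (trans (∑-*ˡ (ι (R a b)) (λ d → ι (R a c ∧ R b c) * (ι ((R a d ∧ R b d) ∧ R c d) * + 1)))
          (cong (ι (R a b) *_) (∑-*ˡ (ι (R a c ∧ R b c)) (λ d → ι ((R a d ∧ R b d) ∧ R c d) * + 1)))))
      (∑-*ˡ (ι (R a b)) (λ c → ι (R a c ∧ R b c) * T R 1 (λ d → (R a d ∧ R b d) ∧ R c d))))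
    refl) (sym (*-identityˡ (T R 3 (R a))))
    where
    point : ∀ x y z → ι (x ∧ (y ∧ z)) ≡ ι x * (ι y * (ι z * + 1))
    point true true true = refl
    point true true false = refl
    point true false z = refl
    point false y z = refl

  I₄≤ : I₄ ≤ 24t + + 6 * (+ n) ^ 3
  I₄≤ = ≤-trans (≤-reflexive I₄≡T) (≤-trans (T-reflexive (adj G) R (adj-sym G) (irrefl G) (cmpl-cover G) 4 everything)
    (+-monoˡ-≤ (+ 6 * (+ n) ^ 3) (≤-reflexive T₄≡24t)))

  J : Fin n → ℤ
  J v = T R 3 (R v)

  -- Summing `cloning` over all `u` turns the right-hand side into the number of ordered 4-cliques,
  -- so every vertex is at most about average. The 9 is 3 from cloning plus 6 from passing to
  -- triples with repetitions and to a neighbourhood containing `v`.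
  J≤ : ∀ v → + n * J v ≤ 24t + + 9 * (+ n) ^ 3
  J≤ v = ≤-trans (*-monoˡ {+ n} 0≤k first) (≤-trans (≤-reflexive (eq (+ n) a)) (≤-trans (+-monoˡ-≤ _ second) (≤-reflexive (eq₂ 24t (+ n)))))
    where
    a = T (adj G) 3 (adj G v)
    first : J v ≤ a + + 6 * (+ n * (+ n * + 1))
    first = ≤-trans (T-reflexive (adj G) R (adj-sym G) (irrefl G) (cmpl-cover G) 3 (R v))
      (≤-trans (+-monoˡ-≤ (+ 3 * (+ n) ^ 2) (T-insert (adj G) (adj-sym G) (irrefl G) 3 (R v) (adj G v) v
        (λ w h w≢v → cmpl-cover G v w h (w≢v ∘ sym)))) (≤-reflexive (eq₁ a ((+ n) ^ 2))))
      where
      eq₁ : ∀ a x → a + + 3 * x + + 3 * x ≡ a + + 6 * x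
      eq₁ = solve-∀
    second : + n * a ≤ 24t + + n * (+ 3 * (+ n * (+ n * + 1)))
    second = ≤-trans (≤-reflexive (sym (∑-const n a))) (≤-trans (∑-mono λ u → Cloning.cloning G ext u v)
      (≤-reflexive (trans (∑-+ (λ u → T (adj G) 3 (adj G u)) (λ _ → + 3 * (+ n) ^ 2))
        (cong₂ _+_ (trans (∑-cong λ u → sym (*-identityˡ (T (adj G) 3 (adj G u)))) T₄≡24t) (∑-const n (+ 3 * (+ n) ^ 2))))))
    eq : ∀ n a → n * (a + + 6 * (n * (n * + 1))) ≡ n * a + + 6 * (n * (n * (n * + 1)))
    eq = solve-∀
    eq₂ : ∀ t n → t + n * (+ 3 * (n * (n * + 1))) + + 6 * (n * (n * (n * + 1)))
      ≡ t + + 9 * (n * (n * (n * + 1)))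
    eq₂ = solve-∀

-- Blow-ups of the pentagon and the upper bound

pentagon : Graph 5
pentagon .adj i j = (j ≡ᵇ succ5 i) ∨ (i ≡ᵇ succ5 j)
pentagon .adj-sym i j = ∨-comm (j ≡ᵇ succ5 i) (i ≡ᵇ succ5 j)
pentagon .irrefl 0F = refl
pentagon .irrefl 1F = refl
pentagon .irrefl 2F = refl
pentagon .irrefl 3F = refl
pentagon .irrefl 4F = refl

far : Adj 5
far = cmpl pentagon

_⇒ᵇ_ : Bool → Bool → Bool
a ⇒ᵇ b = not a ∨ b

⇒ᵇ-elim : ∀ {a b} → (a ⇒ᵇ b) ≡ true → a ≡ true → b ≡ true
⇒ᵇ-elim h refl = h

true≢false : ∀ {b} → b ≡ true → b ≡ false → ⊥
true≢false refl ()

far-TriFree : TriFree far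
far-TriFree a b c ab bc ac = true≢false
  (⇒ᵇ-elim (⇒ᵇ-elim (⇒ᵇ-elim (checkF 3 (λ a b c → far a b ⇒ᵇ (far b c ⇒ᵇ (far a c ⇒ᵇ false))) refl a b c) ab) bc) ac) refl

size : ∀ {n k} → (Fin n → Fin k) → Fin k → ℤ
size c i = ∑ λ p → ι (i ≡ᵇ c p)

∑-colour : ∀ {n k} (c : Fin n → Fin k) (g : Fin k → ℤ) → ∑ (λ p → g (c p)) ≡ ∑ (λ i → size c i * g i)
∑-colour c g = trans (∑-cong λ p → sym (*-identityˡ (g (c p)))) (trans (∑-push c (λ _ → + 1) g)
  (∑-cong λ i → cong (_* g i) (∑-cong λ p → *-identityʳ (ι (i ≡ᵇ c p)))))

∑-join : ∀ a {b} (f : Fin (a ℕ.+ b) → ℤ) → ∑ f ≡ ∑ (λ i → f (i ↑ˡ b)) + ∑ (λ j → f (a ↑ʳ j))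
∑-join zero f = sym (+-identityˡ _)
∑-join (suc a) f = trans (cong (λ x → f zero + x) (∑-join a (λ i → f (suc i)))) (sym (+-assoc (f zero) _ _))

total : ∀ {k} → (Fin k → ℕ) → ℕ
total {zero} w = 0
total {suc k} w = w zero ℕ.+ total (λ i → w (suc i))

colouring : ∀ k (w : Fin k → ℕ) → Σ (Fin (total w) → Fin k) λ c → ∀ j → size c j ≡ + w j
colouring zero w = (λ ()) , λ ()
colouring (suc k) w with colouring k (λ i → w (suc i))
... | c , s = d , sizes
  where
  m = total (λ i → w (suc i))
  branch : Fin (w zero) ⊎ Fin m → Fin (suc k)
  branch = [ (λ _ → zero) , (λ i → suc (c i)) ]′
  d : Fin (w zero ℕ.+ m) → Fin (suc k)
  d i = branch (splitAt (w zero) i)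
  count₂ : ∀ j → size d j ≡ ∑ {w zero} (λ _ → ι (j ≡ᵇ zero)) + ∑ (λ i → ι (j ≡ᵇ suc (c i)))
  count₂ j = trans (∑-join (w zero) (λ i → ι (j ≡ᵇ d i))) (cong₂ _+_
    (∑-cong λ i → cong (λ x → ι (j ≡ᵇ branch x)) (splitAt-↑ˡ (w zero) i m))
    (∑-cong λ i → cong (λ x → ι (j ≡ᵇ branch x)) (splitAt-↑ʳ (w zero) m i)))
  sizes : ∀ j → size d j ≡ + w j
  sizes zero = trans (count₂ zero) (trans (cong₂ _+_ (trans (∑-const (w zero) (+ 1)) (*-identityʳ (+ w zero))) (∑-zero m)) (+-identityʳ (+ w zero)))
  sizes (suc j) = trans (count₂ (suc j)) (trans (cong (_+ size c j) (∑-zero (w zero))) (trans (+-identityˡ (size c j)) (s j)))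

T-colour : ∀ {n k} (B : Adj k) (c : Fin n → Fin k) W → (∀ j → size c j ≤ W) → + 0 ≤ W → ∀ l Ψ →
  T (λ i j → B (c i) (c j)) l (λ i → Ψ (c i)) ≤ W ^ l * T B l Ψ
T-colour B c W p q zero Ψ = ≤-refl
T-colour {n} B c W p q (suc l) Ψ = ≤-trans (∑-mono λ v → *-monoˡ {ι (Ψ (c v))} (0≤ι (Ψ (c v)))
    (T-colour B c W p q l (λ j → Ψ j ∧ B (c v) j)))
  (≤-trans (≤-reflexive (∑-colour c g)) (≤-trans (∑-mono λ i → ≤-trans (≤-reflexive (*-comm (size c i) (g i)))
      (≤-trans (*-monoˡ {g i} (0≤g i) (p i)) (≤-reflexive (eq (ι (Ψ i)) (W ^ l) (T B l (λ j → Ψ j ∧ B i j)) W))))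
    (≤-reflexive (∑-*ˡ (W * W ^ l) (λ i → ι (Ψ i) * T B l (λ j → Ψ j ∧ B i j))))))
  where
  0≤W^ : ∀ l → + 0 ≤ W ^ l
  0≤W^ zero = 0≤k
  0≤W^ (suc l) = 0≤* {W} q (0≤W^ l)
  g : Fin _ → ℤ
  g i = ι (Ψ i) * (W ^ l * T B l (λ j → Ψ j ∧ B i j))
  0≤g : ∀ i → + 0 ≤ g i
  0≤g i = 0≤* {ι (Ψ i)} (0≤ι (Ψ i)) (0≤* {W ^ l} (0≤W^ l) (0≤T B l (λ j → Ψ j ∧ B i j)))
  eq : ∀ a b c w → a * (b * c) * w ≡ w * b * (a * c)
  eq = solve-∀

blowup : ∀ {n} → (Fin n → Fin 5) → Graph n
blowup = pullback pentagon

blowup-αLess : ∀ {n} (c : Fin n → Fin 5) → αLess (blowup c) 3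
blowup-αLess c = pullback-αLess pentagon c far-TriFree

-- The 75 is the number of 4-tuples of pentagon vertices that are pairwise equal or adjacent: 2⁴
-- inside each of the 5 edges, less the 5 constant tuples, which lie in two edges each.
blowup-T₄ : ∀ {n} (c : Fin n → Fin 5) W → (∀ j → size c j ≤ W) → + 0 ≤ W → T (adj (blowup c)) 4 everything ≤ W ^ 4 * + 75
blowup-T₄ c W p q = ≤-trans (T-mono {A = adj (blowup c)} {B = λ i j → ∁ far (c i) (c j)} 4 {everything} {everything} (λ i j h → proj₂ (∧-true {not (i ≡ᵇ j)} h)) (λ _ h → h)) (T-colour (∁ far) c W p q 4 everything)

bump : ℕ → Fin 5 → ℕ
bump r j = if ⌊ toℕ j ℕ.<? r ⌋ then 1 else 0

total-shift : ∀ q (b : Fin 5 → ℕ) → total {5} (λ j → q ℕ.+ b j) ≡ total b ℕ.+ q ℕ.* 5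
total-shift q b = eq q (b 0F) (b 1F) (b 2F) (b 3F) (b 4F)
  where
  eq : ∀ q a b c d e → (q ℕ.+ a) ℕ.+ ((q ℕ.+ b) ℕ.+ ((q ℕ.+ c) ℕ.+ ((q ℕ.+ d) ℕ.+ ((q ℕ.+ e) ℕ.+ 0))))
    ≡ a ℕ.+ (b ℕ.+ (c ℕ.+ (d ℕ.+ (e ℕ.+ 0)))) ℕ.+ q ℕ.* 5
  eq = ℕSolver.solve-∀

balanced-total : ∀ n → total {5} (λ j → n ℕ./ 5 ℕ.+ bump (n ℕ.% 5) j) ≡ n
balanced-total n = trans (spread (n ℕ./ 5) (n ℕ.% 5) (DivMod.m%n<n n 5)) (sym (DivMod.m≡m%n+[m/n]*n n 5))
  where
  spread : ∀ q r → r ℕ.< 5 → total {5} (λ j → q ℕ.+ bump r j) ≡ r ℕ.+ q ℕ.* 5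
  spread q 0 _ = total-shift q (bump 0)
  spread q 1 _ = total-shift q (bump 1)
  spread q 2 _ = total-shift q (bump 2)
  spread q 3 _ = total-shift q (bump 3)
  spread q 4 _ = total-shift q (bump 4)
  spread q (suc (suc (suc (suc (suc r))))) (ℕ.s≤s (ℕ.s≤s (ℕ.s≤s (ℕ.s≤s (ℕ.s≤s ())))))

colouring-of : ∀ {n} (w : Fin 5 → ℕ) → total w ≡ n → Σ (Fin n → Fin 5) λ c → ∀ j → size c j ≡ + w j
colouring-of w refl = colouring 5 w

5[n/5]≤n : ∀ n → + 5 * + (n ℕ./ 5) ≤ + n
5[n/5]≤n n = ≤-trans (≤-reflexive (trans (sym (pos-* 5 (n ℕ./ 5))) (cong +_ (ℕₚ.*-comm 5 (n ℕ./ 5)))))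
  (+≤+ (DivMod.m/n*n≤m n 5))

^4-mono : ∀ {x y} → + 0 ≤ x → x ≤ y → x ^ 4 ≤ y ^ 4
^4-mono {x} {y} p r = *-mono {x} {y} p (0≤* {x} p (0≤* {x} p (0≤* {x} p 0≤k))) r
  (*-mono {x} {y} p (0≤* {x} p (0≤* {x} p 0≤k)) r (*-mono {x} {y} p (0≤* {x} p 0≤k) r (*-mono {x} {y} p 0≤k r ≤-refl)))

blowup-arithmetic : ∀ τ W N → + 0 ≤ W → + 5 * W ≤ N → + 24 * τ ≤ W ^ 4 * + 75 → + 600 * τ ≤ + 3 * N ^ 4
blowup-arithmetic τ W N 0≤W 5W≤N h = ≤-trans (≤-reflexive (eq₁ τ)) (≤-trans (*-monoˡ {+ 25} 0≤k h)
  (≤-trans (≤-reflexive (eq₂ W)) (*-monoˡ {+ 3} {(+ 5 * W) ^ 4} {N ^ 4} 0≤k (^4-mono (0≤* {+ 5} 0≤k 0≤W) 5W≤N))))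
  where
  eq₁ : ∀ t → + 600 * t ≡ + 25 * (+ 24 * t)
  eq₁ = solve-∀
  eq₂ : ∀ w → + 25 * (w * (w * (w * (w * + 1))) * + 75) ≡ + 3 * (+ 5 * w * (+ 5 * w * (+ 5 * w * (+ 5 * w * + 1))))
  eq₂ = solve-∀

-- Compare with a blow-up whose parts have at most ⌊n/5⌋ + 1 vertices. Bounding every part by this
-- `W` and allowing repetitions loses only O(n³), hidden in the shift from `n` to `n + 5`.
t-upper : ∀ {n} (G : Graph n) → IsExtremal 4 3 G → + 600 * + t 4 G ≤ + 3 * (+ 5 + + n) ^ 4
t-upper {n} G ext = bound (+ (n ℕ./ 5 ℕ.+ 1)) refl
  where
  balancedColouring = colouring-of (λ j → n ℕ./ 5 ℕ.+ bump (n ℕ.% 5) j) (balanced-total n)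
  c = proj₁ balancedColouring
  s = proj₂ balancedColouring
  bump≤1 : ∀ r j → bump r j ℕ.≤ 1
  bump≤1 r j with ⌊ toℕ j ℕ.<? r ⌋
  ... | true = ℕₚ.≤-refl
  ... | false = ℕ.z≤n
  bound : ∀ W → W ≡ + (n ℕ./ 5 ℕ.+ 1) → + 600 * + t 4 G ≤ + 3 * (+ 5 + + n) ^ 4
  bound W e = blowup-arithmetic (+ t 4 G) W (+ 5 + + n) 0≤W 5W≤
    (≤-trans (≤-reflexive (sym (T≡t G 4))) (≤-trans (T₄-mono-t {G = G} {blowup c} (proj₂ ext (blowup c) (blowup-αLess c)))
      (blowup-T₄ c W small 0≤W)))
    where
    0≤W : + 0 ≤ W
    0≤W = ≤-trans 0≤k (≤-reflexive (sym e))
    small : ∀ j → size c j ≤ W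
    small j = ≤-trans (≤-reflexive (s j)) (≤-trans (+≤+ (ℕₚ.+-monoʳ-≤ (n ℕ./ 5) (bump≤1 (n ℕ.% 5) j))) (≤-reflexive (sym e)))
    5W≤ : + 5 * W ≤ + 5 + + n
    5W≤ = ≤-trans (≤-reflexive (trans (cong (+ 5 *_) (trans e (pos-+ (n ℕ./ 5) 1))) (eq (+ (n ℕ./ 5))))) (+-monoʳ-≤ (+ 5) (5[n/5]≤n n))
      where
      eq : ∀ q → + 5 * (q + + 1) ≡ + 5 + + 5 * q
      eq = solve-∀

-- The asymptotic density 3/25

fall₄ : ℤ → ℤ
fall₄ x = x * (x - + 1) * (x - + 2) * (x - + 3)

24C : ∀ n → + 24 * + (n C 4) ≡ fall₄ (+ n)
24C zero = refl
24C (suc n) = trans (cong (λ x → + 24 * + x) (sym (nCk+nC[k+1]≡[n+1]C[k+1] n 3)))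
  (trans (cong (+ 24 *_) (pos-+ (n C 3) (n C 4))) (trans (eq (+ (n C 3)) (+ (n C 4)))
    (trans (cong₂ (λ x y → + 4 * x + y) (6C n) (24C n)) (eq′ (+ n)))))
  where
  2C : ∀ n → + 2 * + (n C 2) ≡ + n * (+ n - + 1)
  2C zero = refl
  2C (suc n) = trans (cong (λ x → + 2 * + x) (sym (nCk+nC[k+1]≡[n+1]C[k+1] n 1)))
    (trans (cong (+ 2 *_) (pos-+ (n C 1) (n C 2))) (trans (*-distribˡ-+ (+ 2) (+ (n C 1)) (+ (n C 2)))
      (trans (cong₂ (λ x y → + 2 * + x + y) (nC1≡n n) (2C n)) (e (+ n)))))
    where
    e : ∀ n → + 2 * n + n * (n - + 1) ≡ (+ 1 + n) * (+ 1 + n - + 1)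
    e = solve-∀
  6C : ∀ n → + 6 * + (n C 3) ≡ + n * (+ n - + 1) * (+ n - + 2)
  6C zero = refl
  6C (suc n) = trans (cong (λ x → + 6 * + x) (sym (nCk+nC[k+1]≡[n+1]C[k+1] n 2)))
    (trans (cong (+ 6 *_) (pos-+ (n C 2) (n C 3))) (trans (e′ (+ (n C 2)) (+ (n C 3)))
      (trans (cong₂ (λ x y → + 3 * x + y) (2C n) (6C n)) (e (+ n)))))
    where
    e′ : ∀ a b → + 6 * (a + b) ≡ + 3 * (+ 2 * a) + + 6 * b
    e′ = solve-∀
    e : ∀ n → + 3 * (n * (n - + 1)) + n * (n - + 1) * (n - + 2) ≡ (+ 1 + n) * (+ 1 + n - + 1) * (+ 1 + n - + 2)
    e = solve-∀
  eq : ∀ a b → + 24 * (a + b) ≡ + 4 * (+ 6 * a) + + 24 * b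
  eq = solve-∀
  eq′ : ∀ n → + 4 * (n * (n - + 1) * (n - + 2)) + n * (n - + 1) * (n - + 2) * (n - + 3)
    ≡ (+ 1 + n) * (+ 1 + n - + 1) * (+ 1 + n - + 2) * (+ 1 + n - + 3)
  eq′ = solve-∀

cubic-bound : ∀ N a b c d → + 1 ≤ N → + 0 ≤ b → + 0 ≤ c → + 0 ≤ d →
  a * N ^ 3 + b * (N * N) + c * N + d ≤ (a + b + c + d) * N ^ 3
cubic-bound N a b c d 1≤N 0≤b 0≤c 0≤d = ≤-from-diff (eq N a b c d)
  (0≤* {N - + 1} (i≤j⇒0≤j-i 1≤N) (0≤+ (0≤* {b} 0≤b 0≤N²) (0≤+ (0≤* {c} 0≤c (0≤+ {N * N} 0≤N² 0≤N)) (0≤* {d} 0≤d (0≤+ {N * N + N} (0≤+ {N * N} 0≤N² 0≤N) 0≤k)))))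
  where
  0≤N : + 0 ≤ N
  0≤N = ≤-trans 0≤k 1≤N
  0≤N² : + 0 ≤ N * N
  0≤N² = 0≤* {N} 0≤N 0≤N
  eq : ∀ N a b c d → (a + b + c + d) * (N * (N * (N * + 1))) - (a * (N * (N * (N * + 1))) + b * (N * N) + c * N + d)
    ≡ (N - + 1) * (b * (N * N) + (c * (N * N + N) + d * (N * N + N + + 1)))
  eq = solve-∀

-- Numerical coefficients are kept out of the ring identities by passing them as variables.
upper-arithmetic : ∀ N τ c → + 1 ≤ N → + 24 * c ≡ fall₄ N → + 600 * τ ≤ + 3 * (+ 5 + N) ^ 4 →
  + 25 * τ ≤ + 3 * c + + 162 * N ^ 3
upper-arithmetic N τ c 1≤N 24C≡ h = *-cancelˡ-≤-pos (+ 25 * τ) (+ 3 * c + + 162 * N ^ 3) (+ 24)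
  (≤-trans (≤-reflexive (sym (*-assoc (+ 24) (+ 25) τ))) (≤-trans h (≤-trans (≤-reflexive (expand (+ 5) N))
    (≤-trans (+-monoʳ-≤ (+ 3 * fall₄ N) (cubic-bound N (+ 78) (+ 417) (+ 1518) (+ 1875) 1≤N 0≤k 0≤k 0≤k))
      (≤-reflexive (sym (trans (distr (+ 24) (+ 162) c (N ^ 3)) (cong (λ x → + 3 * x + + 3888 * N ^ 3) 24C≡))))))))
  where
  distr : ∀ a k c x → a * (+ 3 * c + k * x) ≡ + 3 * (a * c) + (a * k) * x
  distr = solve-∀
  expand : ∀ s N → + 3 * ((s + N) * ((s + N) * ((s + N) * ((s + N) * + 1))))
    ≡ + 3 * (N * (N - + 1) * (N - + 2) * (N - + 3))
    + ((+ 12 * s + + 18) * (N * (N * (N * + 1))) + (+ 18 * (s * s) - + 33) * (N * N) + (+ 12 * (s * s * s) + + 18) * N + + 3 * (s * s * s * s))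
  expand = solve-∀

-- This direction needs only 183 = 25 · 6 + 33 where 24 · 162 = 3888 is available. The constant 162
-- comes from the upper bound, whose lower-order coefficients 78, 417, 1518 and 1875 sum to 3888.
lower-arithmetic : ∀ N τ c I → + 1 ≤ N → + 24 * c ≡ fall₄ N → I ≤ + 24 * τ + + 6 * N ^ 3 →
  + 3 * (N * (N * (N * N))) ≤ + 25 * I → + 3 * c ≤ + 25 * τ + + 162 * N ^ 3
lower-arithmetic N τ c I 1≤N 24C≡ I≤ h = *-cancelˡ-≤-pos (+ 3 * c) (+ 25 * τ + + 162 * N ^ 3) (+ 24) (begin
  + 24 * (+ 3 * c)                                ≡⟨ swap (+ 24) (+ 3) c ⟩
  + 3 * (+ 24 * c)                                ≡⟨ cong (+ 3 *_) 24C≡ ⟩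
  + 3 * fall₄ N                                   ≤⟨ ≤-from-diff (e₁ N) (0≤* {+ 18} 0≤k (0≤+ {N ^ 3} 0≤N³ 0≤N)) ⟩
  + 3 * (N * (N * (N * N))) + + 33 * (N * N)      ≤⟨ +-mono-≤ (≤-trans h (*-monoˡ {+ 25} 0≤k I≤)) (*-monoˡ {+ 33} 0≤k N²≤N³) ⟩
  + 25 * (+ 24 * τ + + 6 * N ^ 3) + + 33 * N ^ 3   ≡⟨ e₂ (+ 24) (+ 25) (+ 6) (+ 33) τ (N ^ 3) ⟩
  + 600 * τ + + 183 * N ^ 3                       ≤⟨ +-monoʳ-≤ (+ 600 * τ) (≤-trans (≤-reflexive (*-comm (+ 183) (N ^ 3))) (≤-trans (*-monoˡ {N ^ 3} 0≤N³ 183≤3888) (≤-reflexive (*-comm (N ^ 3) (+ 3888))))) ⟩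
  + 600 * τ + + 3888 * N ^ 3                      ≡⟨ sym (e₃ (+ 24) (+ 25) (+ 162) τ (N ^ 3)) ⟩
  + 24 * (+ 25 * τ + + 162 * N ^ 3)               ∎)
  where
  open ≤-Reasoning
  183≤3888 : + 183 ≤ + 3888
  183≤3888 = ≤ᵇ⇒≤ _
  0≤N : + 0 ≤ N
  0≤N = ≤-trans 0≤k 1≤N
  0≤N³ : + 0 ≤ N ^ 3
  0≤N³ = 0≤* {N} 0≤N (0≤* {N} 0≤N (0≤* {N} 0≤N 0≤k))
  N²≤N³ : N * N ≤ N ^ 3
  N²≤N³ = ≤-from-diff (e N) (0≤* {N * N} (0≤* {N} 0≤N 0≤N) (i≤j⇒0≤j-i 1≤N))
    where
    e : ∀ N → N * (N * (N * + 1)) - N * N ≡ N * N * (N - + 1)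
    e = solve-∀
  swap : ∀ a b c → a * (b * c) ≡ b * (a * c)
  swap = solve-∀
  e₁ : ∀ N → + 3 * (N * (N * (N * N))) + + 33 * (N * N) - + 3 * (N * (N - + 1) * (N - + 2) * (N - + 3)) ≡ + 18 * (N * (N * (N * + 1)) + N)
  e₁ = solve-∀
  e₂ : ∀ a b c d t x → b * (a * t + c * x) + d * x ≡ (a * b) * t + (b * c + d) * x
  e₂ = solve-∀
  e₃ : ∀ a b c t x → a * (b * t + c * x) ≡ (a * b) * t + (a * c) * x
  e₃ = solve-∀

thousandth : ∀ I x → + 0 ≤ + 25000 * I - + 3000 * x → + 3 * x ≤ + 25 * I
thousandth I x h = 0≤i-j⇒j≤i (*-cancelˡ-≤-pos (+ 0) (+ 25 * I - + 3 * x) (+ 1000)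
  (≤-trans h (≤-reflexive (eq (+ 1000) (+ 25) (+ 3) I x))))
  where
  eq : ∀ k a b i x → (k * a) * i - (k * b) * x ≡ k * (a * i - b * x)
  eq = solve-∀

pos-linear : ∀ n a b c → + (a ℕ.* b ℕ.+ c ℕ.* n ℕ.^ 3) ≡ + a * + b + + c * (+ n * (+ n * (+ n * + 1)))
pos-linear n a b c = trans (pos-+ (a ℕ.* b) (c ℕ.* n ℕ.^ 3)) (cong₂ _+_ (pos-* a b) (trans (pos-* c (n ℕ.^ 3))
  (cong (+ c *_) (trans (pos-* n (n ℕ.^ 2)) (cong (+ n *_) (trans (pos-* n (n ℕ.^ 1)) (cong (+ n *_) (pos-* n 1))))))))

cancel-0≤ : ∀ n x → 1 ℕ.≤ n → + 0 ≤ + n * x → + 0 ≤ x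
cancel-0≤ (suc n) x _ h = *-cancelˡ-≤-pos (+ 0) x (+ suc n) (≤-trans (≤-reflexive (*-zeroʳ (+ suc n))) h)

density-bounds′ : ∀ n → 1 ℕ.≤ n → (G : Graph n) → IsExtremal 4 3 G →
  (25 ℕ.* t 4 G ℕ.≤ 3 ℕ.* (n C 4) ℕ.+ 162 ℕ.* n ℕ.^ 3) × (3 ℕ.* (n C 4) ℕ.≤ 25 ℕ.* t 4 G ℕ.+ 162 ℕ.* n ℕ.^ 3)
density-bounds′ n 1≤n G ext =
  drop‿+≤+ (≤-trans (≤-reflexive (pos-* 25 (t 4 G)))
    (≤-trans (upper-arithmetic (+ n) (+ t 4 G) (+ (n C 4)) (+≤+ 1≤n) (24C n) (t-upper G ext))
      (≤-reflexive (sym (pos-linear n 3 (n C 4) 162))))) ,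
  drop‿+≤+ (≤-trans (≤-reflexive (pos-* 3 (n C 4)))
    (≤-trans (lower-arithmetic (+ n) (+ t 4 G) (+ (n C 4)) I₄ (+≤+ 1≤n) (24C n) I₄≤
        (thousandth I₄ (+ n * (+ n * (+ n * + n))) (cancel-0≤ n Δ 1≤n 0≤NΔ)))
      (≤-reflexive (sym (pos-linear n 25 (t 4 G) 162)))))
  where
  open Extremal G ext

density-bounds : ∀ n (G : Graph n) → IsExtremal 4 3 G →
  (25 ℕ.* t 4 G ℕ.≤ 3 ℕ.* (n C 4) ℕ.+ 162 ℕ.* n ℕ.^ 3) × (3 ℕ.* (n C 4) ℕ.≤ 25 ℕ.* t 4 G ℕ.+ 162 ℕ.* n ℕ.^ 3)
density-bounds zero G ext = ℕ.z≤n , ℕ.z≤n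
density-bounds (suc k) G ext = density-bounds′ (suc k) (ℕ.s≤s ℕ.z≤n) G ext

-- An induced path with few faults

∑⁶-drop : ∀ {n} (f : Fun₅ n) → (∑ λ a → ∑ λ b → ∑ λ c → ∑ λ d → ∑ λ u → ∑ {n} λ w → f a b c d u) ≡ + n * ∑⁵ f
∑⁶-drop {n} f = trans (∑⁵-cong λ a b c d u → ∑-const n (f a b c d u)) (∑⁵-*ˡ (+ n) f)

∑⁶-drop₃ : ∀ {n} (f : Fun₅ n) → (∑ λ a → ∑ λ b → ∑ {n} λ c → ∑ λ d → ∑ λ u → ∑ λ w → f a b d u w) ≡ + n * ∑⁵ f
∑⁶-drop₃ {n} f = trans (∑-cong λ a → trans (∑-cong λ b → ∑-const n (∑³ (f a b))) (∑-*ˡ (+ n) (λ b → ∑³ (f a b))))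
  (∑-*ˡ (+ n) (λ a → ∑⁴ (f a)))

∑⁶-drop₂ : ∀ {n} (f : Fun₅ n) → (∑ λ a → ∑ {n} λ b → ∑ λ c → ∑ λ d → ∑ λ u → ∑ λ w → f a c d u w) ≡ + n * ∑⁵ f
∑⁶-drop₂ {n} f = trans (∑-cong λ a → ∑-const n (∑⁴ (f a))) (∑-*ˡ (+ n) (λ a → ∑⁴ (f a)))

∑⁴-∑ : ∀ {n m} (f : Fin m → Fin n → Fin n → Fin n → Fin n → ℤ) →
  (∑⁴ λ a b c d → ∑ λ i → f i a b c d) ≡ ∑ λ i → ∑⁴ (f i)
∑⁴-∑ {n} {m} f = trans (∑-cong λ a → trans (∑-cong λ b → trans (∑-cong λ c → ∑-comm (λ d i → f i a b c d))
    (∑-comm (λ c i → ∑ λ d → f i a b c d))) (∑-comm (λ b i → ∑ λ c → ∑ λ d → f i a b c d)))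
  (∑-comm (λ a i → ∑³ (f i a)))

Pattern₆ : Set → Set
Pattern₆ R = Bool → Bool → Bool → Bool → Bool → Pattern R

at₆ : ∀ {X R : Set} → Pattern₆ R → (X → X → Bool) → X → X → X → X → X → X → R
at₆ g A a b c d u w = g (A a b) (A a c) (A a d) (A b c) (A b d) (A c d) (A a u) (A b u) (A c u) (A d u) (A a w) (A b w) (A c w) (A d w) (A u w)

-- For an induced path abcd: the ways in which u can fail to be attached to abcd like a vertex of a blown-up pentagon,
-- and the ways in which two vertices u, w attached in this manner can fail to be (non)adjacent accordingly.
attachFault : Fin 3 → Pattern Bool
attachFault 0F = isP₄K₁
attachFault 1F ab ac ad au bc bd bu cd cu du = isP₅ au bu cu du ab ac ad bc bd cd
attachFault 2F = isP₅

pairFault : Fin 6 → Pattern₆ Bool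
pairFault 0F ab ac ad bc bd cd au bu cu du aw bw cw dw uw = isP₄K₁ ab aw au ad bw bu bd uw dw du
pairFault 1F ab ac ad bc bd cd au bu cu du aw bw cw dw uw = isP₄K₁ aw bw uw dw ab au ad bu bd du
pairFault 2F ab ac ad bc bd cd au bu cu du aw bw cw dw uw = isP₅ au bu uw du ab aw ad bw bd dw
pairFault 3F ab ac ad bc bd cd au bu cu du aw bw cw dw uw = isP₄K₁ dw cw uw aw cd du ad cu ac au
pairFault 4F ab ac ad bc bd cd au bu cu du aw bw cw dw uw = isP₅ cu du uw au cd cw ac dw ad aw
pairFault 5F ab ac ad bc bd cd au bu cu du aw bw cw dw uw = isP₅ bu au uw du ab bw bd aw ad dw

∑⁴-neg⇒∃ : ∀ {n} (f : Fin n → Fin n → Fin n → Fin n → ℤ) → ∑⁴ f < + 0 →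
  ∃ λ a → ∃ λ b → ∃ λ c → ∃ λ d → f a b c d < + 0
∑⁴-neg⇒∃ f h with ∑-neg⇒∃ (λ a → ∑³ (f a)) h
... | a , h₁ with ∑-neg⇒∃ (λ b → ∑ λ c → ∑ (f a b c)) h₁
... | b , h₂ with ∑-neg⇒∃ (λ c → ∑ (f a b c)) h₂
... | c , h₃ with ∑-neg⇒∃ (f a b c) h₃
... | d , h₄ = a , b , c , d , h₄

ι-*-neg : ∀ p x → ι p * x < + 0 → p ≡ true × x < + 0
ι-*-neg true x h = refl , subst (_< + 0) (*-identityˡ x) h
ι-*-neg false x h = ⊥-elim (<-irrefl refl h)

module Roots {n} (A : Adj n) (sy : Symm A) (ir : Irrefl A) (tf : TriFree A) where
  open Density A sy ir tf

  β₁ : Fin n → Fin n → Fin n → Fin n → Fin n → ℤ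
  β₁ a b c d u = ∑ λ k → ι (at (attachFault k) A a b c d u)

  β₂ : Fin n → Fin n → Fin n → Fin n → Fin n → Fin n → ℤ
  β₂ a b c d u w = ∑ λ k → ι (at₆ (pairFault k) A a b c d u w)

  β : Fin n → Fin n → Fin n → Fin n → Fin n → Fin n → ℤ
  β a b c d u w = β₁ a b c d u + β₂ a b c d u w

  0≤β₁ : ∀ a b c d u → + 0 ≤ β₁ a b c d u
  0≤β₁ a b c d u = ∑-nonneg λ k → 0≤ι (at (attachFault k) A a b c d u)

  0≤β₂ : ∀ a b c d u w → + 0 ≤ β₂ a b c d u w
  0≤β₂ a b c d u w = ∑-nonneg λ k → 0≤ι (at₆ (pairFault k) A a b c d u w)

  ∑⁶ : (Fin n → Fin n → Fin n → Fin n → Fin n → Fin n → ℤ) → ℤ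
  ∑⁶ f = ∑⁴ λ a b c d → ∑ λ u → ∑ λ w → f a b c d u w

  ∑⁶-cong : ∀ {f g} → (∀ a b c d u w → f a b c d u w ≡ g a b c d u w) → ∑⁶ f ≡ ∑⁶ g
  ∑⁶-cong h = ∑⁴-cong λ a b c d → ∑-cong λ u → ∑-cong λ w → h a b c d u w

  ∑⁶-+ : ∀ f g → ∑⁶ (λ a b c d u w → f a b c d u w + g a b c d u w) ≡ ∑⁶ f + ∑⁶ g
  ∑⁶-+ f g = trans (∑⁴-cong λ a b c d → trans (∑-cong λ u → ∑-+ (f a b c d u) (g a b c d u)) (∑-+ (λ u → ∑ (f a b c d u)) (λ u → ∑ (g a b c d u))))
    (∑⁴-+ (λ a b c d → ∑ λ u → ∑ (f a b c d u)) (λ a b c d → ∑ λ u → ∑ (g a b c d u)))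

  ∑⁶-∑ : ∀ {m} (f : Fin m → Fin n → Fin n → Fin n → Fin n → Fin n → Fin n → ℤ) →
    ∑⁶ (λ a b c d u w → ∑ λ k → f k a b c d u w) ≡ ∑ λ k → ∑⁶ (f k)
  ∑⁶-∑ f = trans (∑⁴-cong λ a b c d → trans (∑-cong λ u → ∑-comm (λ w k → f k a b c d u w)) (∑-comm (λ u k → ∑ λ w → f k a b c d u w)))
    (∑⁴-∑ (λ k a b c d → ∑ λ u → ∑ λ w → f k a b c d u w))

  private
    X : ℤ
    X = + n * (+ n * Δ)

    bounded : ∀ p {x} → ⟪ ⟦ p ⟧ ⟫ ≤ + n * Δ → x ≡ + n * ⟪ ⟦ p ⟧ ⟫ → x ≤ X
    bounded p h e = ≤-trans (≤-reflexive e) (*-monoˡ {+ n} {⟪ ⟦ p ⟧ ⟫} 0≤k h)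

  attach-bounded : ∀ k → ∑⁶ (λ a b c d u w → ι (at (attachFault k) A a b c d u)) ≤ X
  attach-bounded 0F = bounded isP₄K₁ P₄K₁≤ (∑⁶-drop p)
    where
    p = at ⟦ isP₄K₁ ⟧ A
  attach-bounded 1F = bounded isP₅ P₅≤ (trans (∑⁶-cong reorder) (trans (∑⁶-drop (σ₄ (σ₃ (σ₂ (σ₁ p))))) (cong (+ n *_) (trans (∑⁵-σ₄ (σ₃ (σ₂ (σ₁ p)))) (trans (∑⁵-σ₃ (σ₂ (σ₁ p))) (trans (∑⁵-σ₂ (σ₁ p)) (∑⁵-σ₁ p)))))))
    where
    p = at ⟦ isP₅ ⟧ A
    reorder : ∀ a b c d u w → ι (at (attachFault 1F) A a b c d u) ≡ p u a b c d
    reorder a b c d u w rewrite sy u a | sy u b | sy u c | sy u d = refl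
  attach-bounded 2F = bounded isP₅ P₅≤ (∑⁶-drop p)
    where
    p = at ⟦ isP₅ ⟧ A

  -- Every fault is an induced P₄ + K₁ or P₅ on five of the six vertices. The sixth is free and
  -- contributes a factor `n`; the `σ`s bring the other five into the order of the pattern.
  pair-bounded : ∀ k → ∑⁶ (λ a b c d u w → ι (at₆ (pairFault k) A a b c d u w)) ≤ X
  pair-bounded 0F = bounded isP₄K₁ P₄K₁≤ (trans (∑⁶-cong reorder) (trans (∑⁶-drop₃ (σ₃ (σ₄ (σ₃ p)))) (cong (+ n *_) (trans (∑⁵-σ₃ (σ₄ (σ₃ p))) (trans (∑⁵-σ₄ (σ₃ p)) (∑⁵-σ₃ p))))))
    where
    p = at ⟦ isP₄K₁ ⟧ A
    reorder : ∀ a b c d u w → ι (at₆ (pairFault 0F) A a b c d u w) ≡ p a b w u d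
    reorder a b c d u w rewrite sy u d | sy w d | sy w u = refl
  pair-bounded 1F = bounded isP₄K₁ P₄K₁≤ (trans (∑⁶-cong reorder) (trans (∑⁶-drop₃ (σ₃ (σ₄ (σ₃ (σ₂ (σ₁ p)))))) (cong (+ n *_) (trans (∑⁵-σ₃ (σ₄ (σ₃ (σ₂ (σ₁ p))))) (trans (∑⁵-σ₄ (σ₃ (σ₂ (σ₁ p)))) (trans (∑⁵-σ₃ (σ₂ (σ₁ p))) (trans (∑⁵-σ₂ (σ₁ p)) (∑⁵-σ₁ p))))))))
    where
    p = at ⟦ isP₄K₁ ⟧ A
    reorder : ∀ a b c d u w → ι (at₆ (pairFault 1F) A a b c d u w) ≡ p w a b u d
    reorder a b c d u w rewrite sy u d | sy w a | sy w b | sy w d | sy w u = refl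
  pair-bounded 2F = bounded isP₅ P₅≤ (trans (∑⁶-cong reorder) (trans (∑⁶-drop₃ (σ₃ (σ₂ (σ₁ (σ₄ p))))) (cong (+ n *_) (trans (∑⁵-σ₃ (σ₂ (σ₁ (σ₄ p)))) (trans (∑⁵-σ₂ (σ₁ (σ₄ p))) (trans (∑⁵-σ₁ (σ₄ p)) (∑⁵-σ₄ p)))))))
    where
    p = at ⟦ isP₅ ⟧ A
    reorder : ∀ a b c d u w → ι (at₆ (pairFault 2F) A a b c d u w) ≡ p u a b w d
    reorder a b c d u w rewrite sy u a | sy u b | sy u d | sy w d = refl
  pair-bounded 3F = bounded isP₄K₁ P₄K₁≤ (trans (∑⁶-cong reorder) (trans (∑⁶-drop₂ (σ₁ (σ₂ (σ₁ (σ₃ (σ₄ (σ₃ (σ₂ (σ₁ p))))))))) (cong (+ n *_) (trans (∑⁵-σ₁ (σ₂ (σ₁ (σ₃ (σ₄ (σ₃ (σ₂ (σ₁ p)))))))) (trans (∑⁵-σ₂ (σ₁ (σ₃ (σ₄ (σ₃ (σ₂ (σ₁ p))))))) (trans (∑⁵-σ₁ (σ₃ (σ₄ (σ₃ (σ₂ (σ₁ p)))))) (trans (∑⁵-σ₃ (σ₄ (σ₃ (σ₂ (σ₁ p))))) (trans (∑⁵-σ₄ (σ₃ (σ₂ (σ₁ p)))) (trans (∑⁵-σ₃ (σ₂ (σ₁ p))) (trans (∑⁵-σ₂ (σ₁ p)) (∑⁵-σ₁ p)))))))))))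
    where
    p = at ⟦ isP₄K₁ ⟧ A
    reorder : ∀ a b c d u w → ι (at₆ (pairFault 3F) A a b c d u w) ≡ p w d c u a
    reorder a b c d u w rewrite sy c a | sy d a | sy d c | sy u a | sy w a | sy w c | sy w d | sy w u = refl
  pair-bounded 4F = bounded isP₅ P₅≤ (trans (∑⁶-cong reorder) (trans (∑⁶-drop₂ (σ₁ (σ₂ (σ₃ (σ₂ (σ₁ (σ₄ p))))))) (cong (+ n *_) (trans (∑⁵-σ₁ (σ₂ (σ₃ (σ₂ (σ₁ (σ₄ p)))))) (trans (∑⁵-σ₂ (σ₃ (σ₂ (σ₁ (σ₄ p))))) (trans (∑⁵-σ₃ (σ₂ (σ₁ (σ₄ p)))) (trans (∑⁵-σ₂ (σ₁ (σ₄ p))) (trans (∑⁵-σ₁ (σ₄ p)) (∑⁵-σ₄ p)))))))))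
    where
    p = at ⟦ isP₅ ⟧ A
    reorder : ∀ a b c d u w → ι (at₆ (pairFault 4F) A a b c d u w) ≡ p u c d w a
    reorder a b c d u w rewrite sy c a | sy d a | sy u a | sy u c | sy u d | sy w a = refl
  pair-bounded 5F = bounded isP₅ P₅≤ (trans (∑⁶-cong reorder) (trans (∑⁶-drop₃ (σ₁ (σ₃ (σ₂ (σ₁ (σ₄ p)))))) (cong (+ n *_) (trans (∑⁵-σ₁ (σ₃ (σ₂ (σ₁ (σ₄ p))))) (trans (∑⁵-σ₃ (σ₂ (σ₁ (σ₄ p)))) (trans (∑⁵-σ₂ (σ₁ (σ₄ p))) (trans (∑⁵-σ₁ (σ₄ p)) (∑⁵-σ₄ p))))))))
    where
    p = at ⟦ isP₅ ⟧ A
    reorder : ∀ a b c d u w → ι (at₆ (pairFault 5F) A a b c d u w) ≡ p u b a w d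
    reorder a b c d u w rewrite sy b a | sy u a | sy u b | sy u d | sy w d = refl

  ∑β≤ : ∑⁶ β ≤ + 9 * (+ n * (+ n * Δ))
  ∑β≤ = ≤-trans (≤-reflexive (∑⁶-+ (λ a b c d u w → β₁ a b c d u) β₂)) (≤-trans (+-mono-≤
    (≤-trans (≤-reflexive (∑⁶-∑ (λ k a b c d u w → ι (at (attachFault k) A a b c d u)))) (∑-bound attach-bounded))
    (≤-trans (≤-reflexive (∑⁶-∑ (λ k a b c d u w → ι (at₆ (pairFault k) A a b c d u w)))) (∑-bound pair-bounded)))
    (≤-reflexive (sym (*-distribʳ-+ X (+ 3) (+ 6)))))

  dev²-sum : ∀ (f : Fin n → ℤ) → (∑⁴ λ a b c d → f a) ≡ + n * (+ n * (+ n * ∑ f))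
  dev²-sum f = trans (∑-cong λ a → trans (∑-cong {n} λ b → trans (∑-cong {n} λ c → ∑-const n (f a)) (∑-const n (+ n * f a))) (∑-const n (+ n * (+ n * f a))))
    (trans (∑-*ˡ (+ n) (λ a → + n * (+ n * f a))) (cong (+ n *_) (trans (∑-*ˡ (+ n) (λ a → + n * f a)) (cong (+ n *_) (∑-*ˡ (+ n) f)))))

  dev² : Fin n → ℤ
  dev² x = dev x * dev x

  devs : Fin n → Fin n → Fin n → Fin n → ℤ
  devs a b c d = dev² a + (dev² b + (dev² c + dev² d))

  ∑devs≤ : ∑⁴ devs ≤ + 4 * (+ n * (+ n * Δ))
  ∑devs≤ = ≤-trans (≤-reflexive (trans (plus (λ a b c d → dev² a) (λ a b c d → dev² b + (dev² c + dev² d)) first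
      (plus (λ a b c d → dev² b) (λ a b c d → dev² c + dev² d) second (plus (λ a b c d → dev² c) (λ a b c d → dev² d) third fourth)))
      (eq (+ n) (∑ dev²)))) (*-monoˡ {+ 4} 0≤k (*-monoˡ {+ n} 0≤k dev²≤))
    where
    Y = + n * (+ n * (+ n * ∑ dev²))
    plus : ∀ f g {x y} → ∑⁴ f ≡ x → ∑⁴ g ≡ y → (∑⁴ λ a b c d → f a b c d + g a b c d) ≡ x + y
    plus f g p q = trans (∑⁴-+ f g) (cong₂ _+_ p q)
    first : (∑⁴ λ a b c d → dev² a) ≡ Y
    first = dev²-sum dev²
    second : (∑⁴ λ a b c d → dev² b) ≡ Y
    second = trans (∑-comm {n} (λ a b → ∑ {n} λ c → ∑ {n} λ d → dev² b)) first
    third : (∑⁴ λ a b c d → dev² c) ≡ Y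
    third = trans (∑-cong {n} λ a → ∑-comm {n} (λ b c → ∑ {n} λ d → dev² c)) second
    fourth : (∑⁴ λ a b c d → dev² d) ≡ Y
    fourth = trans (∑-cong {n} λ a → ∑-cong {n} λ b → ∑-comm {n} (λ c d → dev² d)) third
    eq : ∀ n s → n * (n * (n * s)) + (n * (n * (n * s)) + (n * (n * (n * s)) + n * (n * (n * s)))) ≡ + 4 * (n * (n * n * s))
    eq = solve-∀

  -- One average controls three quantities. As `β₁` does not depend on `w`, it is counted `n` times,
  -- so cost at most M n leaves at most M uncoloured vertices; it also allows at most 2 M n
  -- violating pairs and degree deviations of order √(M n) at the four path vertices.
  cost : Fin n → Fin n → Fin n → Fin n → ℤ
  cost a b c d = (∑ λ u → ∑ λ w → β a b c d u w) + devs a b c d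

  0≤β : ∀ a b c d u w → + 0 ≤ β a b c d u w
  0≤β a b c d u w = 0≤+ (0≤β₁ a b c d u) (0≤β₂ a b c d u w)

  0≤devs : ∀ a b c d → + 0 ≤ devs a b c d
  0≤devs a b c d = 0≤+ (0≤sq (dev a)) (0≤+ (0≤sq (dev b)) (0≤+ (0≤sq (dev c)) (0≤sq (dev d))))

  0≤cost : ∀ a b c d → + 0 ≤ cost a b c d
  0≤cost a b c d = 0≤+ (∑-nonneg λ u → ∑-nonneg λ w → 0≤β a b c d u w) (0≤devs a b c d)

  ∑cost≤ : (∑⁴ λ a b c d → ι (P₄ a b c d) * cost a b c d) ≤ + 13 * (+ n * (+ n * Δ))
  ∑cost≤ = ≤-trans (∑⁴-mono λ a b c d → ≤-trans (*-mono {ι (P₄ a b c d)} {+ 1} (0≤ι (P₄ a b c d)) (0≤cost a b c d) (ι≤1 (P₄ a b c d)) ≤-refl)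
      (≤-reflexive (*-identityˡ (cost a b c d))))
    (≤-trans (≤-reflexive (∑⁴-+ (λ a b c d → ∑ λ u → ∑ λ w → β a b c d u w) devs))
      (≤-trans (+-mono-≤ ∑β≤ ∑devs≤) (≤-reflexive (sym (*-distribʳ-+ (+ n * (+ n * Δ)) (+ 9) (+ 4))))))

  record Root (M : ℤ) : Set where
    field
      a b c d : Fin n
      path : P₄ a b c d ≡ true
      cost≤ : cost a b c d ≤ M * + n

  -- Averaging: if every path had cost at least M n + 1, the total cost would be at least (M n + 1)
  -- N₄, while it is at most 13 n² Δ, with 9 from the nine kinds of fault and 4 from the degrees.
  root : ∀ M → + 13 * (+ n * (+ n * Δ)) < (M * + n + + 1) * N₄ → Root M
  root M h = choose (∑⁴-neg⇒∃ (λ a b c d → ι (P₄ a b c d) * (cost a b c d - E)) total-neg)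
    where
    E = M * + n + + 1
    W = ∑⁴ λ a b c d → ι (P₄ a b c d) * cost a b c d
    eq : ∀ p x e → p * (x - e) ≡ p * x + (- e) * p
    eq = solve-∀
    cancels : ∀ w e x → w < e * x → w + (- e) * x < + 0
    cancels w e x r = <-≤-trans (+-monoˡ-< ((- e) * x) r) (≤-reflexive (fin e x))
      where
      fin : ∀ e x → e * x + (- e) * x ≡ + 0
      fin = solve-∀
    total-neg : (∑⁴ λ a b c d → ι (P₄ a b c d) * (cost a b c d - E)) < + 0
    total-neg = ≤-<-trans (≤-reflexive (trans (∑⁴-cong λ a b c d → eq (ι (P₄ a b c d)) (cost a b c d) E)
      (trans (∑⁴-+ (λ a b c d → ι (P₄ a b c d) * cost a b c d) (λ a b c d → (- E) * ι (P₄ a b c d)))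
        (cong (λ x → W + x) (∑⁴-*ˡ (- E) (λ a b c d → ι (P₄ a b c d)))))))
      (cancels W E N₄ (≤-<-trans ∑cost≤ h))
    below : ∀ x y → x - (y + + 1) < + 0 → x ≤ y
    below x y r = 0≤i-j⇒j≤i (≤-trans (i≤j⇒0≤j-i (i<j⇒suc[i]≤j r)) (≤-reflexive (e x y)))
      where
      e : ∀ x y → + 0 - (+ 1 + (x - (y + + 1))) ≡ y - x
      e = solve-∀
    choose : (∃ λ a → ∃ λ b → ∃ λ c → ∃ λ d → ι (P₄ a b c d) * (cost a b c d - E) < + 0) → Root M
    choose (a , b , c , d , r) = record
      { a = a ; b = b ; c = c ; d = d
      ; path = proj₁ (ι-*-neg (P₄ a b c d) (cost a b c d - E) r)
      ; cost≤ = below (cost a b c d) (M * + n) (proj₂ (ι-*-neg (P₄ a b c d) (cost a b c d - E) r)) }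

-- Colouring the vertices by their adjacencies to the path

-- Colour of a vertex attached to the path abcd: the vertices a, b, c, d have colours 0, 2, 4, 1, and 5 marks a failure.
colourBits : Bool → Bool → Bool → Bool → Fin 6
colourBits false true false false = 0F
colourBits false false true false = 1F
colourBits true false true false = 2F
colourBits true false false true = 3F
colourBits false true false true = 4F
colourBits _ _ _ _ = 5F

typed : Fin 6 → Bool
typed 5F = false
typed _ = true

proper : Fin 6 → Fin 5
proper 0F = 0F
proper 1F = 1F
proper 2F = 2F
proper 3F = 3F
proper 4F = 4F
proper 5F = 0F

far₆ near₆ : Adj 6
far₆ i j = typed i ∧ typed j ∧ far (proper i) (proper j)
near₆ i j = typed i ∧ typed j ∧ not (far (proper i) (proper j))

-- Colour 5 is neither far from nor near to any colour, so pairs with an uncoloured vertex never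
-- count as violations.
violates : Fin 6 → Fin 6 → Bool → Bool
violates i j b = (far₆ i j ∧ not b) ∨ (near₆ i j ∧ b)

untyped-check : Pattern Bool
untyped-check ab ac ad bc bd cd au bu cu du =
  isP₄ ab ac ad bc bd cd ⇒ᵇ
  ((not (au ∧ bu) ∧ not (bu ∧ cu) ∧ not (cu ∧ du) ∧ not (typed (colourBits au bu cu du)))
  ⇒ᵇ anyF λ k → attachFault k ab ac ad au bc bd bu cd cu du)

violation-check : Pattern₆ Bool
violation-check ab ac ad bc bd cd au bu cu du aw bw cw dw uw =
  isP₄ ab ac ad bc bd cd ⇒ᵇ
  ((not (au ∧ aw ∧ uw) ∧ not (bu ∧ bw ∧ uw) ∧ not (cu ∧ cw ∧ uw) ∧ not (du ∧ dw ∧ uw)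
    ∧ violates (colourBits au bu cu du) (colourBits aw bw cw dw) uw)
  ⇒ᵇ ((anyF λ k → pairFault k ab ac ad bc bd cd au bu cu du aw bw cw dw uw)
    ∨ (anyF λ k → pairFault k ab ac ad bc bd cd aw bw cw dw au bu cu du uw)))

path-bits : ∀ ab ac ad bc bd cd → isP₄ ab ac ad bc bd cd ≡ true → ab ≡ true × bc ≡ true × cd ≡ true
path-bits true false false true false true _ = refl , refl , refl

ι-∨≤ : ∀ p q {x} → ι q ≤ x → ι (p ∨ q) ≤ ι p + x
ι-∨≤ true q {x} h = ≤-trans (≤-reflexive (sym (+-identityʳ (+ 1)))) (+-monoʳ-≤ (+ 1) (≤-trans (0≤ι q) h))
ι-∨≤ false q h = ≤-trans h (≤-reflexive (sym (+-identityˡ _)))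

ι-mono : ∀ {p q} → (p ≡ true → q ≡ true) → ι p ≤ ι q
ι-mono {false} {q} h = 0≤ι q
ι-mono {true} h rewrite h refl = ≤-refl

not-true : ∀ {p} → (p ≡ true → ⊥) → not p ≡ true
not-true {false} h = refl
not-true {true} h = ⊥-elim (h refl)

ι-anyF : ∀ {n} (p : Fin n → Bool) → ι (anyF p) ≤ ∑ λ i → ι (p i)
ι-anyF {zero} p = ≤-refl
ι-anyF {suc n} p = ι-∨≤ (p zero) (anyF λ i → p (suc i)) (ι-anyF λ i → p (suc i))

module Colours {n} (A : Adj n) (sy : Symm A) (ir : Irrefl A) (tf : TriFree A)
  (a b c d : Fin n) (path : isP₄ (A a b) (A a c) (A a d) (A b c) (A b d) (A c d) ≡ true) where
  open Roots A sy ir tf using (β₁; β₂)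

  colour : Fin n → Fin 6
  colour u = colourBits (A a u) (A b u) (A c u) (A d u)

  no-triangle : ∀ x y z → not (A x y ∧ A x z ∧ A y z) ≡ true
  no-triangle x y z = not-true λ h → tf x y z (proj₁ (∧-true h)) (proj₂ (∧-true {A x z} (proj₂ (∧-true {A x y} h)))) (proj₁ (∧-true {A x z} (proj₂ (∧-true {A x y} h))))

  no-triangle₂ : ∀ x y z → A x y ≡ true → not (A x z ∧ A y z) ≡ true
  no-triangle₂ x y z e = not-true λ h → tf x y z e (proj₂ (∧-true {A x z} h)) (proj₁ (∧-true h))

  private
    bits = path-bits (A a b) (A a c) (A a d) (A b c) (A b d) (A c d) path
    ab = proj₁ bits
    bc = proj₁ (proj₂ bits)
    cd = proj₂ (proj₂ bits)

  -- In a triangle-free graph the neighbours of `u` on the path form one of its eight independent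
  -- sets. Five are the colours; the other three, namely none, only `a` and only `d`, are the faults
  -- of `attachFault`.
  untyped≤β₁ : ∀ u → ι (not (typed (colour u))) ≤ β₁ a b c d u
  untyped≤β₁ u = ≤-trans (ι-mono implied) (ι-anyF λ k → at (attachFault k) A a b c d u)
    where
    implied : not (typed (colour u)) ≡ true → anyF (λ k → at (attachFault k) A a b c d u) ≡ true
    implied h = ⇒ᵇ-elim (⇒ᵇ-elim (checkᵇ 10 untyped-check refl (A a b) (A a c) (A a d) (A b c) (A b d) (A c d) (A a u) (A b u) (A c u) (A d u)) path)
      (cong₂ _∧_ (no-triangle₂ a b u ab) (cong₂ _∧_ (no-triangle₂ b c u bc) (cong₂ _∧_ (no-triangle₂ c d u cd) h)))

  -- `pairFault` lists its configurations for one order of the two attached vertices only, hence the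
  -- two summands.
  violation≤β₂ : ∀ u w → ι (violates (colour u) (colour w) (A u w)) ≤ β₂ a b c d u w + β₂ a b c d w u
  violation≤β₂ u w = ≤-trans (ι-mono implied) (≤-trans (ι-∨≤ (anyF fault) (anyF fault′) ≤-refl) (+-mono-≤ (ι-anyF fault) (ι-anyF fault′)))
    where
    fault fault′ : Fin 6 → Bool
    fault k = at₆ (pairFault k) A a b c d u w
    fault′ k = at₆ (pairFault k) A a b c d w u
    -- The faults for the swapped pair mention `A w u`, whereas the check knows only `A u w`; the
    -- variable `wu` allows symmetry to identify the two.
    checked : ∀ {wu} → A u w ≡ wu → violates (colour u) (colour w) (A u w) ≡ true →
      anyF fault ∨ anyF (λ k → pairFault k (A a b) (A a c) (A a d) (A b c) (A b d) (A c d) (A a w) (A b w) (A c w) (A d w) (A a u) (A b u) (A c u) (A d u) wu) ≡ true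
    checked refl h = ⇒ᵇ-elim (⇒ᵇ-elim (checkᵇ 15 violation-check refl (A a b) (A a c) (A a d) (A b c) (A b d) (A c d)
        (A a u) (A b u) (A c u) (A d u) (A a w) (A b w) (A c w) (A d w) (A u w)) path)
      (cong₂ _∧_ (no-triangle a u w) (cong₂ _∧_ (no-triangle b u w) (cong₂ _∧_ (no-triangle c u w) (cong₂ _∧_ (no-triangle d u w) h))))
    implied : violates (colour u) (colour w) (A u w) ≡ true → anyF fault ∨ anyF fault′ ≡ true
    implied = checked (sy u w)

up : Fin 5 → Fin 6
up 0F = 0F
up 1F = 1F
up 2F = 2F
up 3F = 3F
up 4F = 4F

-- All that the structural argument needs of the path: `V` bounds the ordered violating pairs and
-- `L` bounds the five classes from below.
record Core {n} (A : Adj n) (V L : ℤ) : Set where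
  field
    colour : Fin n → Fin 6
    same : ∀ u w → typed (colour u) ≡ true → colour u ≡ colour w → A u w ≡ false
    viol≤ : (∑ λ u → ∑ λ w → ι (violates (colour u) (colour w) (A u w))) ≤ V
    sizes : ∀ i → L ≤ size colour (up i)

square-bound : ∀ x δ → + 0 ≤ δ → x * x ≤ δ * δ → - δ ≤ x × x ≤ δ
square-bound x δ 0≤δ h = low , high
  where
  high : x ≤ δ
  high = ≮⇒≥ λ δ<x → <⇒≱ (<-≤-trans (strict δ<x) ≤-refl) h
    where
    strict : δ < x → δ * δ < x * x
    strict r = ≤-<-trans (*-monoˡ {δ} 0≤δ (<⇒≤ r)) (≤-<-trans (≤-reflexive (*-comm δ x)) (positive x δ (≤-<-trans 0≤δ r) r))
      where
      positive : ∀ x y → + 0 < x → y < x → x * y < x * x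
      positive (+ suc m) y _ r = *-monoˡ-<-pos (+ suc m) r
      positive (+ 0) y p _ = ⊥-elim (<-irrefl refl p)
  low : - δ ≤ x
  low = ≮⇒≥ λ x<-δ → <⇒≱ (strict x<-δ) h
    where
    strict : x < - δ → δ * δ < x * x
    strict r = <-≤-trans (≤-<-trans (*-monoˡ {δ} 0≤δ (<⇒≤ δ<-x)) (≤-<-trans (≤-reflexive (*-comm δ (- x))) (positive (- x) δ (≤-<-trans 0≤δ δ<-x) δ<-x)))
      (≤-reflexive (eq x))
      where
      δ<-x : δ < - x
      δ<-x = ≤-<-trans (≤-reflexive (sym (neg-involutive δ))) (neg-mono-< r)
      positive : ∀ x y → + 0 < x → y < x → x * y < x * x
      positive (+ suc m) y _ r = *-monoˡ-<-pos (+ suc m) r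
      positive (+ 0) y p _ = ⊥-elim (<-irrefl refl p)
      eq : ∀ x → (- x) * (- x) ≡ x * x
      eq = solve-∀

same-check : Bool → Bool → Bool → Bool → Bool → Bool → Bool → Bool → Bool → Bool
same-check au bu cu du aw bw cw dw uw =
  (not (au ∧ aw ∧ uw) ∧ not (bu ∧ bw ∧ uw) ∧ not (cu ∧ cw ∧ uw) ∧ not (du ∧ dw ∧ uw)
    ∧ typed (colourBits au bu cu du) ∧ (colourBits au bu cu du ≡ᵇ colourBits aw bw cw dw))
  ⇒ᵇ not uw

-- The colour classes adjacent to the four vertices of the path.
attached : Fin 4 → Fin 6 → Bool
attached 0F i = (i ≡ᵇ 2F) ∨ (i ≡ᵇ 3F)
attached 1F i = (i ≡ᵇ 0F) ∨ (i ≡ᵇ 4F)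
attached 2F i = (i ≡ᵇ 1F) ∨ (i ≡ᵇ 2F)
attached 3F i = (i ≡ᵇ 3F) ∨ (i ≡ᵇ 4F)

pick : Bool → Bool → Bool → Bool → Fin 4 → Bool
pick x y z w 0F = x
pick x y z w 1F = y
pick x y z w 2F = z
pick x y z w 3F = w

attached-check : Bool → Bool → Bool → Bool → Fin 4 → Bool
attached-check au bu cu du k =
  (attached k (colourBits au bu cu du) ⇒ᵇ pick au bu cu du k)
  ∧ (pick au bu cu du k ⇒ᵇ (attached k (colourBits au bu cu du) ∨ (5F ≡ᵇ colourBits au bu cu du)))

attached-checked : ∀ k au bu cu du → attached-check au bu cu du k ≡ true
attached-checked 0F = checkᵇ 4 (λ au bu cu du → attached-check au bu cu du 0F) refl
attached-checked 1F = checkᵇ 4 (λ au bu cu du → attached-check au bu cu du 1F) refl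
attached-checked 2F = checkᵇ 4 (λ au bu cu du → attached-check au bu cu du 2F) refl
attached-checked 3F = checkᵇ 4 (λ au bu cu du → attached-check au bu cu du 3F) refl

-- Lower bounds on the class sizes x₀, …, x₄ from the degrees of a, b, c, d, where m vertices are uncoloured.
size-arithmetic : ∀ N m δ x₀ x₁ x₂ x₃ x₄ x₅ da db dc dd →
  x₀ + (x₁ + (x₂ + (x₃ + (x₄ + (x₅ + + 0))))) ≡ N → x₅ ≤ m →
  x₂ + x₃ ≤ da → da ≤ x₂ + x₃ + x₅ → x₀ + x₄ ≤ db → db ≤ x₀ + x₄ + x₅ →
  x₁ + x₂ ≤ dc → dc ≤ x₁ + x₂ + x₅ → x₃ + x₄ ≤ dd → dd ≤ x₃ + x₄ + x₅ →
  (- δ ≤ + 2 * N - + 5 * da × + 2 * N - + 5 * da ≤ δ) → (- δ ≤ + 2 * N - + 5 * db × + 2 * N - + 5 * db ≤ δ) →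
  (- δ ≤ + 2 * N - + 5 * dc × + 2 * N - + 5 * dc ≤ δ) → (- δ ≤ + 2 * N - + 5 * dd × + 2 * N - + 5 * dd ≤ δ) →
  + 0 ≤ δ → + 0 ≤ m →
  let B = N - + 3 * δ - + 15 * m in
  B ≤ + 5 * x₀ × B ≤ + 5 * x₁ × B ≤ + 5 * x₂ × B ≤ + 5 * x₃ × B ≤ + 5 * x₄
size-arithmetic _ m δ x₀ x₁ x₂ x₃ x₄ x₅ da db dc dd refl 5≤ a₁ a₂ b₁ b₂ c₁ c₂ d₁ d₂ (a₃ , a₄) (b₃ , b₄) (c₃ , c₄) (d₃ , d₄) 0≤δ 0≤m =
  ≤-from-diff (e₀ m δ x₀ x₁ x₂ x₃ x₄ x₅ dc dd)
    (0≤+ (0≤* {+ 5} 0≤k (i≤j⇒0≤j-i c₁)) (0≤+ (0≤* {+ 5} 0≤k (i≤j⇒0≤j-i d₁)) (0≤+ (i≤j⇒0≤j-i c₃) (0≤+ (i≤j⇒0≤j-i d₃) (0≤+ (0≤* {+ 5} 0≤k (i≤j⇒0≤j-i 5≤)) (0≤+ 0≤δ (0≤* {+ 10} 0≤k 0≤m))))))) ,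
  ≤-from-diff (e₁ m δ x₀ x₁ x₂ x₃ x₄ x₅ da db)
    (0≤+ (0≤* {+ 5} 0≤k (i≤j⇒0≤j-i a₁)) (0≤+ (0≤* {+ 5} 0≤k (i≤j⇒0≤j-i b₁)) (0≤+ (i≤j⇒0≤j-i a₃) (0≤+ (i≤j⇒0≤j-i b₃) (0≤+ (0≤* {+ 5} 0≤k (i≤j⇒0≤j-i 5≤)) (0≤+ 0≤δ (0≤* {+ 10} 0≤k 0≤m))))))) ,
  ≤-from-diff (e₂ m δ x₀ x₁ x₂ x₃ x₄ x₅ da db dc)
    (0≤+ (0≤* {+ 5} 0≤k (i≤j⇒0≤j-i a₂)) (0≤+ (0≤* {+ 5} 0≤k (i≤j⇒0≤j-i b₂)) (0≤+ (0≤* {+ 5} 0≤k (i≤j⇒0≤j-i c₂))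
      (0≤+ (i≤j⇒0≤j-i a₄) (0≤+ (i≤j⇒0≤j-i b₄) (0≤+ (i≤j⇒0≤j-i c₄) (0≤+ (0≤* {+ 10} 0≤k (i≤j⇒0≤j-i 5≤)) (0≤* {+ 5} 0≤k 0≤m)))))))) ,
  ≤-from-diff (e₃ m δ x₀ x₁ x₂ x₃ x₄ x₅ db dc)
    (0≤+ (0≤* {+ 5} 0≤k (i≤j⇒0≤j-i b₁)) (0≤+ (0≤* {+ 5} 0≤k (i≤j⇒0≤j-i c₁)) (0≤+ (i≤j⇒0≤j-i b₃) (0≤+ (i≤j⇒0≤j-i c₃) (0≤+ (0≤* {+ 5} 0≤k (i≤j⇒0≤j-i 5≤)) (0≤+ 0≤δ (0≤* {+ 10} 0≤k 0≤m))))))) ,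
  ≤-from-diff (e₄ m δ x₀ x₁ x₂ x₃ x₄ x₅ db dc dd)
    (0≤+ (0≤* {+ 5} 0≤k (i≤j⇒0≤j-i d₂)) (0≤+ (0≤* {+ 5} 0≤k (i≤j⇒0≤j-i b₂)) (0≤+ (0≤* {+ 5} 0≤k (i≤j⇒0≤j-i c₂))
      (0≤+ (i≤j⇒0≤j-i d₄) (0≤+ (i≤j⇒0≤j-i b₄) (0≤+ (i≤j⇒0≤j-i c₄) (0≤+ (0≤* {+ 10} 0≤k (i≤j⇒0≤j-i 5≤)) (0≤* {+ 5} 0≤k 0≤m))))))))
  where
  e₀ : ∀ m δ x₀ x₁ x₂ x₃ x₄ x₅ dc dd → let N = x₀ + (x₁ + (x₂ + (x₃ + (x₄ + (x₅ + + 0))))) in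
    + 5 * x₀ - (N - + 3 * δ - + 15 * m) ≡ + 5 * (dc - (x₁ + x₂)) + (+ 5 * (dd - (x₃ + x₄)) + (+ 2 * N - + 5 * dc - (- δ) + (+ 2 * N - + 5 * dd - (- δ) + (+ 5 * (m - x₅) + (δ + + 10 * m)))))
  e₀ = solve-∀
  e₁ : ∀ m δ x₀ x₁ x₂ x₃ x₄ x₅ da db → let N = x₀ + (x₁ + (x₂ + (x₃ + (x₄ + (x₅ + + 0))))) in
    + 5 * x₁ - (N - + 3 * δ - + 15 * m) ≡ + 5 * (da - (x₂ + x₃)) + (+ 5 * (db - (x₀ + x₄)) + (+ 2 * N - + 5 * da - (- δ) + (+ 2 * N - + 5 * db - (- δ) + (+ 5 * (m - x₅) + (δ + + 10 * m)))))
  e₁ = solve-∀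
  e₂ : ∀ m δ x₀ x₁ x₂ x₃ x₄ x₅ da db dc → let N = x₀ + (x₁ + (x₂ + (x₃ + (x₄ + (x₅ + + 0))))) in
    + 5 * x₂ - (N - + 3 * δ - + 15 * m) ≡ + 5 * (x₂ + x₃ + x₅ - da) + (+ 5 * (x₀ + x₄ + x₅ - db) + (+ 5 * (x₁ + x₂ + x₅ - dc)
      + (δ - (+ 2 * N - + 5 * da) + (δ - (+ 2 * N - + 5 * db) + (δ - (+ 2 * N - + 5 * dc) + (+ 10 * (m - x₅) + + 5 * m))))))
  e₂ = solve-∀
  e₃ : ∀ m δ x₀ x₁ x₂ x₃ x₄ x₅ db dc → let N = x₀ + (x₁ + (x₂ + (x₃ + (x₄ + (x₅ + + 0))))) in
    + 5 * x₃ - (N - + 3 * δ - + 15 * m) ≡ + 5 * (db - (x₀ + x₄)) + (+ 5 * (dc - (x₁ + x₂)) + (+ 2 * N - + 5 * db - (- δ) + (+ 2 * N - + 5 * dc - (- δ) + (+ 5 * (m - x₅) + (δ + + 10 * m)))))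
  e₃ = solve-∀
  e₄ : ∀ m δ x₀ x₁ x₂ x₃ x₄ x₅ db dc dd → let N = x₀ + (x₁ + (x₂ + (x₃ + (x₄ + (x₅ + + 0))))) in
    + 5 * x₄ - (N - + 3 * δ - + 15 * m) ≡ + 5 * (x₃ + x₄ + x₅ - dd) + (+ 5 * (x₀ + x₄ + x₅ - db) + (+ 5 * (x₁ + x₂ + x₅ - dc)
      + (δ - (+ 2 * N - + 5 * dd) + (δ - (+ 2 * N - + 5 * db) + (δ - (+ 2 * N - + 5 * dc) + (+ 10 * (m - x₅) + + 5 * m))))))
  e₄ = solve-∀

module RootCore {n} (A : Adj n) (sy : Symm A) (ir : Irrefl A) (tf : TriFree A) (1≤n : 1 ℕ.≤ n)
  (M : ℤ) (ρ : Roots.Root A sy ir tf M) where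
  open Density A sy ir tf
  open Roots A sy ir tf
  open Root ρ
  open Colours A sy ir tf a b c d path

  x : Fin 6 → ℤ
  x = size colour

  private
    Sβ = ∑ λ u → ∑ λ w → β a b c d u w

  Sβ≤ : Sβ ≤ M * + n
  Sβ≤ = ≤-trans (≤-trans (≤-reflexive (sym (+-identityʳ Sβ))) (+-monoʳ-≤ Sβ (0≤devs a b c d))) cost≤

  devs≤ : devs a b c d ≤ M * + n
  devs≤ = ≤-trans (≤-trans (≤-reflexive (sym (+-identityˡ (devs a b c d))))
    (+-monoˡ-≤ (devs a b c d) (∑-nonneg λ u → ∑-nonneg λ w → 0≤β a b c d u w))) cost≤

  Sβ-split : Sβ ≡ + n * ∑ (β₁ a b c d) + ∑ (λ u → ∑ λ w → β₂ a b c d u w)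
  Sβ-split = trans (∑-cong λ u → trans (∑-+ (λ _ → β₁ a b c d u) (β₂ a b c d u)) (cong (_+ ∑ (β₂ a b c d u)) (∑-const n (β₁ a b c d u))))
    (trans (∑-+ (λ u → + n * β₁ a b c d u) (λ u → ∑ (β₂ a b c d u))) (cong (_+ ∑ (λ u → ∑ (β₂ a b c d u))) (∑-*ˡ (+ n) (β₁ a b c d))))

  x₅≤M : x 5F ≤ M
  x₅≤M = ≤-trans (∑-mono λ u → ≤-trans (≤-reflexive (cong ι (five (colour u)))) (untyped≤β₁ u)) (cancel n 1≤n (∑ (β₁ a b c d)) M
    (≤-trans (≤-trans (≤-reflexive (sym (+-identityʳ _))) (+-monoʳ-≤ (+ n * ∑ (β₁ a b c d)) (∑-nonneg λ u → ∑-nonneg λ w → 0≤β₂ a b c d u w)))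
      (≤-trans (≤-reflexive (sym Sβ-split)) (≤-trans Sβ≤ (≤-reflexive (*-comm M (+ n)))))))
    where
    five : ∀ i → (5F ≡ᵇ i) ≡ not (typed i)
    five 0F = refl
    five 1F = refl
    five 2F = refl
    five 3F = refl
    five 4F = refl
    five 5F = refl
    cancel : ∀ n → 1 ℕ.≤ n → ∀ y z → + n * y ≤ + n * z → y ≤ z
    cancel (suc n) _ y z h = *-cancelˡ-≤-pos y z (+ suc n) h

  viol≤2Mn : (∑ λ u → ∑ λ w → ι (violates (colour u) (colour w) (A u w))) ≤ + 2 * (M * + n)
  viol≤2Mn = ≤-trans (∑-mono λ u → ∑-mono λ w → violation≤β₂ u w)
    (≤-trans (≤-reflexive (trans (∑-cong λ u → ∑-+ (β₂ a b c d u) (λ w → β₂ a b c d w u))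
      (trans (∑-+ (λ u → ∑ (β₂ a b c d u)) (λ u → ∑ λ w → β₂ a b c d w u))
        (trans (cong (λ y → S + y) (∑-comm (λ u w → β₂ a b c d w u))) (double S)))))
      (*-monoˡ {+ 2} 0≤k (≤-trans S≤ Sβ≤)))
    where
    S = ∑ λ u → ∑ λ w → β₂ a b c d u w
    double : ∀ y → y + y ≡ + 2 * y
    double = solve-∀
    S≤ : S ≤ Sβ
    S≤ = ≤-trans (≤-trans (≤-reflexive (sym (+-identityˡ S))) (+-monoˡ-≤ S (0≤* {+ n} 0≤k (∑-nonneg (0≤β₁ a b c d))))) (≤-reflexive (sym Sβ-split))

  -- Each of the five colours records at least one neighbour on the path, so two vertices of the
  -- same colour have a common neighbour there. Unlike the other adjacencies, this one holds without
  -- exception.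
  same-colour : ∀ u w → typed (colour u) ≡ true → colour u ≡ colour w → A u w ≡ false
  same-colour u w ty e = not-true⇒false (⇒ᵇ-elim (checkᵇ 9 same-check refl (A a u) (A b u) (A c u) (A d u) (A a w) (A b w) (A c w) (A d w) (A u w))
    (cong₂ _∧_ (no-triangle a u w) (cong₂ _∧_ (no-triangle b u w) (cong₂ _∧_ (no-triangle c u w) (cong₂ _∧_ (no-triangle d u w)
      (cong₂ _∧_ ty (subst (λ i → (colour u ≡ᵇ i) ≡ true) e (≡ᵇ-refl (colour u)))))))))
    where
    not-true⇒false : ∀ {p} → not p ≡ true → p ≡ false
    not-true⇒false {false} _ = refl

  vertex : Fin 4 → Fin n
  vertex 0F = a
  vertex 1F = b
  vertex 2F = c
  vertex 3F = d

  private
    picked : ∀ k u → pick (A a u) (A b u) (A c u) (A d u) k ≡ A (vertex k) u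
    picked 0F u = refl
    picked 1F u = refl
    picked 2F u = refl
    picked 3F u = refl

    check₁ : ∀ k u → attached k (colour u) ≡ true → A (vertex k) u ≡ true
    check₁ k u h = trans (sym (picked k u)) (⇒ᵇ-elim (proj₁ (∧-true (attached-checked k (A a u) (A b u) (A c u) (A d u)))) h)

    check₂ : ∀ k u → A (vertex k) u ≡ true → attached k (colour u) ∨ (5F ≡ᵇ colour u) ≡ true
    check₂ k u h = ⇒ᵇ-elim (proj₂ (∧-true {attached k (colour u) ⇒ᵇ pick (A a u) (A b u) (A c u) (A d u) k}
      (attached-checked k (A a u) (A b u) (A c u) (A d u)))) (trans (picked k u) h)

    exclusive : ∀ (i j l : Fin 6) → (i ≡ᵇ j) ≡ false → ι ((l ≡ᵇ i) ∨ (l ≡ᵇ j)) ≡ ι (i ≡ᵇ l) + ι (j ≡ᵇ l)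
    exclusive i j l e with l ≡ᵇ i in p | l ≡ᵇ j in q
    ... | true | true rewrite ≡ᵇ⇒≡ l i p | q with e
    ... | ()
    exclusive i j l e | true | false rewrite trans (≡ᵇ-sym i l) p | trans (≡ᵇ-sym j l) q = refl
    exclusive i j l e | false | true rewrite trans (≡ᵇ-sym i l) p | trans (≡ᵇ-sym j l) q = refl
    exclusive i j l e | false | false rewrite trans (≡ᵇ-sym i l) p | trans (≡ᵇ-sym j l) q = refl

  degree-bounds : ∀ k i j → (∀ l → attached k l ≡ (l ≡ᵇ i) ∨ (l ≡ᵇ j)) → (i ≡ᵇ j) ≡ false →
    x i + x j ≤ deg (vertex k) × deg (vertex k) ≤ x i + x j + x 5F
  degree-bounds k i j att i≢j =
    ≤-trans (≤-reflexive (sym class-count)) (∑-mono λ u → ι-mono (check₁ k u)) ,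
    ≤-trans (∑-mono λ u → ≤-trans (ι-mono (check₂ k u)) (ι-∨≤ (attached k (colour u)) (5F ≡ᵇ colour u) ≤-refl))
      (≤-reflexive (trans (∑-+ (λ u → ι (attached k (colour u))) (λ u → ι (5F ≡ᵇ colour u))) (cong (_+ x 5F) class-count)))
    where
    class-count : ∑ (λ u → ι (attached k (colour u))) ≡ x i + x j
    class-count = trans (∑-cong λ u → trans (cong ι (att (colour u))) (exclusive i j (colour u) i≢j))
      (∑-+ (λ u → ι (i ≡ᵇ colour u)) (λ u → ι (j ≡ᵇ colour u)))

  sizes-sum : x 0F + (x 1F + (x 2F + (x 3F + (x 4F + (x 5F + + 0))))) ≡ + n
  sizes-sum = trans (∑-cong {6} λ i → sym (*-identityʳ (x i))) (trans (sym (∑-colour colour (λ _ → + 1))) (trans (∑-const n (+ 1)) (*-identityʳ (+ n))))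

  module _ (δ : ℤ) (0≤δ : + 0 ≤ δ) (Mn≤δ² : M * + n ≤ δ * δ) where

    dev-bound : ∀ k → - δ ≤ dev (vertex k) × dev (vertex k) ≤ δ
    dev-bound k = square-bound (dev (vertex k)) δ 0≤δ (≤-trans (part k) (≤-trans devs≤ Mn≤δ²))
      where
      drop : ∀ {y} z → + 0 ≤ z → y ≤ y + z
      drop {y} z p = ≤-trans (≤-reflexive (sym (+-identityʳ y))) (+-monoʳ-≤ y p)
      drop′ : ∀ y {z w} → + 0 ≤ y → w ≤ z → w ≤ y + z
      drop′ y p q = ≤-trans q (≤-trans (≤-reflexive (sym (+-identityˡ _))) (+-monoˡ-≤ _ p))
      sq′ : ∀ v → + 0 ≤ dev² v
      sq′ v = 0≤sq (dev v)
      part : ∀ k → dev² (vertex k) ≤ devs a b c d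
      part 0F = drop {dev² a} (dev² b + (dev² c + dev² d)) (0≤+ (sq′ b) (0≤+ (sq′ c) (sq′ d)))
      part 1F = drop′ (dev² a) (sq′ a) (drop {dev² b} (dev² c + dev² d) (0≤+ (sq′ c) (sq′ d)))
      part 2F = drop′ (dev² a) (sq′ a) (drop′ (dev² b) (sq′ b) (drop {dev² c} (dev² d) (sq′ d)))
      part 3F = drop′ (dev² a) (sq′ a) (drop′ (dev² b) (sq′ b) (drop′ (dev² c) (sq′ c) ≤-refl))

    0≤M : + 0 ≤ M
    0≤M = ≤-trans (∑-nonneg λ u → 0≤ι (5F ≡ᵇ colour u)) x₅≤M

    size-bounds : ∀ i → + n - + 3 * δ - + 15 * M ≤ + 5 * x (up i)
    size-bounds = λ { 0F → proj₁ all ; 1F → proj₁ (proj₂ all) ; 2F → proj₁ (proj₂ (proj₂ all)) ; 3F → proj₁ (proj₂ (proj₂ (proj₂ all))) ; 4F → proj₂ (proj₂ (proj₂ (proj₂ all))) }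
      where
      A₀ = degree-bounds 0F 2F 3F (λ _ → refl) refl
      A₁ = degree-bounds 1F 0F 4F (λ _ → refl) refl
      A₂ = degree-bounds 2F 1F 2F (λ _ → refl) refl
      A₃ = degree-bounds 3F 3F 4F (λ _ → refl) refl
      all = size-arithmetic (+ n) M δ (x 0F) (x 1F) (x 2F) (x 3F) (x 4F) (x 5F) (deg a) (deg b) (deg c) (deg d) sizes-sum x₅≤M
        (proj₁ A₀) (proj₂ A₀) (proj₁ A₁) (proj₂ A₁) (proj₁ A₂) (proj₂ A₂) (proj₁ A₃) (proj₂ A₃)
        (dev-bound 0F) (dev-bound 1F) (dev-bound 2F) (dev-bound 3F) 0≤δ 0≤M

    core : ∀ L → + 5 * L ≤ + n - + 3 * δ - + 15 * M → Core A (+ 2 * (M * + n)) L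
    core L h = record { colour = colour ; same = same-colour ; viol≤ = viol≤2Mn
      ; sizes = λ i → *-cancelˡ-≤-pos L (x (up i)) (+ 5) (≤-trans h (size-bounds i)) }

-- Each vertex sees more than half of exactly two classes

_⇔ᵇ_ : Bool → Bool → Bool
x ⇔ᵇ y = does (x ≟ᵇ y)

⇔ᵇ-elim : ∀ {x y} → x ⇔ᵇ y ≡ true → x ≡ y
⇔ᵇ-elim {x} {y} e with x ≟ᵇ y
... | yes p = p

≟-true : ∀ {x y : ℤ} → does (x ≟ y) ≡ true → x ≡ y
≟-true {x} {y} e with x ≟ y
... | yes p = p

-- Weighted cliques: T for the blow-up in which the vertex i of B is replaced by w i vertices.
Tw : ∀ {m} → Adj m → ℕ → (Fin m → ℤ) → (Fin m → Bool) → ℤ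
Tw B zero w Ψ = + 1
Tw B (suc k) w Ψ = ∑ λ i → w i * (ι (Ψ i) * Tw B k w (λ j → Ψ j ∧ B i j))

T-push : ∀ {n m} (B : Adj m) (c : Fin n → Fin m) (Φ : Fin n → Bool) k Ψ →
  T (λ p q → B (c p) (c q)) k (λ p → Φ p ∧ Ψ (c p)) ≡ Tw B k (λ i → ∑ λ p → ι (i ≡ᵇ c p) * ι (Φ p)) Ψ
T-push B c Φ zero Ψ = refl
T-push {n} {m} B c Φ (suc k) Ψ = trans (∑-cong step) (∑-push c (λ p → ι (Φ p)) g)
  where
  w : Fin m → ℤ
  w i = ∑ λ p → ι (i ≡ᵇ c p) * ι (Φ p)
  g : Fin m → ℤ
  g i = ι (Ψ i) * Tw B k w (λ j → Ψ j ∧ B i j)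
  step : ∀ p → ι (Φ p ∧ Ψ (c p)) * T (λ p q → B (c p) (c q)) k (λ q → (Φ q ∧ Ψ (c q)) ∧ B (c p) (c q)) ≡ ι (Φ p) * g (c p)
  step p = trans (cong₂ _*_ (ι-∧ (Φ p) (Ψ (c p)))
      (trans (T-congˢ (λ p q → B (c p) (c q)) k (λ q → ∧-assoc (Φ q) (Ψ (c q)) (B (c p) (c q)))) (T-push B c Φ k (λ j → Ψ j ∧ B (c p) j))))
    (*-assoc (ι (Φ p)) (ι (Ψ (c p))) (Tw B k w (λ j → Ψ j ∧ B (c p) j)))

0≤Tw : ∀ {m} (B : Adj m) k {w} Ψ → (∀ i → + 0 ≤ w i) → + 0 ≤ Tw B k w Ψ
0≤Tw B zero Ψ p = 0≤k
0≤Tw B (suc k) {w} Ψ p = ∑-nonneg λ i → 0≤* {w i} (p i) (0≤* {ι (Ψ i)} (0≤ι (Ψ i)) (0≤Tw B k (λ j → Ψ j ∧ B i j) p))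

Tw-mono : ∀ {m} (B : Adj m) k {w w′} Ψ → (∀ i → + 0 ≤ w i) → (∀ i → w i ≤ w′ i) → Tw B k w Ψ ≤ Tw B k w′ Ψ
Tw-mono B zero Ψ p q = ≤-refl
Tw-mono B (suc k) {w} {w′} Ψ p q = ∑-mono λ i →
  *-mono {w i} {w′ i} (p i) (0≤* {ι (Ψ i)} (0≤ι (Ψ i)) (0≤Tw B k (λ j → Ψ j ∧ B i j) p)) (q i)
    (*-monoˡ {ι (Ψ i)} (0≤ι (Ψ i)) (Tw-mono B k (λ j → Ψ j ∧ B i j) p q))

Tw-scale : ∀ {m} (B : Adj m) k s w Ψ → Tw B k (λ i → s * w i) Ψ ≡ s ^ k * Tw B k w Ψ
Tw-scale B zero s w Ψ = refl
Tw-scale B (suc k) s w Ψ = trans (∑-cong λ i → trans (cong (λ x → s * w i * (ι (Ψ i) * x)) (Tw-scale B k s w (λ j → Ψ j ∧ B i j)))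
    (eq s (w i) (ι (Ψ i)) (s ^ k) (Tw B k w (λ j → Ψ j ∧ B i j))))
  (∑-*ˡ (s * s ^ k) (λ i → w i * (ι (Ψ i) * Tw B k w (λ j → Ψ j ∧ B i j))))
  where
  eq : ∀ s w i p x → s * w * (i * (p * x)) ≡ s * p * (w * (i * x))
  eq = solve-∀

triple : ∀ {n} → Adj n → (Fin n → Bool) → Fin n → Fin n → Fin n → Bool
triple B Φ p q r = Φ p ∧ ((Φ q ∧ B p q) ∧ ((Φ r ∧ B p r) ∧ B q r))

T₃-expand : ∀ {n} (B : Adj n) Φ → T B 3 Φ ≡ ∑³ λ p q r → ι (triple B Φ p q r)
T₃-expand B Φ = ∑-cong λ p → trans (sym (∑-*ˡ (ι (Φ p)) (λ q → ι (Φ q ∧ B p q) * ∑ (λ r → ι ((Φ r ∧ B p r) ∧ B q r) * + 1))))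
  (∑-cong λ q → trans (cong (ι (Φ p) *_) (sym (∑-*ˡ (ι (Φ q ∧ B p q)) (λ r → ι ((Φ r ∧ B p r) ∧ B q r) * + 1))))
    (trans (sym (∑-*ˡ (ι (Φ p)) (λ r → ι (Φ q ∧ B p q) * (ι ((Φ r ∧ B p r) ∧ B q r) * + 1))))
      (∑-cong λ r → point (Φ p) (Φ q ∧ B p q) ((Φ r ∧ B p r) ∧ B q r))))
  where
  point : ∀ x y z → ι x * (ι y * (ι z * + 1)) ≡ ι (x ∧ (y ∧ z))
  point true true true = refl
  point true true false = refl
  point true false z = refl
  point false y z = refl

-- A triple of `B` that is not one of `R` has a pair in `X`, in one of three positions, and the
-- remaining vertex is free.
T₃-perturb : ∀ {n} (B R X : Adj n) Φ → (∀ p q → B p q ≡ true → R p q ∨ X p q ≡ true) →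
  T B 3 Φ ≤ T R 3 Φ + + 3 * (+ n * (∑ λ p → ∑ λ q → ι (X p q)))
T₃-perturb {n} B R X Φ h = ≤-trans (≤-reflexive (T₃-expand B Φ)) (≤-trans
  (∑³-mono λ p q r → ≤-trans (ι-mono (implied p q r)) (ι-∨≤ (triple R Φ p q r) _ (ι-∨≤ (X p q) _ (ι-∨≤ (X p r) (X q r) ≤-refl))))
  (≤-reflexive (trans (∑³-+ (λ p q r → ι (triple R Φ p q r)) (λ p q r → ι (X p q) + (ι (X p r) + ι (X q r))))
    (cong₂ _+_ (sym (T₃-expand R Φ))
      (trans (∑³-+ (λ p q r → ι (X p q)) (λ p q r → ι (X p r) + ι (X q r))) (trans (cong₂ _+_ first
        (trans (∑³-+ (λ p q r → ι (X p r)) (λ p q r → ι (X q r))) (cong₂ _+_ second third))) (three (+ n * S))))))))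
  where
  S = ∑ λ p → ∑ λ q → ι (X p q)
  three : ∀ x → x + (x + x) ≡ + 3 * x
  three = solve-∀
  first : (∑³ λ p q r → ι (X p q)) ≡ + n * S
  first = trans (∑-cong {n} λ p → trans (∑-cong {n} λ q → ∑-const n (ι (X p q))) (∑-*ˡ (+ n) (λ q → ι (X p q)))) (∑-*ˡ (+ n) (λ p → ∑ λ q → ι (X p q)))
  second : (∑³ {n} λ p q r → ι (X p r)) ≡ + n * S
  second = trans (∑-cong {n} λ p → ∑-const n (∑ λ r → ι (X p r))) (∑-*ˡ (+ n) (λ p → ∑ λ q → ι (X p q)))
  third : (∑³ {n} λ p q r → ι (X q r)) ≡ + n * S
  third = ∑-const n S
  case-split : ∀ f g k b₁ b₂ b₃ r₁ r₂ r₃ x₁ x₂ x₃ → (b₁ ≡ true → r₁ ∨ x₁ ≡ true) → (b₂ ≡ true → r₂ ∨ x₂ ≡ true) → (b₃ ≡ true → r₃ ∨ x₃ ≡ true) →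
    f ∧ ((g ∧ b₁) ∧ ((k ∧ b₂) ∧ b₃)) ≡ true → (f ∧ ((g ∧ r₁) ∧ ((k ∧ r₂) ∧ r₃))) ∨ (x₁ ∨ (x₂ ∨ x₃)) ≡ true
  case-split true true true true true true r₁ r₂ r₃ x₁ x₂ x₃ h₁ h₂ h₃ _ with r₁ | x₁ | r₂ | x₂ | r₃ | x₃ | h₁ refl | h₂ refl | h₃ refl
  ... | true | true | true | _ | true | _ | _ | _ | _ = refl
  ... | true | false | true | _ | true | _ | _ | _ | _ = refl
  ... | false | true | _ | _ | _ | _ | _ | _ | _ = refl
  ... | true | x | false | true | _ | _ | _ | _ | _ = ∨-one x
    where
    ∨-one : ∀ x → x ∨ true ≡ true
    ∨-one true = refl
    ∨-one false = refl
  ... | true | x | true | y | false | true | _ | _ | _ = ∨-two x y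
    where
    ∨-two : ∀ x y → x ∨ (y ∨ true) ≡ true
    ∨-two true _ = refl
    ∨-two false true = refl
    ∨-two false false = refl
  implied : ∀ p q r → triple B Φ p q r ≡ true → triple R Φ p q r ∨ (X p q ∨ (X p r ∨ X q r)) ≡ true
  implied p q r = case-split (Φ p) (Φ q) (Φ r) (B p q) (B p r) (B q r) (R p q) (R p r) (R q r) (X p q) (X p r) (X q r) (h p q) (h p r) (h q r)

pick₅ : ∀ {X : Set} → X → X → X → X → X → Fin 5 → X
pick₅ a b c d e 0F = a
pick₅ a b c d e 1F = b
pick₅ a b c d e 2F = c
pick₅ a b c d e 3F = d
pick₅ a b c d e 4F = e

cover-check : (Fin 5 → Bool) → Bool
cover-check big = (allF λ i → allF λ j → far i j ⇒ᵇ not (big i ∧ big j)) ⇒ᵇ (anyF λ i → allF λ j → far i j ∨ not (big j))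

-- An independent set of the pentagon lies in the neighbourhood of one vertex.
cover : (big : Fin 5 → Bool) → (∀ i j → far i j ≡ true → big i ∧ big j ≡ false) →
  ∃ λ i → ∀ j → far i j ≡ false → big j ≡ false
cover big h = read (anyF-sound (λ i → allF λ j → far i j ∨ not (big j))
    (⇒ᵇ-elim (checkᵇ 5 (λ a b c d e → cover-check (pick₅ a b c d e)) refl (big 0F) (big 1F) (big 2F) (big 3F) (big 4F))
      (allF-complete _ λ i → allF-complete _ λ j → hyp i j)))
  where
  hyp : ∀ i j → far i j ⇒ᵇ not (big i ∧ big j) ≡ true
  hyp i j with far i j in eq
  ... | false = refl
  ... | true rewrite h i j eq = refl
  read : (∃ λ i → allF (λ j → far i j ∨ not (big j)) ≡ true) → ∃ λ i → ∀ j → far i j ≡ false → big j ≡ false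
  read (i , q) = i , λ j e → clear (far i j) (big j) e (allF-sound (λ j → far i j ∨ not (big j)) q j)
    where
    clear : ∀ x y → x ≡ false → x ∨ not y ≡ true → y ≡ false
    clear false false _ _ = refl

-- Weights 2 on the non-neighbours of i, 1 on the neighbour k and 0 on the other neighbour:
-- relative to these, a vertex seeing only half of class k has too many independent triples among its non-neighbours.
weights₅ : Fin 5 → Fin 5 → Fin 5 → ℤ
weights₅ i k j = if far i j then (if j ≡ᵇ k then + 1 else + 0) else + 2

weights : Fin 5 → Fin 5 → Fin 6 → ℤ
weights i k 5F = + 0
weights i k j = weights₅ i k (proper j)

-- With weight 2 on the three classes near `i` the count is 4³ + 4³ - 2³ = 120. Weight 1 on `k`
-- enlarges the near pair formed with its neighbour among these from 2 to 3, adding 3³ - 2³ = 19.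
weights-count : ∀ i k → far i k ≡ true → Tw near₆ 3 (weights i k) everything ≡ + 139
weights-count i k h = ≟-true (⇒ᵇ-elim (checkF 2 f refl i k) h)
  where
  f : Fin 5 → Fin 5 → Bool
  f i k = far i k ⇒ᵇ does (Tw near₆ 3 (weights i k) everything ≟ + 139)

-- `s` separates few from many neighbours in a class, and `κ` is half of what remains of a class
-- after discarding `s` vertices. In the application a class has about 50 q vertices with q =
-- ⌊n/250⌋, and `L`, `s`, `κ` are 49 q, q, 24 q.
module Typing {n} (A : Adj n) (sy : Symm A) (tf : TriFree A) {V L : ℤ} (core : Core A V L)
  (s κ : ℤ) (0≤s : + 0 ≤ s) (0≤κ : + 0 ≤ κ) (V<s² : V < s * s) (2κ+s≤L : + 2 * κ + s ≤ L)
  (J< : ∀ v → T (∁ A) 3 (∁ A v) + + 3 * (+ n * V) < + 139 * (κ * (κ * (κ * + 1)))) where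
  open Core core

  R : Adj n
  R = ∁ A

  a b : Fin 6 → Fin n → ℤ
  a i v = ∑ λ p → ι (i ≡ᵇ colour p) * ι (A v p)
  b i v = ∑ λ p → ι (i ≡ᵇ colour p) * ι (R v p)

  a+b : ∀ i v → size colour i ≡ a i v + b i v
  a+b i v = trans (∑-cong λ p → split (i ≡ᵇ colour p) (A v p)) (∑-+ (λ p → ι (i ≡ᵇ colour p) * ι (A v p)) (λ p → ι (i ≡ᵇ colour p) * ι (R v p)))
    where
    split : ∀ x y → ι x ≡ ι x * ι y + ι x * ι (not y)
    split true true = refl
    split true false = refl
    split false true = refl
    split false false = refl

  0≤b : ∀ i v → + 0 ≤ b i v
  0≤b i v = ∑-nonneg λ p → 0≤* {ι (i ≡ᵇ colour p)} (0≤ι (i ≡ᵇ colour p)) (0≤ι (R v p))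

  -- Two neighbours of `v` are never adjacent, so all pairs of neighbours of `v` taken from two far
  -- classes are violations.
  far-product : ∀ i j v → far₆ i j ≡ true → a i v * a j v ≤ V
  far-product i j v h = ≤-trans (≤-reflexive (sym (∑-product (λ p → ι (i ≡ᵇ colour p) * ι (A v p)) (λ p → ι (j ≡ᵇ colour p) * ι (A v p)))))
    (≤-trans (∑-mono λ p → ∑-mono λ q → ≤-trans (≤-reflexive (fuse (i ≡ᵇ colour p) (A v p) (j ≡ᵇ colour q) (A v q))) (ι-mono (implied p q))) viol≤)
    where
    fuse : ∀ x y z w → ι x * ι y * (ι z * ι w) ≡ ι ((x ∧ y) ∧ (z ∧ w))
    fuse x y z w = sym (trans (ι-∧ (x ∧ y) (z ∧ w)) (cong₂ _*_ (ι-∧ x y) (ι-∧ z w)))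
    implied : ∀ p q → (((i ≡ᵇ colour p) ∧ A v p) ∧ ((j ≡ᵇ colour q) ∧ A v q)) ≡ true → violates (colour p) (colour q) (A p q) ≡ true
    implied p q e with ∧-true {(i ≡ᵇ colour p) ∧ A v p} e
    ... | e₁ , e₂ with ∧-true {i ≡ᵇ colour p} e₁ | ∧-true {j ≡ᵇ colour q} e₂
    ... | ip , vp | jq , vq rewrite sym (≡ᵇ⇒≡ i (colour p) ip) | sym (≡ᵇ⇒≡ j (colour q) jq) | h with A p q in pq
    ... | true = ⊥-elim (tf v p q vp pq vq)
    ... | false = refl

  Tw-b≤ : ∀ v → Tw near₆ 3 (λ i → b i v) everything ≤ T R 3 (R v) + + 3 * (+ n * V)
  Tw-b≤ v = ≤-trans (≤-reflexive (trans (sym (T-push near₆ colour (R v) 3 everything))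
      (T-congˢ (λ p q → near₆ (colour p) (colour q)) 3 (λ p → ∧-identityʳ (R v p)))))
    (≤-trans (T₃-perturb (λ p q → near₆ (colour p) (colour q)) R (λ p q → violates (colour p) (colour q) (A p q)) (R v) cases)
      (+-monoʳ-≤ (T R 3 (R v)) (*-monoˡ {+ 3} 0≤k (*-monoˡ {+ n} 0≤k viol≤))))
    where
    cases : ∀ p q → near₆ (colour p) (colour q) ≡ true → R p q ∨ violates (colour p) (colour q) (A p q) ≡ true
    cases p q h with A p q
    ... | false = refl
    ... | true rewrite h = ∨-last (far₆ (colour p) (colour q) ∧ false)
      where
      ∨-last : ∀ x → x ∨ true ≡ true
      ∨-last true = refl
      ∨-last false = refl

  far-up : ∀ i j → far₆ (up i) (up j) ≡ far i j
  far-up i j = ⇔ᵇ-elim (checkF 2 (λ i j → far₆ (up i) (up j) ⇔ᵇ far i j) refl i j)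

  Typed : Fin n → Fin 5 → Set
  Typed v i = (∀ j → far i j ≡ true → size colour (up j) < + 2 * a (up j) v) × (∀ j → far i j ≡ false → a (up j) v < s)

  big : Fin n → Fin 5 → Bool
  big v j = does (s ≤? a (up j) v)

  big-true : ∀ v j → big v j ≡ true → s ≤ a (up j) v
  big-true v j e with s ≤? a (up j) v
  ... | yes p = p

  big-false : ∀ v j → big v j ≡ false → a (up j) v < s
  big-false v j e with s ≤? a (up j) v
  ... | no p = ≰⇒> p

  big-far : ∀ v i j → far i j ≡ true → big v i ∧ big v j ≡ false
  big-far v i j h with big v i in eᵢ | big v j in eⱼ
  ... | false | _ = refl
  ... | true | false = refl
  ... | true | true = ⊥-elim (<⇒≱ V<s² (≤-trans (*-mono {s} {a (up i) v} 0≤s 0≤s (big-true v i eᵢ) (big-true v j eⱼ))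
    (far-product (up i) (up j) v (trans (far-up i j) h))))

  b-large : ∀ v i → a (up i) v < s → κ * + 2 ≤ b (up i) v
  b-large v i r = ≤-from-diff (eq (b (up i) v) κ s (a (up i) v) (size colour (up i)) L (a+b (up i) v))
    (0≤+ (i≤j⇒0≤j-i (sizes i)) (0≤+ (i≤j⇒0≤j-i 2κ+s≤L) (i≤j⇒0≤j-i (<⇒≤ r))))
    where
    eq : ∀ b κ s a x L → x ≡ a + b → b - κ * + 2 ≡ (x - L) + (L - (+ 2 * κ + s) + (s - a))
    eq b κ s a _ L refl = e b κ s a L
      where
      e : ∀ b κ s a L → b - κ * + 2 ≡ (a + b - L) + (L - (+ 2 * κ + s) + (s - a))
      e = solve-∀

  b-half : ∀ v k → + 2 * a (up k) v ≤ size colour (up k) → κ * + 1 ≤ b (up k) v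
  b-half v k r = *-cancelˡ-≤-pos (κ * + 1) (b (up k) v) (+ 2) (≤-from-diff (eq (b (up k) v) κ s (a (up k) v) (size colour (up k)) L (a+b (up k) v))
    (0≤+ (i≤j⇒0≤j-i (sizes k)) (0≤+ (i≤j⇒0≤j-i 2κ+s≤L) (0≤+ 0≤s (i≤j⇒0≤j-i r)))))
    where
    eq : ∀ b κ s a x L → x ≡ a + b → + 2 * b - + 2 * (κ * + 1) ≡ (x - L) + (L - (+ 2 * κ + s) + (s + (x - + 2 * a)))
    eq b κ s a _ L refl = e b κ s a L
      where
      e : ∀ b κ s a L → + 2 * b - + 2 * (κ * + 1) ≡ (a + b - L) + (L - (+ 2 * κ + s) + (s + (a + b - + 2 * a)))
      e = solve-∀

  -- Otherwise `v` has at least 2 κ non-neighbours in each class near `i` and κ in class `k`. By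
  -- `weights-count` these span at least 139 κ³ near triples, more than `J<` allows even after the
  -- violations are paid for.
  half-missing : ∀ v i k → far i k ≡ true → (∀ j → far i j ≡ false → a (up j) v < s) → + 2 * a (up k) v ≤ size colour (up k) → ⊥
  half-missing v i k ik small h = <⇒≱ (J< v) (≤-trans (≤-reflexive value)
      (≤-trans (Tw-mono near₆ 3 {λ j → κ * weights i k j} {λ j → b j v} everything (λ j → 0≤* {κ} 0≤κ (0≤weights j)) below) (Tw-b≤ v)))
    where
    value : + 139 * (κ * (κ * (κ * + 1))) ≡ Tw near₆ 3 (λ j → κ * weights i k j) everything
    value = sym (trans (Tw-scale near₆ 3 κ (weights i k) everything) (trans (cong (κ ^ 3 *_) (weights-count i k ik)) (*-comm (κ ^ 3) (+ 139))))
    0≤weights₅ : ∀ j → + 0 ≤ weights₅ i k j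
    0≤weights₅ j with far i j | j ≡ᵇ k
    ... | false | _ = 0≤k
    ... | true | true = 0≤k
    ... | true | false = 0≤k
    below₅ : ∀ j → κ * weights₅ i k j ≤ b (up j) v
    below₅ j with far i j in eq | j ≡ᵇ k in eq₂
    ... | false | _ = b-large v j (small j eq)
    ... | true | true rewrite ≡ᵇ⇒≡ j k eq₂ = b-half v k h
    ... | true | false = ≤-trans (≤-reflexive (*-zeroʳ κ)) (0≤b (up j) v)
    0≤weights : ∀ j → + 0 ≤ weights i k j
    0≤weights 0F = 0≤weights₅ 0F
    0≤weights 1F = 0≤weights₅ 1F
    0≤weights 2F = 0≤weights₅ 2F
    0≤weights 3F = 0≤weights₅ 3F
    0≤weights 4F = 0≤weights₅ 4F
    0≤weights 5F = 0≤k
    below : ∀ j → κ * weights i k j ≤ b j v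
    below 0F = below₅ 0F
    below 1F = below₅ 1F
    below 2F = below₅ 2F
    below 3F = below₅ 3F
    below 4F = below₅ 4F
    below 5F = ≤-trans (≤-reflexive (*-zeroʳ κ)) (0≤b 5F v)

  -- By `far-product` and V < s², no two classes in which `v` has at least `s` neighbours are far
  -- from each other, so `cover` supplies the index.
  typing : ∀ v → Σ (Fin 5) (Typed v)
  typing v = decide (cover (big v) (big-far v))
    where
    decide : (∃ λ i → ∀ j → far i j ≡ false → big v j ≡ false) → Σ (Fin 5) (Typed v)
    decide (i , small) = i , halves , λ j e → big-false v j (small j e)
      where
      halves : ∀ j → far i j ≡ true → size colour (up j) < + 2 * a (up j) v
      halves j e = ≰⇒> (half-missing v i j e (λ j e → big-false v j (small j e)))

-- From types to a full blow-up of the pentagon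

common-neighbour : ∀ i j → far i j ≡ false → ∃ λ k → far i k ≡ true × far j k ≡ true
common-neighbour i j e = read (anyF-sound (λ k → far i k ∧ far j k)
    (⇒ᵇ-elim (checkF 2 (λ i j → not (far i j) ⇒ᵇ anyF λ k → far i k ∧ far j k) refl i j) (cong not e)))
  where
  read : (∃ λ k → far i k ∧ far j k ≡ true) → ∃ λ k → far i k ≡ true × far j k ≡ true
  read (k , h) = k , ∧-true h

common-non-neighbour : ∀ i j → far i j ≡ true → ∃ λ k → far i k ≡ false × far j k ≡ false
common-non-neighbour i j e = read (anyF-sound (λ k → not (far i k) ∧ not (far j k))
    (⇒ᵇ-elim (checkF 2 (λ i j → far i j ⇒ᵇ anyF λ k → not (far i k) ∧ not (far j k)) refl i j) e))
  where
  both : ∀ {x y} → not x ∧ not y ≡ true → x ≡ false × y ≡ false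
  both {false} {false} _ = refl , refl
  read : (∃ λ k → not (far i k) ∧ not (far j k) ≡ true) → ∃ λ k → far i k ≡ false × far j k ≡ false
  read (k , h) = k , both h

module Blowup {n} (G : Graph n) (ext : IsExtremal 4 3 G) {V L : ℤ} (core : Core (cmpl G) V L)
  (s κ : ℤ) (0≤s : + 0 ≤ s) (0≤κ : + 0 ≤ κ) (V<s² : V < s * s) (2κ+s≤L : + 2 * κ + s ≤ L) (2s+3<L : + 2 * s + + 3 < L)
  (J< : ∀ v → T (∁ (cmpl G)) 3 (∁ (cmpl G) v) + + 3 * (+ n * V) < + 139 * (κ * (κ * (κ * + 1)))) where

  A : Adj n
  A = cmpl G

  tf : TriFree A
  tf = αLess⇒TriFree G (proj₁ ext)

  open Core core
  open Typing A (cmpl-symm G) tf core s κ 0≤s 0≤κ V<s² 2κ+s≤L J<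

  τ : Fin n → Fin 5
  τ v = proj₁ (typing v)

  -- Pigeonhole: within class `k` the two indicator functions sum to more than the size of the
  -- class, and the summand is positive only at a common neighbour.
  shared-neighbour : ∀ k u w → size colour (up k) < + 2 * a (up k) u → size colour (up k) < + 2 * a (up k) w →
    ∃ λ p → A u p ≡ true × A w p ≡ true
  shared-neighbour k u w h₁ h₂ = read (∑-pos⇒∃ (λ p → χ p * ι (A u p) + χ p * ι (A w p) - χ p) positive)
    where
    χ : Fin n → ℤ
    χ p = ι (up k ≡ᵇ colour p)
    positive : + 0 < ∑ (λ p → χ p * ι (A u p) + χ p * ι (A w p) - χ p)
    positive = <-≤-trans (arith (size colour (up k)) (a (up k) u) (a (up k) w) h₁ h₂)
      (≤-reflexive (sym (trans (∑-minus (λ p → χ p * ι (A u p) + χ p * ι (A w p)) χ) (cong (_- size colour (up k)) (∑-+ (λ p → χ p * ι (A u p)) (λ p → χ p * ι (A w p)))))))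
      where
      arith : ∀ x y z → x < + 2 * y → x < + 2 * z → + 0 < y + z - x
      arith x y z p q = *-cancelˡ-<-nonNeg (+ 2) (<-≤-trans (+<+ (ℕ.s≤s ℕ.z≤n)) (≤-trans (0≤i-j⇒j≤i {i = + 2 * (y + z - x)} {j = + 2}
        (≤-trans (0≤+ (i≤j⇒0≤j-i (i<j⇒suc[i]≤j p)) (i≤j⇒0≤j-i (i<j⇒suc[i]≤j q))) (≤-reflexive (eq x y z)))) ≤-refl))
        where
        eq : ∀ x y z → (+ 2 * y - (+ 1 + x)) + (+ 2 * z - (+ 1 + x)) ≡ + 2 * (y + z - x) - + 2
        eq = solve-∀
    read : (∃ λ p → + 0 < χ p * ι (A u p) + χ p * ι (A w p) - χ p) → ∃ λ p → A u p ≡ true × A w p ≡ true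
    read (p , h) = p , both (up k ≡ᵇ colour p) (A u p) (A w p) h
      where
      both : ∀ x y z → + 0 < ι x * ι y + ι x * ι z - ι x → y ≡ true × z ≡ true
      both true true true _ = refl , refl
      both true true false (+<+ ())
      both true false true (+<+ ())
      both true false false ()
      both false y z (+<+ ())

  -- Two vertices whose types are not far both see more than half of some class, hence share a
  -- neighbour; an edge between them would close a triangle.
  homomorphism : ∀ u w → A u w ≡ true → far (τ u) (τ w) ≡ true
  homomorphism u w uw = by (far (τ u) (τ w)) refl
    where
    by : ∀ b → far (τ u) (τ w) ≡ b → far (τ u) (τ w) ≡ true
    by true e = e
    by false e = ⊥-elim (clash (common-neighbour (τ u) (τ w) e))
      where
      clash : (∃ λ k → far (τ u) k ≡ true × far (τ w) k ≡ true) → ⊥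
      clash (k , f₁ , f₂) = triangle (shared-neighbour k u w (proj₁ (proj₂ (typing u)) k f₁) (proj₁ (proj₂ (typing w)) k f₂))
        where
        triangle : (∃ λ p → A u p ≡ true × A w p ≡ true) → ⊥
        triangle (p , up′ , wp) = tf u w p uw wp up′

  -- A vertex of class k outside a set F of at most three vertices that is not adjacent to u or w.
  avoid : ∀ k u w (F : Fin n → ℤ) → ∑ F ≤ + 3 → (∀ p → + 0 ≤ F p) → a (up k) u < s → a (up k) w < s →
    ∃ λ p → up k ≡ colour p × A u p ≡ false × A w p ≡ false × F p < + 1
  avoid k u w F F≤3 0≤F h₁ h₂ = read (∑-pos⇒∃ (λ p → χ p - (χ p * ι (A u p) + χ p * ι (A w p) + F p)) positive)
    where
    χ : Fin n → ℤ
    χ p = ι (up k ≡ᵇ colour p)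
    positive : + 0 < ∑ (λ p → χ p - (χ p * ι (A u p) + χ p * ι (A w p) + F p))
    positive = <-≤-trans (arith (size colour (up k)) (a (up k) u) (a (up k) w) (∑ F) s L (sizes k) h₁ h₂ F≤3 2s+3<L)
      (≤-reflexive (sym (trans (∑-minus χ (λ p → χ p * ι (A u p) + χ p * ι (A w p) + F p)) (cong (λ x → size colour (up k) - x)
        (trans (∑-+ (λ p → χ p * ι (A u p) + χ p * ι (A w p)) F) (cong (_+ ∑ F) (∑-+ (λ p → χ p * ι (A u p)) (λ p → χ p * ι (A w p)))))))))
      where
      arith : ∀ x y z f s L → L ≤ x → y < s → z < s → f ≤ + 3 → + 2 * s + + 3 < L → + 0 < x - (y + z + f)
      arith x y z f s L p q r t o = <-≤-trans (+<+ (ℕ.s≤s ℕ.z≤n)) (0≤i-j⇒j≤i {j = + 1} (≤-trans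
        (0≤+ (i≤j⇒0≤j-i p) (0≤+ (i≤j⇒0≤j-i (<⇒≤ q)) (0≤+ (i≤j⇒0≤j-i (<⇒≤ r)) (0≤+ (i≤j⇒0≤j-i t) (i≤j⇒0≤j-i (i<j⇒suc[i]≤j o))))))
        (≤-reflexive (eq x y z f s L))))
        where
        eq : ∀ x y z f s L → x - L + (s - y + (s - z + (+ 3 - f + (L - (+ 1 + (+ 2 * s + + 3)))))) ≡ x - (y + z + f) - + 1
        eq = solve-∀
    read : (∃ λ p → + 0 < χ p - (χ p * ι (A u p) + χ p * ι (A w p) + F p)) → ∃ λ p → up k ≡ colour p × A u p ≡ false × A w p ≡ false × F p < + 1
    read (p , h) = p , ≡ᵇ⇒≡ (up k) (colour p) (proj₁ parts) , proj₂ parts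
      where
      nope : ∀ m f → + 0 ≤ f → m ≤ + 0 → + 0 < m - f → ⊥
      nope m f p q r = <-irrefl refl (<-≤-trans r (≤-trans (+-monoˡ-≤ (- f) q) (≤-trans (≤-reflexive (+-identityˡ (- f))) (neg-mono-≤ p))))
      rearr : ∀ x y f → + 0 < x - (y + f) → + 0 < (x - y) - f
      rearr x y f r = <-≤-trans r (≤-reflexive (eq x y f))
        where
        eq : ∀ x y f → x - (y + f) ≡ (x - y) - f
        eq = solve-∀
      four : ∀ x y z f → + 0 ≤ f → + 0 < ι x - (ι x * ι y + ι x * ι z + f) → x ≡ true × y ≡ false × z ≡ false × f < + 1
      four false y z f 0≤f r = ⊥-elim (nope (+ 0) f 0≤f ≤-refl (rearr (+ 0) (+ 0) f r))
      four true true true f 0≤f r = ⊥-elim (nope (+ 1 - + 2) f 0≤f -≤+ (rearr (+ 1) (+ 2) f r))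
      four true true false f 0≤f r = ⊥-elim (nope (+ 0) f 0≤f ≤-refl (rearr (+ 1) (+ 1) f r))
      four true false true f 0≤f r = ⊥-elim (nope (+ 0) f 0≤f ≤-refl (rearr (+ 1) (+ 1) f r))
      four true false false f 0≤f r = refl , refl , refl , less
        where
        less : f < + 1
        less = subst (_< + 1) (+-identityˡ f) (subst (+ 0 + f <_) (eq f) (+-monoˡ-< f r))
          where
          eq : ∀ f → + 1 - (+ 0 + f) + f ≡ + 1
          eq = solve-∀
      parts = four (up k ≡ᵇ colour p) (A u p) (A w p) (F p) (0≤F p) h

  δ : Fin n → Fin n → ℤ
  δ u p = ι (p ≡ᵇ u)

  ∑δ : ∀ u → ∑ (δ u) ≡ + 1
  ∑δ u = trans (∑-cong λ p → sym (*-identityʳ (ι (p ≡ᵇ u)))) (∑-δ u (λ _ → + 1))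

  distinct : ∀ u w x p → δ u p + (δ w p + δ x p) < + 1 → u ≢ p × w ≢ p × x ≢ p
  distinct u w x p h = apart u (proj₁ none) , apart w (proj₁ (proj₂ none)) , apart x (proj₂ (proj₂ none))
    where
    zero-sum : ∀ x y z → ι x + (ι y + ι z) < + 1 → x ≡ false × y ≡ false × z ≡ false
    zero-sum false false false _ = refl , refl , refl
    zero-sum true false false (+<+ (ℕ.s≤s ()))
    zero-sum true true false (+<+ (ℕ.s≤s ()))
    zero-sum true false true (+<+ (ℕ.s≤s ()))
    zero-sum true true true (+<+ (ℕ.s≤s ()))
    zero-sum false true false (+<+ (ℕ.s≤s ()))
    zero-sum false true true (+<+ (ℕ.s≤s ()))
    zero-sum false false true (+<+ (ℕ.s≤s ()))
    none = zero-sum (p ≡ᵇ u) (p ≡ᵇ w) (p ≡ᵇ x) h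
    apart : ∀ v → (p ≡ᵇ v) ≡ false → v ≢ p
    apart v e refl = true≢false (≡ᵇ-refl v) e

  G′ : Graph n
  G′ = blowup τ

  cmpl-false⇒adj : ∀ i j → A i j ≡ false → i ≢ j → adj G i j ≡ true
  cmpl-false⇒adj i j e = cmpl-cover G i j (cong not e)

  G′⊆G : ∀ i j → adj G′ i j ≡ true → adj G i j ≡ true
  G′⊆G i j h = cmpl-false⇒adj i j (by (A i j) refl) i≢j
    where
    i≢j : i ≢ j
    i≢j refl = true≢false h (irrefl G′ i)
    by : ∀ b → A i j ≡ b → A i j ≡ false
    by false e = e
    by true e = ⊥-elim (true≢false (proj₂ (∧-true {not (i ≡ᵇ j)} h)) (cong not (homomorphism i j e)))

  δ₃ : Fin n → Fin n → Fin n → Fin n → ℤ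
  δ₃ u w x p = δ u p + (δ w p + δ x p)

  ∑δ₃ : ∀ u w x → ∑ (δ₃ u w x) ≤ + 3
  ∑δ₃ u w x = ≤-reflexive (trans (∑-+ (δ u) (λ p → δ w p + δ x p)) (cong₂ _+_ (∑δ u) (trans (∑-+ (δ w) (δ x)) (cong₂ _+_ (∑δ w) (∑δ x)))))

  0≤δ₃ : ∀ u w x p → + 0 ≤ δ₃ u w x p
  0≤δ₃ u w x p = 0≤+ (0≤ι (p ≡ᵇ u)) (0≤+ (0≤ι (p ≡ᵇ w)) (0≤ι (p ≡ᵇ x)))

  typed-up : ∀ k → typed (up k) ≡ true
  typed-up 0F = refl
  typed-up 1F = refl
  typed-up 2F = refl
  typed-up 3F = refl
  typed-up 4F = refl

  -- A missing edge of the complement would lie in a 4-clique of G that the full blow-up does not have.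
  complete : ∀ u w → far (τ u) (τ w) ≡ true → A u w ≡ true
  complete u w f = by (A u w) refl
    where
    u≢w : u ≢ w
    u≢w refl = true≢false f (cmpl-irrefl pentagon (τ u))
    by : ∀ b → A u w ≡ b → A u w ≡ true
    by true e = e
    by false e = ⊥-elim (clash (common-non-neighbour (τ u) (τ w) f))
      where
      clash : (∃ λ k → far (τ u) k ≡ false × far (τ w) k ≡ false) → ⊥
      -- For the first vertex only `u` and `w` must be avoided; `u` is repeated so that the same
      -- three-point set serves both choices.
      clash (k , f₁ , f₂) = first (avoid k u w (δ₃ u w u) (∑δ₃ u w u) (0≤δ₃ u w u) su sw)
        where
        su = proj₂ (proj₂ (typing u)) k f₁
        sw = proj₂ (proj₂ (typing w)) k f₂
        first : (∃ λ p → up k ≡ colour p × A u p ≡ false × A w p ≡ false × δ₃ u w u p < + 1) → ⊥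
        first (p , kp , up′ , wp , dp) = second (avoid k u w (δ₃ u w p) (∑δ₃ u w p) (0≤δ₃ u w p) su sw)
          where
          second : (∃ λ q → up k ≡ colour q × A u q ≡ false × A w q ≡ false × δ₃ u w p q < + 1) → ⊥
          second (q , kq , uq , wq , dq) = <⇒≱ strict (T₄-mono-t {G = G} {G′} (proj₂ ext G′ (blowup-αLess τ)))
            where
            Dp = distinct u w u p dp
            Dq = distinct u w p q dq
            pq : A p q ≡ false
            pq = same p q (trans (cong typed (sym kp)) (typed-up k)) (trans (sym kp) kq)
            ¬uw : adj G′ u w ≡ false
            ¬uw = trans (cong (λ b → not (u ≡ᵇ w) ∧ not b) f) (∧-zeroʳ (not (u ≡ᵇ w)))
            strict : T (adj G′) 4 everything < T (adj G) 4 everything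
            strict = T₄-strict (adj G′) (adj G) G′⊆G u w p q ¬uw (cmpl-false⇒adj u w e u≢w)
              (cmpl-false⇒adj u p up′ (proj₁ Dp)) (cmpl-false⇒adj u q uq (proj₁ Dq))
              (cmpl-false⇒adj w p wp (proj₁ (proj₂ Dp))) (cmpl-false⇒adj w q wq (proj₁ (proj₂ Dq)))
              (cmpl-false⇒adj p q pq (proj₂ (proj₂ Dq)))

  is-blowup : ∀ u w → A u w ≡ far (τ u) (τ w)
  is-blowup u w = by (A u w) (far (τ u) (τ w)) refl refl
    where
    by : ∀ x y → A u w ≡ x → far (τ u) (τ w) ≡ y → A u w ≡ far (τ u) (τ w)
    by true _ e _ = trans e (sym (homomorphism u w e))
    by false false e f = trans e (sym f)
    by false true e f = trans (complete u w f) (sym f)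

IsBlowup : ∀ {n} → Graph n → (Fin n → Fin 5) → Set
IsBlowup G τ = ∀ u w → cmpl G u w ≡ far (τ u) (τ w)

IsBlowup⇒Partition : ∀ {n} (G : Graph n) τ → IsBlowup G τ → IsC5BlowupPartition G τ
IsBlowup⇒Partition G τ h =
  (λ u v u≢v e → cmpl-cover G u v (cong not (trans (h u v) (close (τ u) (τ v) e))) u≢v) ,
  (λ u v e → cmpl-adj G u v (trans (h u v) (trans (cong (far (τ u)) e) (opposite (τ u)))))
  where
  opposite : ∀ i → far i (succ5 (succ5 i)) ≡ true
  opposite 0F = refl
  opposite 1F = refl
  opposite 2F = refl
  opposite 3F = refl
  opposite 4F = refl
  close₁ : ∀ i → far i (succ5 i) ≡ false
  close₁ 0F = refl
  close₁ 1F = refl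
  close₁ 2F = refl
  close₁ 3F = refl
  close₁ 4F = refl
  close : ∀ i j → (j ≡ i ⊎ j ≡ succ5 i ⊎ i ≡ succ5 j) → far i j ≡ false
  close i _ (inj₁ refl) = cmpl-irrefl pentagon i
  close i _ (inj₂ (inj₁ refl)) = close₁ i
  close _ j (inj₂ (inj₂ refl)) = trans (cmpl-symm pentagon (succ5 j) j) (close₁ j)

-- Arithmetic of the thresholds

0<-cancel : ∀ {x y} → + 0 ≤ x → + 0 < x * y → + 0 < y
0<-cancel {x} {y} p h = ≰⇒> λ y≤0 → <⇒≱ h (≤-trans (*-monoˡ {x} p y≤0) (≤-reflexive (*-zeroʳ x)))

1≤* : ∀ {x y} → + 1 ≤ x → + 1 ≤ y → + 1 ≤ x * y
1≤* {x} {y} p q = *-mono {+ 1} {x} {+ 1} {y} 0≤k 0≤k p q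

-- Since Δ is at most γ N³ and N at least 2 α γ, the term α N Δ is at most N⁵/2. This leaves N⁵ ≤ 4
-- α N N₄, and the value 13 · 4 α γ of `M` is what the averaging in `root` then requires.
root-arithmetic : ∀ α γ N Δ N₄ → + 1 ≤ N → + 0 ≤ α → + 0 ≤ γ → Δ ≤ γ * N ^ 3 → + 2 * α * γ ≤ N →
  N * (N * (N * (N * N))) ≤ α * (N * Δ) + + 2 * α * (N * N₄) →
  + 13 * (N * (N * Δ)) < (+ 13 * (+ 4 * α * γ) * N + + 1) * N₄
root-arithmetic α γ N Δ N₄ 1≤N 0≤α 0≤γ Δ≤ N≥ rich = 0<diff (0<-cancel {N} 0≤N (<-≤-trans pos-NN₄
    (≤-from-diff (e₂ α γ N Δ N₄) (0≤+ (0≤* {+ 13 * (γ * N)} (0≤* {+ 13} 0≤k (0≤* {γ} 0≤γ 0≤N)) (i≤j⇒0≤j-i many))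
      (0≤* {+ 13 * (N * (N * N))} (0≤* {+ 13} 0≤k (0≤* {N} 0≤N (0≤* {N} 0≤N 0≤N))) (i≤j⇒0≤j-i Δ≤))))))
  where
  0≤N : + 0 ≤ N
  0≤N = ≤-trans 0≤k 1≤N
  N⁵ = N * (N * (N * (N * N)))
  many : N⁵ ≤ + 4 * α * (N * N₄)
  many = ≤-from-diff (e₁ α γ N Δ N₄) (0≤+ (0≤* {+ 2} 0≤k (i≤j⇒0≤j-i rich)) (0≤+ (0≤* {+ 2 * (α * N)} (0≤* {+ 2} 0≤k (0≤* {α} 0≤α 0≤N)) (i≤j⇒0≤j-i Δ≤))
    (0≤* {N * (N * (N * N))} (0≤* {N} 0≤N (0≤* {N} 0≤N (0≤* {N} 0≤N 0≤N))) (i≤j⇒0≤j-i N≥))))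
    where
    e₁ : ∀ α γ N Δ N₄ → + 4 * α * (N * N₄) - N * (N * (N * (N * N)))
      ≡ + 2 * (α * (N * Δ) + + 2 * α * (N * N₄) - N * (N * (N * (N * N)))) + (+ 2 * (α * N) * (γ * (N * (N * (N * + 1))) - Δ) + N * (N * (N * N)) * (N - + 2 * α * γ))
    e₁ = solve-∀
  pos-NN₄ : + 0 < N * N₄
  pos-NN₄ = 0<-cancel {+ 4 * α} (0≤* {+ 4} 0≤k 0≤α) (<-≤-trans (+<+ (ℕ.s≤s ℕ.z≤n)) (≤-trans (1≤* {N} 1≤N (1≤* {N} 1≤N (1≤* {N} 1≤N (1≤* {N} {N} 1≤N 1≤N)))) many))
  0<diff : ∀ {x y} → + 0 < y - x → x < y
  0<diff {x} {y} h = ≤-<-trans (≤-reflexive (sym (+-identityˡ x))) (<-≤-trans (+-monoˡ-< x h) (≤-reflexive (e x y)))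
    where
    e : ∀ x y → y - x + x ≡ y
    e = solve-∀
  e₂ : ∀ α γ N Δ N₄ → N * ((+ 13 * (+ 4 * α * γ) * N + + 1) * N₄ - + 13 * (N * (N * Δ))) - N * N₄
    ≡ + 13 * (γ * N) * (+ 4 * α * (N * N₄) - N * (N * (N * (N * N)))) + + 13 * (N * (N * N)) * (γ * (N * (N * (N * + 1))) - Δ)
  e₂ = solve-∀

-- Up to the factor 1000, 4035 = 3885 + 150: the first is 60 + 450 + 1500 + 1875 from expanding 3 (N
-- + 5)⁴, the second 25 · 6 from tuples with repetitions.
Δ-arithmetic : ∀ N τ I → + 1 ≤ N → I ≤ + 24 * τ + + 6 * N ^ 3 → + 600 * τ ≤ + 3 * (+ 5 + N) ^ 4 →
  + 25000 * I - + 3000 * (N * (N * (N * N))) ≤ + 4035000 * N ^ 3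
Δ-arithmetic N τ I 1≤N I≤ t≤ = ≤-trans (≤-reflexive (e₁ (+ 1000) (+ 25) (+ 3) I (N * (N * (N * N)))))
  (≤-trans (*-monoˡ {+ 1000} 0≤k inner) (≤-reflexive (sym (*-assoc (+ 1000) (+ 4035) (N ^ 3)))))
  where
  e₁ : ∀ k a b i x → (k * a) * i - (k * b) * x ≡ k * (a * i - b * x)
  e₁ = solve-∀
  expand : ∀ s N → + 3 * ((s + N) * ((s + N) * ((s + N) * ((s + N) * + 1))))
    ≡ + 3 * (N * (N * (N * N))) + ((+ 12 * s) * (N * (N * (N * + 1))) + (+ 18 * (s * s)) * (N * N) + (+ 12 * (s * s * s)) * N + + 3 * (s * s * s * s))
  expand = solve-∀
  e₂ : ∀ a b c t x → a * (b * t + c * x) ≡ (b * a) * t + (a * c) * x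
  e₂ = solve-∀
  e₃ : ∀ p x y z → p + x * z + y * z - p ≡ (x + y) * z
  e₃ = solve-∀
  inner : + 25 * I - + 3 * (N * (N * (N * N))) ≤ + 4035 * N ^ 3
  inner = ≤-trans (+-monoˡ-≤ (- (+ 3 * (N * (N * (N * N)))))
    (≤-trans (*-monoˡ {+ 25} 0≤k I≤) (≤-trans (≤-reflexive (e₂ (+ 25) (+ 24) (+ 6) τ (N ^ 3))) (+-monoˡ-≤ (+ 150 * N ^ 3)
      (≤-trans t≤ (≤-trans (≤-reflexive (expand (+ 5) N)) (+-monoʳ-≤ (+ 3 * (N * (N * (N * N)))) (cubic-bound N (+ 60) (+ 450) (+ 1500) (+ 1875) 1≤N 0≤k 0≤k 0≤k))))))))
    (≤-reflexive (e₃ (+ 3 * (N * (N * (N * N)))) (+ 3885) (+ 150) (N ^ 3)))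

-- As for Δ, with 4110 = 3885 + 25 · 9.
J-arithmetic : ∀ N τ J → + 1 ≤ N → N * J ≤ + 24 * τ + + 9 * N ^ 3 → + 600 * τ ≤ + 3 * (+ 5 + N) ^ 4 →
  N * (+ 25 * J) ≤ N * (+ 3 * (N * (N * N)) + + 4110 * (N * N))
J-arithmetic N τ J 1≤N J≤ t≤ = ≤-trans (≤-reflexive (e₁ N (+ 25) J)) (≤-trans (*-monoˡ {+ 25} 0≤k J≤)
  (≤-trans (≤-reflexive (e₂ (+ 25) (+ 24) (+ 9) τ (N ^ 3))) (≤-trans (+-monoˡ-≤ (+ 225 * N ^ 3)
    (≤-trans t≤ (≤-trans (≤-reflexive (expand (+ 5) N)) (+-monoʳ-≤ (+ 3 * (N * (N * (N * N)))) (cubic-bound N (+ 60) (+ 450) (+ 1500) (+ 1875) 1≤N 0≤k 0≤k 0≤k)))))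
    (≤-reflexive (e₃ (+ 3) (+ 3885) (+ 225) N)))))
  where
  e₁ : ∀ n a j → n * (a * j) ≡ a * (n * j)
  e₁ = solve-∀
  e₂ : ∀ a b c t x → a * (b * t + c * x) ≡ (b * a) * t + (a * c) * x
  e₂ = solve-∀
  expand : ∀ s N → + 3 * ((s + N) * ((s + N) * ((s + N) * ((s + N) * + 1))))
    ≡ + 3 * (N * (N * (N * N))) + ((+ 12 * s) * (N * (N * (N * + 1))) + (+ 18 * (s * s)) * (N * N) + (+ 12 * (s * s * s)) * N + + 3 * (s * s * s * s))
  expand = solve-∀
  e₃ : ∀ c a b N → c * (N * (N * (N * N))) + a * (N * (N * (N * + 1))) + b * (N * (N * (N * + 1))) ≡ N * (c * (N * (N * N)) + (a + b) * (N * N))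
  e₃ = solve-∀

-- Here N ≤ p (q + 1) with p = 250 and κ = c q with c = 24; a, d, h stand for numerical coefficients.
typing-arithmetic : ∀ a d h p c k E q N X → + 1 ≤ q → + 0 ≤ N → N ≤ p * (q + + 1) → + 0 ≤ E → + 0 ≤ a → + 0 ≤ d →
  a ≡ + 3 * (p * (p * p)) → a + d ≡ + 25 * (k * (c * (c * c))) → + 7 * a < h * d → + 4 * (p * p) ≤ d → h + E ≤ q →
  + 25 * X ≤ + 3 * (N * (N * N)) + E * (N * N) → X < k * (c * q * (c * q * (c * q * + 1)))
typing-arithmetic a d h p c k E q N X 1≤q 0≤N N≤ 0≤E 0≤a 0≤d a≡ ad≡ 7a<hd 4p²≤d h+E≤q X≤ =
  *-cancelˡ-<-nonNeg (+ 25) (≤-<-trans X≤ (<-≤-trans strict (≤-reflexive (trans (cong (_* (q * (q * q))) ad≡) (e₀ c k q)))))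
  where
  0≤q : + 0 ≤ q
  0≤q = ≤-trans 0≤k 1≤q
  Q = q + + 1
  e₀ : ∀ c k q → + 25 * (k * (c * (c * c))) * (q * (q * q)) ≡ + 25 * (k * (c * q * (c * q * (c * q * + 1))))
  e₀ = solve-∀
  N²≤ : N * N ≤ p * Q * (p * Q)
  N²≤ = *-mono {N} {p * Q} 0≤N 0≤N N≤ N≤
  N³≤ : N * (N * N) ≤ p * Q * (p * Q * (p * Q))
  N³≤ = *-mono {N} {p * Q} 0≤N (0≤* {N} 0≤N 0≤N) N≤ N²≤
  Q²≤ : Q * Q ≤ + 4 * (q * q)
  Q²≤ = ≤-from-diff (e q) (0≤* {q - + 1} (i≤j⇒0≤j-i 1≤q) (0≤+ {+ 3 * q} (0≤* {+ 3} 0≤k 0≤q) 0≤k))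
    where
    e : ∀ q → + 4 * (q * q) - (q + + 1) * (q + + 1) ≡ (q - + 1) * (+ 3 * q + + 1)
    e = solve-∀
  Q³≤ : Q * (Q * Q) ≤ q * (q * q) + + 7 * (q * q)
  Q³≤ = ≤-from-diff (e q) (0≤* {q - + 1} (i≤j⇒0≤j-i 1≤q) (0≤+ {+ 4 * q} (0≤* {+ 4} 0≤k 0≤q) 0≤k))
    where
    e : ∀ q → q * (q * q) + + 7 * (q * q) - (q + + 1) * ((q + + 1) * (q + + 1)) ≡ (q - + 1) * (+ 4 * q + + 1)
    e = solve-∀
  cube : + 3 * (N * (N * N)) ≤ a * (q * (q * q) + + 7 * (q * q))
  cube = ≤-trans (*-monoˡ {+ 3} 0≤k N³≤) (≤-trans (≤-reflexive (trans (e p Q) (cong (_* (Q * (Q * Q))) (sym a≡)))) (*-monoˡ {a} 0≤a Q³≤))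
    where
    e : ∀ p Q → + 3 * (p * Q * (p * Q * (p * Q))) ≡ + 3 * (p * (p * p)) * (Q * (Q * Q))
    e = solve-∀
  quad : E * (N * N) ≤ E * (d * (q * q))
  quad = *-monoˡ {E} 0≤E (≤-trans N²≤ (≤-trans (≤-reflexive (e p Q)) (≤-trans (*-monoˡ {p * p} (0≤sq p) Q²≤)
    (≤-trans (≤-reflexive (e′ (p * p) (q * q))) (≤-trans (*-monoˡ {q * q} (0≤sq q) 4p²≤d) (≤-reflexive (*-comm (q * q) d)))))))
    where
    e : ∀ p Q → p * Q * (p * Q) ≡ p * p * (Q * Q)
    e = solve-∀
    e′ : ∀ x y → x * (+ 4 * y) ≡ y * (+ 4 * x)
    e′ = solve-∀
  strict : + 3 * (N * (N * N)) + E * (N * N) < (a + d) * (q * (q * q))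
  strict = ≤-<-trans (+-mono-≤ cube quad) (<-≤-trans (+-monoˡ-< (E * (d * (q * q)))
      (≤-<-trans (≤-reflexive (e₁ a q)) (+-monoʳ-< (a * (q * (q * q))) (less (+ 7 * a) (h * d) 7a<hd))))
    (≤-from-diff (e₂ a d h E q) (0≤* {d} 0≤d (0≤* {q * q} (0≤sq q) (i≤j⇒0≤j-i h+E≤q)))))
    where
    1≤q² : + 1 ≤ q * q
    1≤q² = 1≤* {q} {q} 1≤q 1≤q
    less : ∀ x y → x < y → q * q * x < q * q * y
    less x y r = <-≤-trans (≤-<-trans (≤-reflexive (sym (+-identityʳ (q * q * x)))) (+-monoʳ-< (q * q * x)
        (<-≤-trans (+<+ (ℕ.s≤s ℕ.z≤n)) (1≤* {q * q} {y - x} 1≤q² (≤-trans (0≤i-j⇒j≤i {i = y - x} {j = + 1} (≤-trans (i≤j⇒0≤j-i (i<j⇒suc[i]≤j r)) (≤-reflexive (e₃ x y)))) ≤-refl)))))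
      (≤-reflexive (e₄ (q * q) x y))
      where
      e₃ : ∀ x y → y - (+ 1 + x) ≡ y - x - + 1
      e₃ = solve-∀
      e₄ : ∀ s x y → s * x + s * (y - x) ≡ s * y
      e₄ = solve-∀
    e₁ : ∀ a q → a * (q * (q * q) + + 7 * (q * q)) ≡ a * (q * (q * q)) + q * q * (+ 7 * a)
    e₁ = solve-∀
    e₂ : ∀ a d h E q → (a + d) * (q * (q * q)) - (a * (q * (q * q)) + q * q * (h * d) + E * (d * (q * q))) ≡ d * (q * q * (q - (h + E)))
    e₂ = solve-∀

/-bounds : ∀ n p .{{_ : ℕ.NonZero p}} → (+ p * + (n ℕ./ p) ≤ + n) × (+ n ≤ + p * (+ (n ℕ./ p) + + 1))
/-bounds n p =
  ≤-trans (≤-reflexive (trans (sym (pos-* p (n ℕ./ p))) (cong +_ (ℕₚ.*-comm p (n ℕ./ p))))) (+≤+ (DivMod.m/n*n≤m n p)) ,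
  ≤-trans (+≤+ upper) (≤-reflexive (trans (pos-* p (n ℕ./ p ℕ.+ 1)) (cong (+ p *_) (pos-+ (n ℕ./ p) 1))))
  where
  upper : n ℕ.≤ p ℕ.* (n ℕ./ p ℕ.+ 1)
  upper = ℕₚ.≤-trans (ℕₚ.≤-reflexive (DivMod.m≡m%n+[m/n]*n n p))
    (ℕₚ.≤-trans (ℕₚ.+-monoˡ-≤ _ (ℕₚ.<⇒≤ (DivMod.m%n<n n p))) (ℕₚ.≤-reflexive (eq p (n ℕ./ p))))
    where
    eq : ∀ p q → p ℕ.+ q ℕ.* p ≡ p ℕ.* (q ℕ.+ 1)
    eq = ℕSolver.solve-∀

/-lower : ∀ n p k .{{_ : ℕ.NonZero p}} → p ℕ.* k ℕ.≤ n → k ℕ.≤ n ℕ./ p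
/-lower n p k h = ℕₚ.≤-trans (ℕₚ.≤-reflexive (sym (DivMod.m*n/n≡m k p)))
  (DivMod./-monoˡ-≤ p (ℕₚ.≤-trans (ℕₚ.≤-reflexive (ℕₚ.*-comm k p)) h))

-- Shows that √(M n) is eventually below n/D for every fixed D; this makes the errors in the part
-- sizes o(n).
below-square : ∀ M N p d → + 0 ≤ M → + 1 ≤ d → N ≤ p * (d + + 1) → + 0 ≤ p → + 2 * (p * M) ≤ d → M * N ≤ d * d
below-square M N p d 0≤M 1≤d N≤ 0≤p h = ≤-trans (*-monoˡ {M} 0≤M (≤-trans N≤ (*-monoˡ {p} 0≤p
    (≤-from-diff (e₁ d) (i≤j⇒0≤j-i 1≤d)))))
  (≤-trans (≤-reflexive (e₂ M p d)) (≤-trans (*-monoˡ {d} (≤-trans 0≤k 1≤d) h) ≤-refl))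
  where
  e₁ : ∀ d → + 2 * d - (d + + 1) ≡ d - + 1
  e₁ = solve-∀
  e₂ : ∀ M p d → M * (p * (+ 2 * d)) ≡ d * (+ 2 * (p * M))
  e₂ = solve-∀

-- Part sizes of the blow-up from four degrees

-- `far` is again a pentagon, in which the two neighbours of `i` are `step i` and `back i`; three
-- places forward is two places back.
step : Fin 5 → Fin 5
step i = succ5 (succ5 i)

back : Fin 5 → Fin 5
back i = succ5 (succ5 (succ5 i))

-- No two vertices of an induced P₄ have the same neighbours within it, so they lie in different
-- parts and the path runs round the pentagon in one of the two directions.
path-colours : ∀ i j k l → isP₄ (far i j) (far i k) (far i l) (far j k) (far j l) (far k l) ≡ true →
  (j ≡ step i × k ≡ step (step i) × l ≡ step (step (step i))) ⊎ (j ≡ back i × k ≡ back (back i) × l ≡ back (back (back i)))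
path-colours i j k l h = read (∨-true (⇒ᵇ-elim (checkF 4 (λ i j k l → isP₄ (far i j) (far i k) (far i l) (far j k) (far j l) (far k l)
    ⇒ᵇ (follows step i j k l ∨ follows back i j k l)) refl i j k l) h))
  where
  follows : (Fin 5 → Fin 5) → Fin 5 → Fin 5 → Fin 5 → Fin 5 → Bool
  follows σ i j k l = (j ≡ᵇ σ i) ∧ ((k ≡ᵇ σ (σ i)) ∧ (l ≡ᵇ σ (σ (σ i))))
  three : ∀ σ → follows σ i j k l ≡ true → j ≡ σ i × k ≡ σ (σ i) × l ≡ σ (σ (σ i))
  three σ e = ≡ᵇ⇒≡ j (σ i) (proj₁ (∧-true e)) , ≡ᵇ⇒≡ k (σ (σ i)) (proj₁ (∧-true (proj₂ (∧-true {j ≡ᵇ σ i} e)))) ,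
    ≡ᵇ⇒≡ l (σ (σ (σ i))) (proj₂ (∧-true {k ≡ᵇ σ (σ i)} (proj₂ (∧-true {j ≡ᵇ σ i} e))))
  read : follows step i j k l ≡ true ⊎ follows back i j k l ≡ true → _
  read (inj₁ e) = inj₁ (three step e)
  read (inj₂ e) = inj₂ (three back e)

farDegree : (Fin 5 → ℤ) → Fin 5 → ℤ
farDegree w i = ∑ λ j → w j * ι (far i j)

Near : ℤ → ℤ → ℤ → Set
Near N δ x = (- (+ 3 * δ) ≤ + 5 * x - N) × (+ 5 * x - N ≤ + 3 * δ)

Deviates : ℤ → ℤ → ℤ → Set
Deviates N δ d = (- δ ≤ + 2 * N - + 5 * d) × (+ 2 * N - + 5 * d ≤ δ)

-- The part sizes along the pentagon v₁ v₂ v₃ v₄ v₅ are determined by n and the degrees in four consecutive parts.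
five-sizes : ∀ δ v₁ v₂ v₃ v₄ v₅ → + 0 ≤ δ → let N = v₁ + v₂ + v₃ + v₄ + v₅ in
  Deviates N δ (v₂ + v₅) → Deviates N δ (v₁ + v₃) → Deviates N δ (v₂ + v₄) → Deviates N δ (v₃ + v₅) →
  Near N δ v₁ × Near N δ v₂ × Near N δ v₃ × Near N δ v₄ × Near N δ v₅
five-sizes δ v₁ v₂ v₃ v₄ v₅ 0≤δ (a , a′) (b , b′) (c , c′) (d , d′) =
  two (e₁ v₁ v₂ v₃ v₄ v₅) (c , c′) (d , d′) , three (e₂ v₁ v₂ v₃ v₄ v₅) (a , a′) (b , b′) (c , c′) ,
  three (e₃ v₁ v₂ v₃ v₄ v₅) (b , b′) (c , c′) (d , d′) , two (e₄ v₁ v₂ v₃ v₄ v₅) (a , a′) (b , b′) , two (e₅ v₁ v₂ v₃ v₄ v₅) (b , b′) (c , c′)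
  where
  two : ∀ {x y z} → z ≡ x + y → (- δ ≤ x × x ≤ δ) → (- δ ≤ y × y ≤ δ) → (- (+ 3 * δ) ≤ z) × (z ≤ + 3 * δ)
  two {x} {y} refl (p , p′) (q , q′) = ≤-from-diff (l x y δ) (0≤+ (i≤j⇒0≤j-i p) (0≤+ (i≤j⇒0≤j-i q) 0≤δ)) ,
    ≤-from-diff (r x y δ) (0≤+ (i≤j⇒0≤j-i p′) (0≤+ (i≤j⇒0≤j-i q′) 0≤δ))
    where
    l : ∀ x y δ → x + y - - (+ 3 * δ) ≡ x - - δ + (y - - δ + δ)
    l = solve-∀
    r : ∀ x y δ → + 3 * δ - (x + y) ≡ δ - x + (δ - y + δ)
    r = solve-∀
  three : ∀ {x y z w} → w ≡ - (x + y + z) → (- δ ≤ x × x ≤ δ) → (- δ ≤ y × y ≤ δ) → (- δ ≤ z × z ≤ δ) → (- (+ 3 * δ) ≤ w) × (w ≤ + 3 * δ)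
  three {x} {y} {z} refl (p , p′) (q , q′) (o , o′) = ≤-from-diff (l x y z δ) (0≤+ (i≤j⇒0≤j-i p′) (0≤+ (i≤j⇒0≤j-i q′) (i≤j⇒0≤j-i o′))) ,
    ≤-from-diff (r x y z δ) (0≤+ (i≤j⇒0≤j-i p) (0≤+ (i≤j⇒0≤j-i q) (i≤j⇒0≤j-i o)))
    where
    l : ∀ x y z δ → - (x + y + z) - - (+ 3 * δ) ≡ δ - x + (δ - y + (δ - z))
    l = solve-∀
    r : ∀ x y z δ → + 3 * δ - - (x + y + z) ≡ x - - δ + (y - - δ + (z - - δ))
    r = solve-∀
  e₁ : ∀ v₁ v₂ v₃ v₄ v₅ → let N = v₁ + v₂ + v₃ + v₄ + v₅ in + 5 * v₁ - N ≡ (+ 2 * N - + 5 * (v₂ + v₄)) + (+ 2 * N - + 5 * (v₃ + v₅))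
  e₁ = solve-∀
  e₂ : ∀ v₁ v₂ v₃ v₄ v₅ → let N = v₁ + v₂ + v₃ + v₄ + v₅ in + 5 * v₂ - N ≡ - ((+ 2 * N - + 5 * (v₂ + v₅)) + (+ 2 * N - + 5 * (v₁ + v₃)) + (+ 2 * N - + 5 * (v₂ + v₄)))
  e₂ = solve-∀
  e₃ : ∀ v₁ v₂ v₃ v₄ v₅ → let N = v₁ + v₂ + v₃ + v₄ + v₅ in + 5 * v₃ - N ≡ - ((+ 2 * N - + 5 * (v₁ + v₃)) + (+ 2 * N - + 5 * (v₂ + v₄)) + (+ 2 * N - + 5 * (v₃ + v₅)))
  e₃ = solve-∀
  e₄ : ∀ v₁ v₂ v₃ v₄ v₅ → let N = v₁ + v₂ + v₃ + v₄ + v₅ in + 5 * v₄ - N ≡ (+ 2 * N - + 5 * (v₂ + v₅)) + (+ 2 * N - + 5 * (v₁ + v₃))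
  e₄ = solve-∀
  e₅ : ∀ v₁ v₂ v₃ v₄ v₅ → let N = v₁ + v₂ + v₃ + v₄ + v₅ in + 5 * v₅ - N ≡ (+ 2 * N - + 5 * (v₁ + v₃)) + (+ 2 * N - + 5 * (v₂ + v₄))
  e₅ = solve-∀

farDegree-value : ∀ w i → farDegree w i ≡ w (step i) + w (back i)
farDegree-value w 0F = eq (w 0F) (w 1F) (w 2F) (w 3F) (w 4F)
  where
  eq : ∀ a b c d e → a * + 0 + (b * + 0 + (c * + 1 + (d * + 1 + (e * + 0 + + 0)))) ≡ c + d
  eq = solve-∀
farDegree-value w 1F = eq (w 0F) (w 1F) (w 2F) (w 3F) (w 4F)
  where
  eq : ∀ a b c d e → a * + 0 + (b * + 0 + (c * + 0 + (d * + 1 + (e * + 1 + + 0)))) ≡ d + e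
  eq = solve-∀
farDegree-value w 2F = eq (w 0F) (w 1F) (w 2F) (w 3F) (w 4F)
  where
  eq : ∀ a b c d e → a * + 1 + (b * + 0 + (c * + 0 + (d * + 0 + (e * + 1 + + 0)))) ≡ e + a
  eq = solve-∀
farDegree-value w 3F = eq (w 0F) (w 1F) (w 2F) (w 3F) (w 4F)
  where
  eq : ∀ a b c d e → a * + 1 + (b * + 1 + (c * + 0 + (d * + 0 + (e * + 0 + + 0)))) ≡ a + b
  eq = solve-∀
farDegree-value w 4F = eq (w 0F) (w 1F) (w 2F) (w 3F) (w 4F)
  where
  eq : ∀ a b c d e → a * + 0 + (b * + 1 + (c * + 1 + (d * + 0 + (e * + 0 + + 0)))) ≡ b + c
  eq = solve-∀

total-along : ∀ (w : Fin 5 → ℤ) i → ∑ w ≡ w i + w (step i) + w (step (step i)) + w (step (step (step i))) + w (step (step (step (step i))))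
total-along w 0F = eq (w 0F) (w 1F) (w 2F) (w 3F) (w 4F)
  where
  eq : ∀ a b c d e → a + (b + (c + (d + (e + + 0)))) ≡ a + c + e + b + d
  eq = solve-∀
total-along w 1F = eq (w 0F) (w 1F) (w 2F) (w 3F) (w 4F)
  where
  eq : ∀ a b c d e → a + (b + (c + (d + (e + + 0)))) ≡ b + d + a + c + e
  eq = solve-∀
total-along w 2F = eq (w 0F) (w 1F) (w 2F) (w 3F) (w 4F)
  where
  eq : ∀ a b c d e → a + (b + (c + (d + (e + + 0)))) ≡ c + e + b + d + a
  eq = solve-∀
total-along w 3F = eq (w 0F) (w 1F) (w 2F) (w 3F) (w 4F)
  where
  eq : ∀ a b c d e → a + (b + (c + (d + (e + + 0)))) ≡ d + a + c + e + b
  eq = solve-∀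
total-along w 4F = eq (w 0F) (w 1F) (w 2F) (w 3F) (w 4F)
  where
  eq : ∀ a b c d e → a + (b + (c + (d + (e + + 0)))) ≡ e + b + d + a + c
  eq = solve-∀

back-as-steps : ∀ i → back i ≡ step (step (step (step i)))
back-as-steps 0F = refl
back-as-steps 1F = refl
back-as-steps 2F = refl
back-as-steps 3F = refl
back-as-steps 4F = refl

step⁵ : ∀ i → step (step (step (step (step i)))) ≡ i
step⁵ 0F = refl
step⁵ 1F = refl
step⁵ 2F = refl
step⁵ 3F = refl
step⁵ 4F = refl

steps-cover : ∀ (P : Fin 5 → Set) i → P i → P (step i) → P (step (step i)) → P (step (step (step i))) → P (step (step (step (step i)))) → ∀ p → P p
steps-cover P 0F x₁ x₂ x₃ x₄ x₅ = λ { 0F → x₁ ; 1F → x₄ ; 2F → x₂ ; 3F → x₅ ; 4F → x₃ }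
steps-cover P 1F x₁ x₂ x₃ x₄ x₅ = λ { 0F → x₃ ; 1F → x₁ ; 2F → x₄ ; 3F → x₂ ; 4F → x₅ }
steps-cover P 2F x₁ x₂ x₃ x₄ x₅ = λ { 0F → x₅ ; 1F → x₃ ; 2F → x₁ ; 3F → x₄ ; 4F → x₂ }
steps-cover P 3F x₁ x₂ x₃ x₄ x₅ = λ { 0F → x₂ ; 1F → x₅ ; 2F → x₃ ; 3F → x₁ ; 4F → x₄ }
steps-cover P 4F x₁ x₂ x₃ x₄ x₅ = λ { 0F → x₄ ; 1F → x₂ ; 2F → x₅ ; 3F → x₃ ; 4F → x₁ }

sizes-near : ∀ (w : Fin 5 → ℤ) δ i → + 0 ≤ δ →
  Deviates (∑ w) δ (farDegree w i) → Deviates (∑ w) δ (farDegree w (step i)) →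
  Deviates (∑ w) δ (farDegree w (step (step i))) → Deviates (∑ w) δ (farDegree w (step (step (step i)))) →
  ∀ p → Near (∑ w) δ (w p)
sizes-near w δ i 0≤δ h₁ h₂ h₃ h₄ = steps-cover (λ p → Near (∑ w) δ (w p)) i (back-to i (proj₁ all)) (back-to (step i) (proj₁ (proj₂ all)))
    (back-to (step (step i)) (proj₁ (proj₂ (proj₂ all)))) (back-to (step (step (step i))) (proj₁ (proj₂ (proj₂ (proj₂ all)))))
    (back-to (step (step (step (step i)))) (proj₂ (proj₂ (proj₂ (proj₂ all)))))
  where
  v₁ = w i
  v₂ = w (step i)
  v₃ = w (step (step i))
  v₄ = w (step (step (step i)))
  v₅ = w (step (step (step (step i))))
  N = v₁ + v₂ + v₃ + v₄ + v₅
  back-to : ∀ p → Near N δ (w p) → Near (∑ w) δ (w p)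
  back-to p = subst (λ N → Near N δ (w p)) (sym (total-along w i))
  convert : ∀ j {d} → w (step j) + w (back j) ≡ d → Deviates (∑ w) δ (farDegree w j) → Deviates N δ d
  convert j refl h = subst (λ N → Deviates N δ (w (step j) + w (back j))) (total-along w i) (subst (Deviates (∑ w) δ) (farDegree-value w j) h)
  neighbours : ∀ j → w (step (step j)) + w (back (step j)) ≡ w j + w (step (step j))
  neighbours j = trans (cong (λ p → w (step (step j)) + w p) (trans (back-as-steps (step j)) (step⁵ j))) (+-comm (w (step (step j))) (w j))
  all = five-sizes δ v₁ v₂ v₃ v₄ v₅ 0≤δ
    (convert i (cong (λ p → w (step i) + w p) (back-as-steps i)) h₁)
    (convert (step i) (neighbours i) h₂) (convert (step (step i)) (neighbours (step i)) h₃)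
    (convert (step (step (step i))) (neighbours (step (step i))) h₄)

module BlowupSizes {n} (A : Adj n) (sy : Symm A) (ir : Irrefl A) (tf : TriFree A) (1≤n : 1 ℕ.≤ n)
  (M : ℤ) (ρ : Roots.Root A sy ir tf M) (τ : Fin n → Fin 5) (is-blowup : ∀ u w → A u w ≡ far (τ u) (τ w)) where
  open Density A sy ir tf
  open Roots A sy ir tf
  open Root ρ
  open RootCore A sy ir tf 1≤n M ρ using (vertex; dev-bound)

  N : ℤ
  N = + n

  w : Fin 5 → ℤ
  w = size τ

  w-total : ∑ w ≡ N
  w-total = trans (∑-cong λ i → sym (*-identityʳ (w i))) (trans (sym (∑-colour τ (λ _ → + 1))) (trans (∑-const n (+ 1)) (*-identityʳ N)))

  deg-colour : ∀ x → deg x ≡ farDegree w (τ x)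
  deg-colour x = trans (∑-cong λ y → cong ι (is-blowup x y)) (∑-colour τ (λ j → ι (far (τ x) j)))

  colour-path : isP₄ (far (τ a) (τ b)) (far (τ a) (τ c)) (far (τ a) (τ d)) (far (τ b) (τ c)) (far (τ b) (τ d)) (far (τ c) (τ d)) ≡ true
  colour-path = trans (sym (six (is-blowup a b) (is-blowup a c) (is-blowup a d) (is-blowup b c) (is-blowup b d) (is-blowup c d))) path
    where
    six : ∀ {x₁ x₂ x₃ x₄ x₅ x₆ y₁ y₂ y₃ y₄ y₅ y₆} → x₁ ≡ y₁ → x₂ ≡ y₂ → x₃ ≡ y₃ → x₄ ≡ y₄ → x₅ ≡ y₅ → x₆ ≡ y₆ →
      isP₄ x₁ x₂ x₃ x₄ x₅ x₆ ≡ isP₄ y₁ y₂ y₃ y₄ y₅ y₆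
    six refl refl refl refl refl refl = refl

  -- The parts of `τ` are not defined by the colouring from the path, so their sizes are found anew
  -- from the degrees of the four path vertices. If the path runs backwards round the pentagon, it
  -- is read from `d` to `a`.
  near : ∀ δ → + 0 ≤ δ → M * N ≤ δ * δ → ∀ p → Near N δ (w p)
  near δ 0≤δ h p = subst (λ N → Near N δ (w p)) w-total (oriented (path-colours (τ a) (τ b) (τ c) (τ d) colour-path))
    where
    deviates : ∀ k {i} → τ (vertex k) ≡ i → Deviates (∑ w) δ (farDegree w i)
    deviates k refl = subst (λ N → Deviates N δ (farDegree w (τ (vertex k)))) (sym w-total)
      (subst (Deviates N δ) (deg-colour (vertex k)) (dev-bound δ 0≤δ h k))
    step-back : ∀ i → step (back i) ≡ i
    step-back i = trans (cong step (back-as-steps i)) (step⁵ i)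
    oriented : (τ b ≡ step (τ a) × τ c ≡ step (step (τ a)) × τ d ≡ step (step (step (τ a))))
      ⊎ (τ b ≡ back (τ a) × τ c ≡ back (back (τ a)) × τ d ≡ back (back (back (τ a)))) → Near (∑ w) δ (w p)
    oriented (inj₁ (b′ , c′ , d′)) = sizes-near w δ (τ a) 0≤δ (deviates 0F refl) (deviates 1F b′) (deviates 2F c′) (deviates 3F d′) p
    oriented (inj₂ (b′ , c′ , d′)) = sizes-near w δ (τ d) 0≤δ (deviates 3F refl)
      (deviates 2F (trans c′ (sym (trans (cong step d′) (step-back (back (back (τ a))))))))
      (deviates 1F (trans b′ (sym (trans (cong (step ∘ step) d′) (trans (cong step (step-back (back (back (τ a))))) (step-back (back (τ a))))))))
      (deviates 0F (sym (trans (cong (step ∘ step ∘ step) d′) (trans (cong (step ∘ step) (step-back (back (back (τ a))))) (trans (cong step (step-back (back (τ a)))) (step-back (τ a)))))))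
      p

-- The structure of large minimisers

module Large {n} (G : Graph n) (ext : IsExtremal 4 3 G) (1≤n : 1 ℕ.≤ n) (g m : ℕ) where
  open Extremal G ext
  open Roots A (cmpl-symm G) (cmpl-irrefl G) tf

  N M : ℤ
  N = + n
  M = + m

  module _ (g-bound : Δ ≤ + g * N ^ 3) (M≡ : M ≡ + 13 * (+ 4 * + 1000 * + g)) (large₁ : + 2 * + 1000 * + g ≤ N) where

    the-root : Root M
    the-root = root M (subst (λ M → + 13 * (N * (N * Δ)) < (M * N + + 1) * N₄) (sym M≡)
      (root-arithmetic (+ 1000) (+ g) N Δ N₄ (+≤+ 1≤n) 0≤k 0≤k g-bound large₁ many-P₄))

    open Root the-root
    open RootCore A (cmpl-symm G) (cmpl-irrefl G) tf 1≤n M the-root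

    module _ (J-bound : ∀ v → + 25 * J v ≤ + 3 * (N * (N * N)) + + 4110 * (N * N))
      (q : ℤ) (0≤q : + 0 ≤ q) (q-low : + 250 * q ≤ N) (q-high : N ≤ + 250 * (q + + 1))
      (large₂ : + 1000 * M + + 1 ≤ q) (large₃ : + 300 + (+ 4110 + + 150 * M) ≤ q) where

      1≤q : + 1 ≤ q
      1≤q = ≤-trans (≤-trans (≤-reflexive (sym (+-identityˡ (+ 1)))) (+-monoˡ-≤ (+ 1) (0≤* {+ 1000} {M} 0≤k 0≤k))) large₂

      M≤q : + 1000 * M ≤ q
      M≤q = ≤-trans (≤-trans (≤-reflexive (sym (+-identityʳ (+ 1000 * M)))) (+-monoʳ-≤ (+ 1000 * M) (0≤k {1}))) large₂

      V<q² : + 2 * (M * N) < q * q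
      V<q² = ≤-<-trans (*-monoˡ {+ 2} 0≤k (*-monoˡ {M} 0≤k q-high)) (arith (+ 250) (+ 1000) M q refl 1≤q 0≤k 0≤k large₂)
        where
        arith : ∀ p k M q → k ≡ + 4 * p → + 1 ≤ q → + 0 ≤ p → + 0 ≤ M → k * M + + 1 ≤ q → + 2 * (M * (p * (q + + 1))) < q * q
        arith p _ M q refl 1≤q 0≤p 0≤M h = <-≤-trans (≤-<-trans (≤-from-diff (e₁ p M q) (0≤* {+ 2 * (M * p)} (0≤* {+ 2} 0≤k (0≤* {M} 0≤M 0≤p)) (i≤j⇒0≤j-i 1≤q)))
          (≤-<-trans (≤-reflexive (sym (+-identityʳ (q * (+ 4 * p * M))))) (+-monoʳ-< (q * (+ 4 * p * M)) (<-≤-trans (+<+ (ℕ.s≤s ℕ.z≤n)) 1≤q))))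
          (≤-trans (≤-reflexive (e₂ p M q)) (*-monoˡ {q} (≤-trans 0≤k 1≤q) h))
          where
          e₁ : ∀ p M q → q * (+ 4 * p * M) - + 2 * (M * (p * (q + + 1))) ≡ + 2 * (M * p) * (q - + 1)
          e₁ = solve-∀
          e₂ : ∀ p M q → q * (+ 4 * p * M) + q ≡ q * (+ 4 * p * M + + 1)
          e₂ = solve-∀

      Mn≤q² : M * N ≤ q * q
      Mn≤q² = ≤-trans (≤-from-diff (e (M * N)) (0≤* {M} 0≤k 0≤k)) (<⇒≤ V<q²)
        where
        e : ∀ x → + 2 * x - x ≡ x
        e = solve-∀

      -- A fifth of `n` is at least 50 q. The degree deviations and the M uncoloured vertices cost 3
      -- q + 15 M in five times a class, at most 5 q because 1000 M is at most q.
      the-core : Core A (+ 2 * (M * N)) (+ 49 * q)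
      the-core = core q 0≤q Mn≤q² (+ 49 * q) (≤-trans (≤-reflexive (sym (*-assoc (+ 5) (+ 49) q)))
        (sizes-arith (+ 250) (+ 245) (+ 15) (+ 1000) (+ 985) N q M refl refl q-low M≤q 0≤q 0≤k 0≤k))
        where
        sizes-arith : ∀ p r f k l N q M → p ≡ r + + 5 → k ≡ f + l → p * q ≤ N → k * M ≤ q → + 0 ≤ q → + 0 ≤ l → + 0 ≤ M → r * q ≤ N - + 3 * q - f * M
        sizes-arith _ r f _ l N q M refl refl h₁ h₂ 0≤q 0≤l 0≤M = ≤-from-diff (e r f l N q M) (0≤+ (i≤j⇒0≤j-i h₁) (0≤+ (i≤j⇒0≤j-i h₂) (0≤+ 0≤q (0≤* {l} 0≤l 0≤M))))
          where
          e : ∀ r f l N q M → N - + 3 * q - f * M - r * q ≡ N - (r + + 5) * q + (q - (f + l) * M + (q + l * M))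
          e = solve-∀

      -- The coefficient 46875000 is 3 · 250³, or equivalently 25 · 120 · 25³, while 25 · 139 · 24³
      -- exceeds it by 1163400. This excess pays both for rounding `n` up to 250 (q + 1) and for the
      -- quadratic error terms.
      J< : ∀ v → J v + + 3 * (N * (+ 2 * (M * N))) < + 139 * (+ 24 * q * (+ 24 * q * (+ 24 * q * + 1)))
      J< v = typing-arithmetic (+ 46875000) (+ 1163400) (+ 300) (+ 250) (+ 24) (+ 139) (+ 4110 + + 150 * M) q N (J v + + 3 * (N * (+ 2 * (M * N))))
        1≤q 0≤k q-high (0≤+ {+ 4110} 0≤k (0≤* {+ 150} {M} 0≤k 0≤k)) 0≤k 0≤k refl refl
        (+<+ (ℕₚ.<ᵇ⇒< 328125000 349020000 _)) (+≤+ (ℕₚ.≤ᵇ⇒≤ 250000 1163400 _)) large₃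
        (≤-trans (≤-reflexive (e₁ (+ 25) (+ 3) (+ 2) (J v) N M)) (≤-trans (+-monoˡ-≤ (+ 150 * (M * (N * N))) (J-bound v)) (≤-reflexive (e₂ (+ 3 * (N * (N * N))) (+ 4110) (+ 150) M (N * N)))))
        where
        e₁ : ∀ a b c j N M → a * (j + b * (N * (c * (M * N)))) ≡ a * j + (a * b * c) * (M * (N * N))
        e₁ = solve-∀
        e₂ : ∀ x a b M y → x + a * y + b * (M * y) ≡ x + (a + b * M) * y
        e₂ = solve-∀

      2κ+s≤L : + 2 * (+ 24 * q) + q ≤ + 49 * q
      2κ+s≤L = ≤-reflexive (e (+ 2) (+ 24) q)
        where
        e : ∀ a b q → a * (b * q) + q ≡ (a * b + + 1) * q
        e = solve-∀

      2s+3<L : + 2 * q + + 3 < + 49 * q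
      2s+3<L = arith (+ 43) q 0≤k 1≤q
        where
        arith : ∀ l q → + 0 ≤ l → + 1 ≤ q → + 2 * q + + 3 < (+ 6 + l) * q
        arith l q 0≤l 1≤q = <-≤-trans (≤-<-trans (≤-reflexive (sym (+-identityʳ (+ 2 * q + + 3)))) (+-monoʳ-< (+ 2 * q + + 3) (+<+ (ℕ.s≤s ℕ.z≤n))))
          (≤-from-diff {+ 2 * q + + 3 + + 1} (e l q) (0≤+ (0≤* {+ 4} 0≤k (i≤j⇒0≤j-i 1≤q)) (0≤* {l} 0≤l (≤-trans 0≤k 1≤q))))
          where
          e : ∀ l q → (+ 6 + l) * q - (+ 2 * q + + 3 + + 1) ≡ + 4 * (q - + 1) + l * q
          e = solve-∀

      open Blowup G ext the-core q (+ 24 * q) 0≤q (0≤* {+ 24} {q} 0≤k 0≤q) V<q² 2κ+s≤L 2s+3<L J< using (τ; is-blowup)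

      conclusion : Σ (Fin n → Fin 5) λ τ → IsBlowup G τ × (∀ δ → + 0 ≤ δ → M * N ≤ δ * δ → ∀ p → Near N δ (size τ p))
      conclusion = τ , is-blowup , BlowupSizes.near A (cmpl-symm G) (cmpl-irrefl G) tf 1≤n M the-root τ is-blowup

cancel-≤ : ∀ n {x y} → 1 ℕ.≤ n → + n * x ≤ + n * y → x ≤ y
cancel-≤ (suc n) {x} {y} _ h = *-cancelˡ-≤-pos x y (+ suc n) h

threshold : ℕ → ℕ → ℕ → ℕ
threshold g m D = 250 ℕ.* ((1000 ℕ.* m ℕ.+ 1) ℕ.+ (300 ℕ.+ (4110 ℕ.+ 150 ℕ.* m))) ℕ.+ (D ℕ.* (2 ℕ.* (D ℕ.* m) ℕ.+ 1) ℕ.+ (2 ℕ.* 1000 ℕ.* g ℕ.+ 1))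

-- Only the relation between `g` and `m` is used here, so the large numerals remain variables and
-- appear in `structure` alone.
structure-generic : ∀ g m D .{{_ : ℕ.NonZero D}} → + m ≡ + 13 * (+ 4 * + 1000 * + g) →
  (∀ N τ I → + 1 ≤ N → I ≤ + 24 * τ + + 6 * N ^ 3 → + 600 * τ ≤ + 3 * (+ 5 + N) ^ 4 →
    + 25000 * I - + 3000 * (N * (N * (N * N))) ≤ + g * N ^ 3) →
  ∀ n → threshold g m D ℕ.≤ n → (G : Graph n) → IsExtremal 4 3 G →
  Σ (Fin n → Fin 5) λ τ → IsBlowup G τ × (∀ p → Near (+ n) (+ (n ℕ./ D)) (size τ p))
structure-generic g m D M≡ Δ-arith n n≥ G ext = finish
    (Large.conclusion G ext 1≤n g m Δ≤ M≡ large₁ J-bound (+ (n ℕ./ 250)) 0≤k (proj₁ (/-bounds n 250)) (proj₂ (/-bounds n 250)) large₂ large₃)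
  where
  X₁ = 1000 ℕ.* m ℕ.+ 1
  X₂ = 300 ℕ.+ (4110 ℕ.+ 150 ℕ.* m)
  Y = D ℕ.* (2 ℕ.* (D ℕ.* m) ℕ.+ 1)
  Z = 2 ℕ.* 1000 ℕ.* g ℕ.+ 1
  rest≥ : Y ℕ.+ Z ℕ.≤ n
  rest≥ = ℕₚ.≤-trans (ℕₚ.m≤n+m (Y ℕ.+ Z) (250 ℕ.* (X₁ ℕ.+ X₂))) n≥
  Z≤n : Z ℕ.≤ n
  Z≤n = ℕₚ.≤-trans (ℕₚ.m≤n+m Z Y) rest≥
  1≤n : 1 ℕ.≤ n
  1≤n = ℕₚ.≤-trans (ℕₚ.m≤n+m 1 (2 ℕ.* 1000 ℕ.* g)) Z≤n
  d≥ : 2 ℕ.* (D ℕ.* m) ℕ.+ 1 ℕ.≤ n ℕ./ D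
  d≥ = /-lower n D (2 ℕ.* (D ℕ.* m) ℕ.+ 1) (ℕₚ.≤-trans (ℕₚ.m≤m+n Y Z) rest≥)
  q≥ : X₁ ℕ.+ X₂ ℕ.≤ n ℕ./ 250
  q≥ = /-lower n 250 (X₁ ℕ.+ X₂) (ℕₚ.≤-trans (ℕₚ.m≤m+n (250 ℕ.* (X₁ ℕ.+ X₂)) (Y ℕ.+ Z)) n≥)
  open Extremal G ext
  large₁ : + 2 * + 1000 * + g ≤ + n
  large₁ = ≤-trans (≤-reflexive (sym (pos-* 2000 g))) (+≤+ (ℕₚ.≤-trans (ℕₚ.m≤m+n (2 ℕ.* 1000 ℕ.* g) 1) Z≤n))
  large₂ : + 1000 * + m + + 1 ≤ + (n ℕ./ 250)
  large₂ = ≤-trans (≤-reflexive (sym (trans (pos-+ (1000 ℕ.* m) 1) (cong (_+ + 1) (pos-* 1000 m))))) (+≤+ (ℕₚ.≤-trans (ℕₚ.m≤m+n X₁ X₂) q≥))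
  large₃ : + 300 + (+ 4110 + + 150 * + m) ≤ + (n ℕ./ 250)
  large₃ = ≤-trans (≤-reflexive (sym (trans (pos-+ 300 (4110 ℕ.+ 150 ℕ.* m)) (cong (λ x → + 300 + x) (trans (pos-+ 4110 (150 ℕ.* m)) (cong (λ x → + 4110 + x) (pos-* 150 m)))))))
    (+≤+ (ℕₚ.≤-trans (ℕₚ.m≤n+m X₂ X₁) q≥))
  Δ≤ : Δ ≤ + g * (+ n) ^ 3
  Δ≤ = Δ-arith (+ n) (+ t 4 G) I₄ (+≤+ 1≤n) I₄≤ (t-upper G ext)
  J-bound : ∀ v → + 25 * J v ≤ + 3 * (+ n * (+ n * + n)) + + 4110 * (+ n * + n)
  J-bound v = cancel-≤ n 1≤n (J-arithmetic (+ n) (+ t 4 G) (J v) (+≤+ 1≤n) (J≤ v) (t-upper G ext))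
  finish : (Σ (Fin n → Fin 5) λ τ → IsBlowup G τ × (∀ δ → + 0 ≤ δ → + m * + n ≤ δ * δ → ∀ p → Near (+ n) δ (size τ p))) →
    Σ (Fin n → Fin 5) λ τ → IsBlowup G τ × (∀ p → Near (+ n) (+ (n ℕ./ D)) (size τ p))
  finish (τ , is-blowup , near) = τ , is-blowup , near (+ (n ℕ./ D)) 0≤k
    (below-square (+ m) (+ n) (+ D) (+ (n ℕ./ D)) 0≤k (+≤+ (ℕₚ.≤-trans (ℕₚ.m≤n+m 1 (2 ℕ.* (D ℕ.* m))) d≥)) (proj₂ (/-bounds n D)) 0≤k
      (≤-trans (≤-reflexive (sym (trans (pos-* 2 (D ℕ.* m)) (cong (+ 2 *_) (pos-* D m))))) (+≤+ (ℕₚ.≤-trans (ℕₚ.m≤m+n (2 ℕ.* (D ℕ.* m)) 1) d≥))))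

-- 209820000000 is 13 · 4 · 1000 · 4035000, with 1000 from `many-P₄` and 4035000 from the bound on
-- Δ.
structure : ∀ D .{{_ : ℕ.NonZero D}} → Σ ℕ λ n₀ → ∀ n → n₀ ℕ.≤ n → (G : Graph n) → IsExtremal 4 3 G →
  Σ (Fin n → Fin 5) λ τ → IsBlowup G τ × (∀ p → Near (+ n) (+ (n ℕ./ D)) (size τ p))
structure D = threshold 4035000 209820000000 D , structure-generic 4035000 209820000000 D refl Δ-arithmetic

-- The exact number of 4-cliques in a blow-up

quad : ∀ {n} → Adj n → (Fin n → Bool) → Fin n → Fin n → Fin n → Fin n → Bool
quad B Φ a b c d = Φ a ∧ triple B (λ w → Φ w ∧ B a w) b c d

T₄-expand : ∀ {n} (B : Adj n) Φ → T B 4 Φ ≡ ∑⁴ λ a b c d → ι (quad B Φ a b c d)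
T₄-expand B Φ = ∑-cong λ a → trans (cong (ι (Φ a) *_) (T₃-expand B (λ w → Φ w ∧ B a w)))
  (trans (sym (∑³-*ˡ (ι (Φ a)) (λ b c d → ι (triple B (λ w → Φ w ∧ B a w) b c d))))
    (∑³-cong λ b c d → sym (ι-∧ (Φ a) (triple B (λ w → Φ w ∧ B a w) b c d))))

-- The adjacencies ab, ac, bc, ad, bd, cd in the order in which quad uses them.
quadBits : Bool → Bool → Bool → Bool → Bool → Bool → Bool → Bool → Bool → Bool → Bool
quadBits a b c d e₁ e₂ e₃ e₄ e₅ e₆ = a ∧ ((b ∧ e₁) ∧ (((c ∧ e₂) ∧ e₃) ∧ (((d ∧ e₄) ∧ e₅) ∧ e₆)))

six : Bool → Bool → Bool → Bool → Bool → Bool → Bool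
six e₁ e₂ e₃ e₄ e₅ e₆ = e₁ ∧ e₂ ∧ e₃ ∧ e₄ ∧ e₅ ∧ e₆

quad-∧ : ∀ e₁ e₂ e₃ e₄ e₅ e₆ k₁ k₂ k₃ k₄ k₅ k₆ → quadBits true true true true (e₁ ∧ k₁) (e₂ ∧ k₂) (e₃ ∧ k₃) (e₄ ∧ k₄) (e₅ ∧ k₅) (e₆ ∧ k₆) ≡ six e₁ e₂ e₃ e₄ e₅ e₆ ∧ six k₁ k₂ k₃ k₄ k₅ k₆
quad-∧ e₁ e₂ e₃ e₄ e₅ e₆ k₁ k₂ k₃ k₄ k₅ k₆ = ⇔ᵇ-elim (checkᵇ 12 f refl e₁ e₂ e₃ e₄ e₅ e₆ k₁ k₂ k₃ k₄ k₅ k₆)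
  where
  f : Pattern (Bool → Bool → Bool)
  f e₁ e₂ e₃ e₄ e₅ e₆ k₁ k₂ k₃ k₄ k₅ k₆ = quadBits true true true true (e₁ ∧ k₁) (e₂ ∧ k₂) (e₃ ∧ k₃) (e₄ ∧ k₄) (e₅ ∧ k₅) (e₆ ∧ k₆) ⇔ᵇ (six e₁ e₂ e₃ e₄ e₅ e₆ ∧ six k₁ k₂ k₃ k₄ k₅ k₆)

quad-φ : ∀ a b c d e₁ e₂ e₃ e₄ e₅ e₆ → quadBits a b c d e₁ e₂ e₃ e₄ e₅ e₆ ≡ six e₁ e₂ e₃ e₄ e₅ e₆ ∧ (a ∧ b ∧ c ∧ d)
quad-φ a b c d e₁ e₂ e₃ e₄ e₅ e₆ = ⇔ᵇ-elim (checkᵇ 10 f refl a b c d e₁ e₂ e₃ e₄ e₅ e₆)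
  where
  f : Pattern Bool
  f a b c d e₁ e₂ e₃ e₄ e₅ e₆ = quadBits a b c d e₁ e₂ e₃ e₄ e₅ e₆ ⇔ᵇ (six e₁ e₂ e₃ e₄ e₅ e₆ ∧ (a ∧ b ∧ c ∧ d))

sixFar : Fin 5 → Fin 5 → Fin 5 → Fin 5 → Bool
sixFar i j k l = six (∁ far i j) (∁ far i k) (∁ far j k) (∁ far i l) (∁ far j l) (∁ far k l)

inPair : Fin 5 → Fin 5 → Bool
inPair m i = (m ≡ᵇ i) ∨ (succ5 m ≡ᵇ i)

-- A clique of the pentagon (with loops) lies in two consecutive vertices, and in exactly two such pairs if it is a single vertex.
pentagon-cliques : ∀ i j k l → ι (sixFar i j k l) ≡
  ∑ (λ m → ι (inPair m i ∧ inPair m j ∧ inPair m k ∧ inPair m l)) - ∑ (λ m → ι ((m ≡ᵇ i) ∧ (m ≡ᵇ j) ∧ (m ≡ᵇ k) ∧ (m ≡ᵇ l)))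
pentagon-cliques i j k l = ≟-true (checkF 4 (λ i j k l → does (ι (sixFar i j k l) ≟ rhs i j k l)) refl i j k l)
  where
  rhs : Fin 5 → Fin 5 → Fin 5 → Fin 5 → ℤ
  rhs i j k l = ∑ (λ m → ι (inPair m i ∧ inPair m j ∧ inPair m k ∧ inPair m l)) - ∑ (λ m → ι ((m ≡ᵇ i) ∧ (m ≡ᵇ j) ∧ (m ≡ᵇ k) ∧ (m ≡ᵇ l)))

∑⁴-minus : ∀ {n} (f g : Fin n → Fin n → Fin n → Fin n → ℤ) → (∑⁴ λ a b c d → f a b c d - g a b c d) ≡ ∑⁴ f - ∑⁴ g
∑⁴-minus f g = trans (∑-cong λ a → trans (∑-cong λ b → trans (∑-cong λ c → ∑-minus (f a b c) (g a b c))
    (∑-minus (λ c → ∑ (f a b c)) (λ c → ∑ (g a b c)))) (∑-minus (λ b → ∑ λ c → ∑ (f a b c)) (λ b → ∑ λ c → ∑ (g a b c))))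
  (∑-minus (λ a → ∑³ (f a)) (λ a → ∑³ (g a)))

different : ∀ {n} → Adj n
different i j = not (i ≡ᵇ j)

falling : ℕ → ℤ → ℤ
falling zero x = + 1
falling (suc k) x = x * falling k (x - + 1)

T-complete : ∀ {n} k (Φ : Fin n → Bool) → T different k Φ ≡ falling k (∑ λ v → ι (Φ v))
T-complete zero Φ = refl
T-complete {n} (suc k) Φ = trans (∑-cong term) (∑-*ʳ (falling k (S - + 1)) (λ v → ι (Φ v)))
  where
  S = ∑ λ v → ι (Φ v)
  removed : ∀ v → Φ v ≡ true → (∑ λ w → ι (Φ w ∧ different v w)) ≡ S - + 1
  removed v e = begin
    (∑ λ w → ι (Φ w ∧ not (v ≡ᵇ w)))                  ≡⟨ ∑-cong (λ w → point (Φ w) (v ≡ᵇ w) (w ≡ᵇ v) (≡ᵇ-sym v w)) ⟩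
    (∑ λ w → ι (Φ w) - ι (w ≡ᵇ v) * ι (Φ w))          ≡⟨ ∑-minus (λ w → ι (Φ w)) (λ w → ι (w ≡ᵇ v) * ι (Φ w)) ⟩
    S - (∑ λ w → ι (w ≡ᵇ v) * ι (Φ w))                ≡⟨ cong (λ x → S - x) (trans (∑-δ v (λ w → ι (Φ w))) (cong ι e)) ⟩
    S - + 1                                           ∎
    where
    open ≡-Reasoning
    point : ∀ x y z → y ≡ z → ι (x ∧ not y) ≡ ι x - ι z * ι x
    point true true _ refl = refl
    point true false _ refl = refl
    point false true _ refl = refl
    point false false _ refl = refl
  term : ∀ v → ι (Φ v) * T different k (λ w → Φ w ∧ different v w) ≡ ι (Φ v) * falling k (S - + 1)
  term v = by (Φ v) refl
    where
    by : ∀ b → Φ v ≡ b → ι (Φ v) * T different k (λ w → Φ w ∧ different v w) ≡ ι (Φ v) * falling k (S - + 1)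
    by true e = cong (ι (Φ v) *_) (trans (T-complete k (λ w → Φ w ∧ different v w)) (cong (falling k) (removed v e)))
    by false e = trans (cong (λ b → ι b * T different k (λ w → Φ w ∧ different v w)) e) (sym (cong (λ b → ι b * falling k (S - + 1)) e))

cliqueCount : (Fin 5 → ℤ) → ℤ
cliqueCount w = ∑ (λ m → falling 4 (w m + w (succ5 m))) - ∑ (λ m → falling 4 (w m))

-- `pentagon-cliques` is an inclusion-exclusion formula; summed over tuples of distinct vertices it
-- expresses the count through complete graphs on one part or on two consecutive parts, whose
-- ordered cliques are counted by falling factorials.
blowup-count : ∀ {n} (c : Fin n → Fin 5) → T (adj (blowup c)) 4 everything ≡ cliqueCount (size c)
blowup-count {n} c = begin
  T (adj (blowup c)) 4 everything
    ≡⟨ T₄-expand (adj (blowup c)) everything ⟩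
  (∑⁴ λ x y z t → ι (quad (adj (blowup c)) everything x y z t))
    ≡⟨ ∑⁴-cong pointwise ⟩
  (∑⁴ λ x y z t → ∑ (λ m → ι (quad different (P m) x y z t)) - ∑ (λ m → ι (quad different (Q m) x y z t)))
    ≡⟨ ∑⁴-minus (λ x y z t → ∑ λ m → ι (quad different (P m) x y z t)) (λ x y z t → ∑ λ m → ι (quad different (Q m) x y z t)) ⟩
  (∑⁴ λ x y z t → ∑ λ m → ι (quad different (P m) x y z t)) - (∑⁴ λ x y z t → ∑ λ m → ι (quad different (Q m) x y z t))
    ≡⟨ cong₂ _-_ (count-part P (λ m → size c m + size c (succ5 m)) P-size) (count-part Q (size c) (λ _ → refl)) ⟩
  cliqueCount (size c) ∎
  where
  open ≡-Reasoning
  P Q : Fin 5 → Fin n → Bool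
  P m p = inPair m (c p)
  Q m p = m ≡ᵇ c p
  P-size : ∀ m → (∑ λ p → ι (P m p)) ≡ size c m + size c (succ5 m)
  P-size m = trans (∑-cong λ p → exclusive (m ≡ᵇ c p) (succ5 m ≡ᵇ c p) (λ e e′ → not-both m (c p) e e′)) (∑-+ (λ p → ι (m ≡ᵇ c p)) (λ p → ι (succ5 m ≡ᵇ c p)))
    where
    exclusive : ∀ x y → (x ≡ true → y ≡ true → ⊥) → ι (x ∨ y) ≡ ι x + ι y
    exclusive true true h = ⊥-elim (h refl refl)
    exclusive true false h = refl
    exclusive false true h = refl
    exclusive false false h = refl
    succ-moves : ∀ i → succ5 i ≢ i
    succ-moves 0F ()
    succ-moves 1F ()
    succ-moves 2F ()
    succ-moves 3F ()
    succ-moves 4F ()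
    not-both : ∀ m i → (m ≡ᵇ i) ≡ true → (succ5 m ≡ᵇ i) ≡ true → ⊥
    not-both m i e e′ = succ-moves m (trans (≡ᵇ⇒≡ (succ5 m) i e′) (sym (≡ᵇ⇒≡ m i e)))
  count-part : ∀ (X : Fin 5 → Fin n → Bool) (x : Fin 5 → ℤ) → (∀ m → (∑ λ p → ι (X m p)) ≡ x m) →
    (∑⁴ λ p q r s → ∑ λ m → ι (quad different (X m) p q r s)) ≡ ∑ (λ m → falling 4 (x m))
  count-part X x h = trans (∑⁴-∑ (λ m p q r s → ι (quad different (X m) p q r s)))
    (∑-cong λ m → trans (sym (T₄-expand different (X m))) (trans (T-complete 4 (X m)) (cong (falling 4) (h m))))
  pointwise : ∀ x y z t → ι (quad (adj (blowup c)) everything x y z t) ≡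
    ∑ (λ m → ι (quad different (P m) x y z t)) - ∑ (λ m → ι (quad different (Q m) x y z t))
  pointwise x y z t = begin
    ι (quad (adj (blowup c)) everything x y z t)
      ≡⟨ cong ι (quad-∧ (different x y) (different x z) (different y z) (different x t) (different y t) (different z t)
           (∁ far (c x) (c y)) (∁ far (c x) (c z)) (∁ far (c y) (c z)) (∁ far (c x) (c t)) (∁ far (c y) (c t)) (∁ far (c z) (c t))) ⟩
    ι (e ∧ sixFar (c x) (c y) (c z) (c t))
      ≡⟨ ι-∧ e (sixFar (c x) (c y) (c z) (c t)) ⟩
    ι e * ι (sixFar (c x) (c y) (c z) (c t))
      ≡⟨ cong (ι e *_) (pentagon-cliques (c x) (c y) (c z) (c t)) ⟩
    ι e * (∑ (λ m → ι (P m x ∧ P m y ∧ P m z ∧ P m t)) - ∑ (λ m → ι (Q m x ∧ Q m y ∧ Q m z ∧ Q m t)))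
      ≡⟨ distr (ι e) (∑ λ m → ι (P m x ∧ P m y ∧ P m z ∧ P m t)) (∑ λ m → ι (Q m x ∧ Q m y ∧ Q m z ∧ Q m t)) ⟩
    ι e * ∑ (λ m → ι (P m x ∧ P m y ∧ P m z ∧ P m t)) - ι e * ∑ (λ m → ι (Q m x ∧ Q m y ∧ Q m z ∧ Q m t))
      ≡⟨ cong₂ _-_ (absorb P) (absorb Q) ⟩
    ∑ (λ m → ι (quad different (P m) x y z t)) - ∑ (λ m → ι (quad different (Q m) x y z t)) ∎
    where
    e = six (different x y) (different x z) (different y z) (different x t) (different y t) (different z t)
    distr : ∀ a b c → a * (b - c) ≡ a * b - a * c
    distr = solve-∀
    absorb : ∀ (X : Fin 5 → Fin n → Bool) → ι e * ∑ (λ m → ι (X m x ∧ X m y ∧ X m z ∧ X m t)) ≡ ∑ (λ m → ι (quad different (X m) x y z t))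
    absorb X = trans (sym (∑-*ˡ (ι e) (λ m → ι (X m x ∧ X m y ∧ X m z ∧ X m t)))) (∑-cong λ m →
      trans (sym (ι-∧ e (X m x ∧ X m y ∧ X m z ∧ X m t)))
        (cong ι (sym (quad-φ (X m x) (X m y) (X m z) (X m t) (different x y) (different x z) (different y z) (different x t) (different y t) (different z t)))))

-- Expansion of the count around equal parts

Σ² Σs² : (Fin 5 → ℤ) → ℤ
Σ² y = ∑ λ i → y i * y i
Σs² y = ∑ λ i → (y i + y (succ5 i)) * (y i + y (succ5 i))

-- Part sizes m + y i contribute 6 m² (4 Σs² y - Σ² y) to the number of cliques, up to lower order terms in m.
quadratic : (Fin 5 → ℤ) → ℤ
quadratic y = + 4 * Σs² y - Σ² y

pairTerm partTerm : ℤ → ℤ → ℤ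
pairTerm m s = (+ 24 * (m * m) - + 36 * m + + 11) * (s * s) + (+ 8 * m - + 6) * (s * (s * s)) + s * (s * (s * s))
partTerm m y = (+ 6 * (m * m) - + 18 * m + + 11) * (y * y) + (+ 4 * m - + 6) * (y * (y * y)) + y * (y * (y * y))

deviation : ℤ → (Fin 5 → ℤ) → ℤ
deviation m y = ∑ (λ i → pairTerm m (y i + y (succ5 i))) - ∑ (λ i → partTerm m (y i))

-- The linear terms involve only `∑ y`, because every part lies in exactly two pairs. For fixed `n`
-- the comparison of blow-ups is therefore left entirely to `deviation`.
taylor : ∀ m (y : Fin 5 → ℤ) → cliqueCount (λ i → m + y i) ≡
  (+ 5 * falling 4 (+ 2 * m) - + 5 * falling 4 m)
  + (+ 2 * (+ 32 * (m * (m * m)) - + 72 * (m * m) + + 44 * m - + 6) - (+ 4 * (m * (m * m)) - + 18 * (m * m) + + 22 * m - + 6)) * ∑ y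
  + deviation m y
taylor m y = trans (cong₂ _-_ pairs parts) (fin (falling 4 (+ 2 * m)) (falling 4 m) A B (∑ y) (∑ λ i → pairTerm m (y i + y (succ5 i))) (∑ λ i → partTerm m (y i)))
  where
  A = + 32 * (m * (m * m)) - + 72 * (m * m) + + 44 * m - + 6
  B = + 4 * (m * (m * m)) - + 18 * (m * m) + + 22 * m - + 6
  pair : ∀ m x z → (m + x + (m + z)) * ((m + x + (m + z) - + 1) * ((m + x + (m + z) - + 1 - + 1) * ((m + x + (m + z) - + 1 - + 1 - + 1) * + 1)))
    ≡ (+ 2 * m) * ((+ 2 * m - + 1) * ((+ 2 * m - + 1 - + 1) * ((+ 2 * m - + 1 - + 1 - + 1) * + 1)))
    + ((+ 32 * (m * (m * m)) - + 72 * (m * m) + + 44 * m - + 6) * (x + z)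
    + ((+ 24 * (m * m) - + 36 * m + + 11) * ((x + z) * (x + z)) + (+ 8 * m - + 6) * ((x + z) * ((x + z) * (x + z))) + (x + z) * ((x + z) * ((x + z) * (x + z)))))
  pair = solve-∀
  part : ∀ m x → (m + x) * ((m + x - + 1) * ((m + x - + 1 - + 1) * ((m + x - + 1 - + 1 - + 1) * + 1)))
    ≡ m * ((m - + 1) * ((m - + 1 - + 1) * ((m - + 1 - + 1 - + 1) * + 1)))
    + ((+ 4 * (m * (m * m)) - + 18 * (m * m) + + 22 * m - + 6) * x
    + ((+ 6 * (m * m) - + 18 * m + + 11) * (x * x) + (+ 4 * m - + 6) * (x * (x * x)) + x * (x * (x * x))))
  part = solve-∀
  twice : ∀ a b c d e → (a + b) + ((b + c) + ((c + d) + ((d + e) + ((e + a) + + 0)))) ≡ + 2 * (a + (b + (c + (d + (e + + 0)))))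
  twice = solve-∀
  pairs : ∑ (λ i → falling 4 (m + y i + (m + y (succ5 i)))) ≡ + 5 * falling 4 (+ 2 * m) + (A * (+ 2 * ∑ y) + ∑ (λ i → pairTerm m (y i + y (succ5 i))))
  pairs = trans (∑-cong {5} λ i → pair m (y i) (y (succ5 i))) (trans (∑-+ {5} (λ _ → falling 4 (+ 2 * m)) (λ i → A * (y i + y (succ5 i)) + pairTerm m (y i + y (succ5 i))))
    (cong₂ _+_ (∑-const 5 (falling 4 (+ 2 * m))) (trans (∑-+ {5} (λ i → A * (y i + y (succ5 i))) (λ i → pairTerm m (y i + y (succ5 i))))
      (cong (_+ ∑ (λ i → pairTerm m (y i + y (succ5 i)))) (trans (∑-*ˡ {5} A (λ i → y i + y (succ5 i))) (cong (A *_) (twice (y 0F) (y 1F) (y 2F) (y 3F) (y 4F))))))))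
  parts : ∑ (λ i → falling 4 (m + y i)) ≡ + 5 * falling 4 m + (B * ∑ y + ∑ (λ i → partTerm m (y i)))
  parts = trans (∑-cong {5} λ i → part m (y i)) (trans (∑-+ {5} (λ _ → falling 4 m) (λ i → B * y i + partTerm m (y i)))
    (cong₂ _+_ (∑-const 5 (falling 4 m)) (trans (∑-+ {5} (λ i → B * y i) (λ i → partTerm m (y i))) (cong (_+ ∑ (λ i → partTerm m (y i))) (∑-*ˡ {5} B y)))))
  fin : ∀ p q A B s g h → + 5 * p + (A * (+ 2 * s) + g) - (+ 5 * q + (B * s + h)) ≡ (+ 5 * p - + 5 * q) + (+ 2 * A - B) * s + (g - h)
  fin = solve-∀

-- The loss 17 is 16 from the cubic term, as K s ≥ -2 m, plus 1 from the term -36 m; the rest is (s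
-- - 3)² + 2.
pairTerm-lower : ∀ K m s → + 0 ≤ K → + 0 ≤ m → + 36 * K ≤ m → - (+ 2 * m) ≤ K * s → (+ 24 * K - + 17) * (m * m) * (s * s) ≤ K * pairTerm m s
pairTerm-lower K m s 0≤K 0≤m h₁ h₂ = ≤-from-diff (e K m s) (0≤* {s * s} (0≤sq s) (0≤+ (0≤* {+ 8 * m} (0≤* {+ 8} 0≤k 0≤m) (i≤j⇒0≤j-i h₂))
  (0≤+ (0≤* {m} 0≤m (i≤j⇒0≤j-i h₁)) (0≤* {K} 0≤K (0≤+ (0≤sq (s - + 3)) (0≤k {2}))))))
  where
  e : ∀ K m s → K * ((+ 24 * (m * m) - + 36 * m + + 11) * (s * s) + (+ 8 * m - + 6) * (s * (s * s)) + s * (s * (s * s))) - (+ 24 * K - + 17) * (m * m) * (s * s)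
    ≡ s * s * (+ 8 * m * (K * s - - (+ 2 * m)) + (m * (m - + 36 * K) + K * ((s - + 3) * (s - + 3) + + 2)))
  e = solve-∀

-- The excess 5 is 4 from the cubic and 1 from the quartic term, as K y lies between -m and m.
partTerm-upper : ∀ K m y → + 1 ≤ K → + 1 ≤ m → - m ≤ K * y → K * y ≤ m → K * partTerm m y ≤ (+ 6 * K + + 5) * (m * m) * (y * y)
partTerm-upper K m y 1≤K 1≤m h₁ h₂ = ≤-from-diff (e K m y) (0≤* {y * y} (0≤sq y)
  (0≤+ (0≤* {+ 4 * m} (0≤* {+ 4} 0≤k 0≤m) lo) (0≤+ (0≤* {m - K * y} lo hi) (0≤+ (0≤* {K * (K - + 1)} (0≤* {K} 0≤K (i≤j⇒0≤j-i 1≤K)) (0≤sq y))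
    (0≤+ (0≤* {+ 6} 0≤k hi) (0≤+ (0≤* {m - + 1} (i≤j⇒0≤j-i 1≤m) (0≤+ (0≤* {+ 12} 0≤k 0≤K) (0≤* {+ 6} 0≤k (i≤j⇒0≤j-i 1≤K)))) (0≤+ 0≤K (0≤* {+ 6} 0≤k (i≤j⇒0≤j-i 1≤K)))))))))
  where
  0≤m : + 0 ≤ m
  0≤m = ≤-trans 0≤k 1≤m
  0≤K : + 0 ≤ K
  0≤K = ≤-trans 0≤k 1≤K
  lo : + 0 ≤ m - K * y
  lo = i≤j⇒0≤j-i h₂
  hi : + 0 ≤ K * y - - m
  hi = i≤j⇒0≤j-i h₁
  e : ∀ K m y → (+ 6 * K + + 5) * (m * m) * (y * y) - K * ((+ 6 * (m * m) - + 18 * m + + 11) * (y * y) + (+ 4 * m - + 6) * (y * (y * y)) + y * (y * (y * y)))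
    ≡ y * y * (+ 4 * m * (m - K * y) + ((m - K * y) * (K * y - - m) + (K * (K - + 1) * (y * y) + (+ 6 * (K * y - - m)
      + ((m - + 1) * (+ 12 * K + + 6 * (K - + 1)) + (K + + 6 * (K - + 1)))))))
  e = solve-∀

-- 73 = 17 · 4 + 5: the loss of 17 on `Σs² y` is converted into one on `Σ² y` by Σs² ≤ 4 Σ².
deviation-lower : ∀ K m (y : Fin 5 → ℤ) → + 1 ≤ K → + 36 * K ≤ m → (∀ i → - m ≤ K * y i × K * y i ≤ m) →
  m * m * (+ 6 * K * quadratic y - + 73 * Σ² y) ≤ K * deviation m y
deviation-lower K m y 1≤K 36K≤m h = ≤-trans (≤-from-diff (e₁ K (m * m) (Σs² y) (Σ² y)) (0≤* {m * m} (0≤sq m) (0≤* {+ 17} 0≤k smooth)))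
  (≤-trans (+-mono-≤ lower (neg-mono-≤ upper)) (≤-reflexive (e₂ K (∑ λ i → pairTerm m (y i + y (succ5 i))) (∑ λ i → partTerm m (y i)))))
  where
  0≤K : + 0 ≤ K
  0≤K = ≤-trans 0≤k 1≤K
  1≤m : + 1 ≤ m
  1≤m = ≤-trans (≤-trans 1≤K (≤-from-diff (e K) (0≤* {+ 35} 0≤k 0≤K))) 36K≤m
    where
    e : ∀ K → + 36 * K - K ≡ + 35 * K
    e = solve-∀
  lower : (+ 24 * K - + 17) * (m * m) * Σs² y ≤ K * ∑ (λ i → pairTerm m (y i + y (succ5 i)))
  lower = ≤-trans (≤-reflexive (sym (∑-*ˡ {5} ((+ 24 * K - + 17) * (m * m)) (λ i → (y i + y (succ5 i)) * (y i + y (succ5 i))))))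
    (≤-trans (∑-mono {5} λ i → pairTerm-lower K m (y i + y (succ5 i)) 0≤K (≤-trans 0≤k 1≤m) 36K≤m (both i))
      (≤-reflexive (∑-*ˡ {5} K (λ i → pairTerm m (y i + y (succ5 i))))))
    where
    both : ∀ i → - (+ 2 * m) ≤ K * (y i + y (succ5 i))
    both i = ≤-from-diff (e K m (y i) (y (succ5 i))) (0≤+ (i≤j⇒0≤j-i (proj₁ (h i))) (i≤j⇒0≤j-i (proj₁ (h (succ5 i)))))
      where
      e : ∀ K m x z → K * (x + z) - - (+ 2 * m) ≡ K * x - - m + (K * z - - m)
      e = solve-∀
  upper : K * ∑ (λ i → partTerm m (y i)) ≤ (+ 6 * K + + 5) * (m * m) * Σ² y
  upper = ≤-trans (≤-reflexive (sym (∑-*ˡ {5} K (λ i → partTerm m (y i)))))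
    (≤-trans (∑-mono {5} λ i → partTerm-upper K m (y i) 1≤K 1≤m (proj₁ (h i)) (proj₂ (h i)))
      (≤-reflexive (∑-*ˡ {5} ((+ 6 * K + + 5) * (m * m)) (λ i → y i * y i))))
  smooth : + 0 ≤ + 4 * Σ² y - Σs² y
  smooth = ≤-trans (0≤+ (0≤sq (y 0F - y 1F)) (0≤+ (0≤sq (y 1F - y 2F)) (0≤+ (0≤sq (y 2F - y 3F)) (0≤+ (0≤sq (y 3F - y 4F)) (0≤sq (y 4F - y 0F))))))
    (≤-reflexive (e (y 0F) (y 1F) (y 2F) (y 3F) (y 4F)))
    where
    e : ∀ a b c d e → (a - b) * (a - b) + ((b - c) * (b - c) + ((c - d) * (c - d) + ((d - e) * (d - e) + (e - a) * (e - a)))) ≡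
      + 4 * (a * a + (b * b + (c * c + (d * d + (e * e + + 0))))) - ((a + b) * (a + b) + ((b + c) * (b + c) + ((c + d) * (c + d) + ((d + e) * (d + e) + ((e + a) * (e + a) + + 0)))))
    e = solve-∀
  e₁ : ∀ K M S Q → (+ 24 * K - + 17) * M * S - (+ 6 * K + + 5) * M * Q - M * (+ 6 * K * (+ 4 * S - Q) - + 73 * Q) ≡ M * (+ 17 * (+ 4 * Q - S))
  e₁ = solve-∀
  e₂ : ∀ K a b → K * a - K * b ≡ K * (a - b)
  e₂ = solve-∀

-- Minimising the integral quadratic form

-- The optimal deviations for each residue r of n modulo 5, and the values of the quadratic form at them.
optimum : Fin 5 → Fin 5 → ℤ
optimum 0F _ = + 0
optimum 1F 0F = - + 1
optimum 1F 1F = + 1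
optimum 1F 4F = + 1
optimum 2F 2F = + 1
optimum 2F 4F = + 1
optimum 3F 1F = + 1
optimum 3F 3F = + 1
optimum 3F 4F = + 1
optimum 4F 1F = + 1
optimum 4F 2F = + 1
optimum 4F 4F = + 2
optimum _ _ = + 0

optimalValue : Fin 5 → ℤ
optimalValue 0F = + 0
optimalValue 1F = + 5
optimalValue 2F = + 14
optimalValue 3F = + 29
optimalValue 4F = + 50

rotate : Fin 5 → Fin 5 → Fin 5
rotate 0F i = i
rotate 1F i = succ5 i
rotate 2F i = succ5 (succ5 i)
rotate 3F i = succ5 (succ5 (succ5 i))
rotate 4F i = succ5 (succ5 (succ5 (succ5 i)))

reflect : Fin 5 → Fin 5
reflect 0F = 0F
reflect 1F = 4F
reflect 2F = 3F
reflect 3F = 2F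
reflect 4F = 1F

dihedral : Fin 10 → Fin 5 → Fin 5
dihedral k i = [ (λ k → rotate k i) , (λ k → rotate k (reflect i)) ]′ (splitAt 5 k)

Optimal : Fin 5 → (Fin 5 → ℤ) → Set
Optimal r y = ∃ λ k → ∀ i → y i ≡ optimum r (dihedral k i)

-- This is 5 · `quadratic y` - `Σ² y`. Minimality is proved for this smaller form, so that the
-- subtracted `Σ² y` can absorb the error in `deviation-lower`.
excess : (Fin 5 → ℤ) → ℤ
excess y = + 20 * Σs² y - + 6 * Σ² y

-- 24 (excess y) - (95 y₀² - 38 r y₀ + 359 r²) is a sum of squares, with r = ∑ y: complete squares in
-- p = y₁ + y₄ and in δ = y₁ - y₄, ε = y₂ - y₃.
excess-bound₀ : ∀ (y : Fin 5 → ℤ) → + 95 * (y 0F * y 0F) - + 38 * (∑ y * y 0F) + + 359 * (∑ y * ∑ y) ≤ + 24 * excess y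
excess-bound₀ y = *-cancelˡ-≤-pos _ _ (+ 7) (≤-from-diff (trans (whole (+ 7) (+ 24) (excess y) X D Y (half a b c d e))
    (cong₂ (λ u v → u + v) (cong (+ 7 *_) main) (cong (+ 24 *_) (rest δ ε))))
  (0≤+ (0≤* {+ 7} 0≤k (0≤sq S)) (0≤* {+ 24} 0≤k (0≤+ (0≤sq (+ 7 * ε + + 10 * δ)) (0≤* {+ 19} 0≤k (0≤sq δ))))))
  where
  a = y 0F
  b = y 1F
  c = y 2F
  d = y 3F
  e = y 4F
  p = b + e
  k = c + d
  δ = b - e
  ε = c - d
  r = ∑ y
  X = + 34 * (a * a) + + 40 * (a * p) + + 17 * (p * p) + + 20 * (p * k) + + 27 * (k * k)
  D = + 17 * (δ * δ) + + 20 * (δ * ε) + + 7 * (ε * ε)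
  Y = + 95 * (a * a) - + 38 * (r * a) + + 359 * (r * r)
  S = + 24 * p + + 37 * a - + 17 * r
  half : ∀ a b c d e → + 20 * ((a + b) * (a + b) + ((b + c) * (b + c) + ((c + d) * (c + d) + ((d + e) * (d + e) + ((e + a) * (e + a) + + 0)))))
      - + 6 * (a * a + (b * b + (c * c + (d * d + (e * e + + 0)))))
    ≡ (+ 34 * (a * a) + + 40 * (a * (b + e)) + + 17 * ((b + e) * (b + e)) + + 20 * ((b + e) * (c + d)) + + 27 * ((c + d) * (c + d)))
    + (+ 17 * ((b - e) * (b - e)) + + 20 * ((b - e) * (c - d)) + + 7 * ((c - d) * (c - d)))
  half = solve-∀
  whole : ∀ n m E X D Y → E ≡ X + D → n * (m * E) - n * Y ≡ n * (m * X - Y) + m * (n * D)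
  whole n m _ X D Y refl = split n m X D Y
    where
    split : ∀ n m X D Y → n * (m * (X + D)) - n * Y ≡ n * (m * X - Y) + m * (n * D)
    split = solve-∀
  rest : ∀ δ ε → + 7 * (+ 17 * (δ * δ) + + 20 * (δ * ε) + + 7 * (ε * ε)) ≡ (+ 7 * ε + + 10 * δ) * (+ 7 * ε + + 10 * δ) + + 19 * (δ * δ)
  rest = solve-∀
  main : + 24 * X - Y ≡ S * S
  main = trans (cong (λ k → + 24 * (+ 34 * (a * a) + + 40 * (a * p) + + 17 * (p * p) + + 20 * (p * k) + + 27 * (k * k)) - Y) (k≡ a b c d e)) (poly a p r)
    where
    k≡ : ∀ a b c d e → c + d ≡ a + (b + (c + (d + (e + + 0)))) - a - (b + e)
    k≡ = solve-∀
    poly : ∀ a p r → + 24 * (+ 34 * (a * a) + + 40 * (a * p) + + 17 * (p * p) + + 20 * (p * (r - a - p)) + + 27 * ((r - a - p) * (r - a - p)))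
      - (+ 95 * (a * a) - + 38 * (r * a) + + 359 * (r * r)) ≡ (+ 24 * p + + 37 * a - + 17 * r) * (+ 24 * p + + 37 * a - + 17 * r)
    poly = solve-∀

excess-rotate : ∀ (y : Fin 5 → ℤ) → (excess (y ∘ succ5) ≡ excess y) × (∑ (y ∘ succ5) ≡ ∑ y)
excess-rotate y = e₁ (y 0F) (y 1F) (y 2F) (y 3F) (y 4F) , e₂ (y 0F) (y 1F) (y 2F) (y 3F) (y 4F)
  where
  e₁ : ∀ a b c d e → + 20 * ((b + c) * (b + c) + ((c + d) * (c + d) + ((d + e) * (d + e) + ((e + a) * (e + a) + ((a + b) * (a + b) + + 0)))))
      - + 6 * (b * b + (c * c + (d * d + (e * e + (a * a + + 0)))))
    ≡ + 20 * ((a + b) * (a + b) + ((b + c) * (b + c) + ((c + d) * (c + d) + ((d + e) * (d + e) + ((e + a) * (e + a) + + 0)))))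
      - + 6 * (a * a + (b * b + (c * c + (d * d + (e * e + + 0)))))
  e₁ = solve-∀
  e₂ : ∀ a b c d e → b + (c + (d + (e + (a + + 0)))) ≡ a + (b + (c + (d + (e + + 0))))
  e₂ = solve-∀

ExcessBound : (Fin 5 → ℤ) → ℤ → Set
ExcessBound y x = + 95 * (x * x) - + 38 * (∑ y * x) + + 359 * (∑ y * ∑ y) ≤ + 24 * excess y

rotate-back : ∀ y {x} → ExcessBound (y ∘ succ5) x → ExcessBound y x
rotate-back y {x} h = subst (λ r → + 95 * (x * x) - + 38 * (r * x) + + 359 * (r * r) ≤ + 24 * excess y) (proj₂ (excess-rotate y))
  (≤-trans h (≤-reflexive (cong (+ 24 *_) (proj₁ (excess-rotate y)))))

excess-bound : ∀ (y : Fin 5 → ℤ) i → ExcessBound y (y i)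
excess-bound y 0F = excess-bound₀ y
excess-bound y 1F = rotate-back y {y 1F} (excess-bound₀ (y ∘ succ5))
excess-bound y 2F = rotate-back y {y 2F} (rotate-back (y ∘ succ5) {y 2F} (excess-bound₀ (y ∘ succ5 ∘ succ5)))
excess-bound y 3F = rotate-back y {y 3F} (rotate-back (y ∘ succ5) {y 3F} (rotate-back (y ∘ succ5 ∘ succ5) {y 3F} (excess-bound₀ (y ∘ succ5 ∘ succ5 ∘ succ5))))
excess-bound y 4F = rotate-back y {y 4F} (rotate-back (y ∘ succ5) {y 4F} (rotate-back (y ∘ succ5 ∘ succ5) {y 4F}
  (rotate-back (y ∘ succ5 ∘ succ5 ∘ succ5) {y 4F} (excess-bound₀ (y ∘ succ5 ∘ succ5 ∘ succ5 ∘ succ5)))))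

residue : Fin 5 → ℤ
residue r = + toℕ r

Small : ℤ → Set
Small x = - + 1 ≤ x × x ≤ + 2

-- The quadratic in `x` exceeds `T` at 3 and at -2, and the sign conditions make it grow beyond
-- these two points.
range : ∀ α β γ r x T → + 0 ≤ α → + 0 ≤ β → + 0 ≤ r → α * (x * x) - β * (r * x) + γ * (r * r) ≤ T →
  T < + 3 * (α * + 3 - β * r) + γ * (r * r) → T < + 2 * (α * + 2 + β * r) + γ * (r * r) → + 0 ≤ α * + 3 - β * r → Small x
range α β γ r x T 0≤α 0≤β 0≤r h h₁ h₂ 0≤d = ≮⇒≥ too-low , ≮⇒≥ too-high
  where
  too-high : + 2 < x → ⊥
  too-high 2<x = <⇒≱ h₁ (≤-trans (≤-from-diff (e α β γ r x) (0≤+ (0≤* {x - + 3} x≥3 (0≤+ {α * + 3 - β * r} 0≤d (0≤* {α} 0≤α (0≤+ {x - + 3} x≥3 (0≤k {3}))))) (0≤k {0}))) h)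
    where
    x≥3 : + 0 ≤ x - + 3
    x≥3 = i≤j⇒0≤j-i (i<j⇒suc[i]≤j 2<x)
    e : ∀ α β γ r x → α * (x * x) - β * (r * x) + γ * (r * r) - (+ 3 * (α * + 3 - β * r) + γ * (r * r)) ≡ (x - + 3) * (α * + 3 - β * r + α * (x - + 3 + + 3)) + + 0
    e = solve-∀
  too-low : x < - + 1 → ⊥
  too-low x<-1 = <⇒≱ h₂ (≤-trans (≤-from-diff (e α β γ r x) (0≤* {(- + 2) - x} x≤-2 (0≤+ (0≤* {α} 0≤α (0≤+ {(- + 2) - x} x≤-2 (0≤k {4}))) (0≤* {β} 0≤β 0≤r)))) h)
    where
    x≤-2 : + 0 ≤ - + 2 - x
    x≤-2 = ≤-trans (i≤j⇒0≤j-i (i<j⇒suc[i]≤j x<-1)) (≤-reflexive (e′ x))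
      where
      e′ : ∀ x → - + 1 - (+ 1 + x) ≡ - + 2 - x
      e′ = solve-∀
    e : ∀ α β γ r x → α * (x * x) - β * (r * x) + γ * (r * r) - (+ 2 * (α * + 2 + β * r) + γ * (r * r)) ≡ (- + 2 - x) * (α * (- + 2 - x + + 4) + β * r)
    e = solve-∀

decide-≤ : ∀ {x y} → (x ≤ᵇ y) ≡ true → x ≤ y
decide-≤ {x} {y} e = ≤ᵇ⇒≤ (subst Bool.T (sym e) _)

decide-< : ∀ {x y} → (+ 1 + x ≤ᵇ y) ≡ true → x < y
decide-< {x} {y} e = suc[i]≤j⇒i<j (decide-≤ e)

small-deviations : ∀ r (y : Fin 5 → ℤ) → ∑ y ≡ residue r → excess y ≤ + 5 * optimalValue r → ∀ i → Small (y i)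
small-deviations r y s h i = range (+ 95) (+ 38) (+ 359) (residue r) (y i) (+ 24 * (+ 5 * optimalValue r)) 0≤k 0≤k 0≤k
    (≤-trans (subst (λ r → + 95 * (y i * y i) - + 38 * (r * y i) + + 359 * (r * r) ≤ + 24 * excess y) s (excess-bound y i)) (*-monoˡ {+ 24} 0≤k h))
    (decide-< (allF-sound f₁ refl r)) (decide-< (allF-sound f₂ refl r)) (decide-≤ (allF-sound f₃ refl r))
  where
  f₁ f₂ f₃ : Fin 5 → Bool
  f₁ r = + 1 + + 24 * (+ 5 * optimalValue r) ≤ᵇ + 3 * (+ 95 * + 3 - + 38 * residue r) + + 359 * (residue r * residue r)
  f₂ r = + 1 + + 24 * (+ 5 * optimalValue r) ≤ᵇ + 2 * (+ 95 * + 2 + + 38 * residue r) + + 359 * (residue r * residue r)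
  f₃ r = + 0 ≤ᵇ + 95 * + 3 - + 38 * residue r

smallValue : Fin 4 → ℤ
smallValue 0F = - + 1
smallValue 1F = + 0
smallValue 2F = + 1
smallValue 3F = + 2

small-index : ∀ x → Small x → ∃ λ k → x ≡ smallValue k
small-index (-[1+ 0 ]) _ = 0F , refl
small-index (-[1+ suc k ]) (-≤- () , _)
small-index (+ 0) _ = 1F , refl
small-index (+ 1) _ = 2F , refl
small-index (+ 2) _ = 3F , refl
small-index (+ suc (suc (suc k))) (_ , +≤+ (ℕ.s≤s (ℕ.s≤s ())))

optimalᵇ : Fin 5 → (Fin 5 → ℤ) → Bool
optimalᵇ r y = anyF λ k → allF λ i → does (y i ≟ optimum r (dihedral k i))

optimal-check : Fin 5 → (Fin 5 → ℤ) → Bool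
optimal-check r y = (does (∑ y ≟ residue r) ∧ (excess y ≤ᵇ + 5 * optimalValue r)) ⇒ᵇ optimalᵇ r y

≟-refl : ∀ {x y : ℤ} → x ≡ y → does (x ≟ y) ≡ true
≟-refl {x} {y} e with x ≟ y
... | yes p = refl
... | no p = ⊥-elim (p e)

≤ᵇ-refl : ∀ {x y} → x ≤ y → (x ≤ᵇ y) ≡ true
≤ᵇ-refl {x} {y} h with x ≤ᵇ y | ≤⇒≤ᵇ h
... | true | _ = refl

optimal-checked : ∀ r a b c d e → optimal-check r (smallValue ∘ pick₅ a b c d e) ≡ true
optimal-checked r = checkF 5 (λ a b c d e → optimal-check r (smallValue ∘ pick₅ a b c d e))
  (allF-sound (λ r → exhaustF 5 λ a b c d e → optimal-check r (smallValue ∘ pick₅ a b c d e)) refl r)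

-- Below the bound every coordinate lies between -1 and 2 by `small-deviations`, so 4⁵ vectors per
-- residue remain; they are evaluated in `optimal-checked`.
optimal-or-large : ∀ r (y : Fin 5 → ℤ) → ∑ y ≡ residue r → Optimal r y ⊎ (+ 5 * optimalValue r < excess y)
optimal-or-large r y s = by (excess y ≤? + 5 * optimalValue r)
  where
  by : Dec (excess y ≤ + 5 * optimalValue r) → Optimal r y ⊎ (+ 5 * optimalValue r < excess y)
  by (no p) = inj₂ (≰⇒> p)
  by (yes p) = inj₁ (read (anyF-sound (λ k → allF λ i → does (z i ≟ optimum r (dihedral k i))) checked))
    where
    index : ∀ i → ∃ λ k → y i ≡ smallValue k
    index i = small-index (y i) (small-deviations r y s p i)
    z : Fin 5 → ℤ
    z = smallValue ∘ pick₅ (proj₁ (index 0F)) (proj₁ (index 1F)) (proj₁ (index 2F)) (proj₁ (index 3F)) (proj₁ (index 4F))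
    y≡z : ∀ i → y i ≡ z i
    y≡z 0F = proj₂ (index 0F)
    y≡z 1F = proj₂ (index 1F)
    y≡z 2F = proj₂ (index 2F)
    y≡z 3F = proj₂ (index 3F)
    y≡z 4F = proj₂ (index 4F)
    excess≡ : excess y ≡ excess z
    excess≡ = cong₂ (λ u v → + 20 * u - + 6 * v) (∑-cong {5} λ i → cong₂ (λ u v → (u + v) * (u + v)) (y≡z i) (y≡z (succ5 i))) (∑-cong {5} λ i → cong₂ _*_ (y≡z i) (y≡z i))
    checked : optimalᵇ r z ≡ true
    checked = ⇒ᵇ-elim (optimal-checked r (proj₁ (index 0F)) (proj₁ (index 1F)) (proj₁ (index 2F)) (proj₁ (index 3F)) (proj₁ (index 4F)))
      (cong₂ _∧_ (≟-refl (trans (sym (∑-cong {5} y≡z)) s)) (≤ᵇ-refl (≤-trans (≤-reflexive (sym excess≡)) p)))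
    read : (∃ λ k → allF (λ i → does (z i ≟ optimum r (dihedral k i))) ≡ true) → Optimal r y
    read (k , h) = k , λ i → trans (y≡z i) (≟-true (allF-sound (λ i → does (z i ≟ optimum r (dihedral k i))) h i))

-- Lower-order terms and the optimal part sizes

linearTerm constantTerm : (Fin 5 → ℤ) → ℤ
linearTerm y = ∑ (λ i → let s = y i + y (succ5 i) in + 8 * (s * (s * s)) - + 36 * (s * s)) - ∑ (λ i → + 4 * (y i * (y i * y i)) - + 18 * (y i * y i))
constantTerm y = ∑ (λ i → let s = y i + y (succ5 i) in s * (s * (s * s)) - + 6 * (s * (s * s)) + + 11 * (s * s))
  - ∑ (λ i → y i * (y i * (y i * y i)) - + 6 * (y i * (y i * y i)) + + 11 * (y i * y i))

deviation-expand : ∀ m (y : Fin 5 → ℤ) → deviation m y ≡ + 6 * quadratic y * (m * m) + linearTerm y * m + constantTerm y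
deviation-expand m y = trans (cong₂ _-_ pairs parts) (fin m (Σs² y) (Σ² y) (∑ l₁) (∑ l₂) (∑ c₁) (∑ c₂))
  where
  s l₁ l₂ c₁ c₂ : Fin 5 → ℤ
  s i = y i + y (succ5 i)
  l₁ i = + 8 * (s i * (s i * s i)) - + 36 * (s i * s i)
  l₂ i = + 4 * (y i * (y i * y i)) - + 18 * (y i * y i)
  c₁ i = s i * (s i * (s i * s i)) - + 6 * (s i * (s i * s i)) + + 11 * (s i * s i)
  c₂ i = y i * (y i * (y i * y i)) - + 6 * (y i * (y i * y i)) + + 11 * (y i * y i)
  combine₃ : ∀ k (a b c : Fin 5 → ℤ) → ∑ (λ i → k * a i + (m * b i + c i)) ≡ k * ∑ a + (m * ∑ b + ∑ c)
  combine₃ k a b c = trans (∑-+ (λ i → k * a i) (λ i → m * b i + c i)) (cong₂ _+_ (∑-*ˡ k a)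
    (trans (∑-+ (λ i → m * b i) c) (cong (_+ ∑ c) (∑-*ˡ m b))))
  pairs : ∑ (λ i → pairTerm m (s i)) ≡ + 24 * (m * m) * Σs² y + (m * ∑ l₁ + ∑ c₁)
  pairs = trans (∑-cong {5} λ i → e m (s i)) (combine₃ (+ 24 * (m * m)) (λ i → s i * s i) l₁ c₁)
    where
    e : ∀ m s → (+ 24 * (m * m) - + 36 * m + + 11) * (s * s) + (+ 8 * m - + 6) * (s * (s * s)) + s * (s * (s * s)) ≡
      + 24 * (m * m) * (s * s) + (m * (+ 8 * (s * (s * s)) - + 36 * (s * s)) + (s * (s * (s * s)) - + 6 * (s * (s * s)) + + 11 * (s * s)))
    e = solve-∀
  parts : ∑ (λ i → partTerm m (y i)) ≡ + 6 * (m * m) * Σ² y + (m * ∑ l₂ + ∑ c₂)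
  parts = trans (∑-cong {5} λ i → e m (y i)) (combine₃ (+ 6 * (m * m)) (λ i → y i * y i) l₂ c₂)
    where
    e : ∀ m y → (+ 6 * (m * m) - + 18 * m + + 11) * (y * y) + (+ 4 * m - + 6) * (y * (y * y)) + y * (y * (y * y)) ≡
      + 6 * (m * m) * (y * y) + (m * (+ 4 * (y * (y * y)) - + 18 * (y * y)) + (y * (y * (y * y)) - + 6 * (y * (y * y)) + + 11 * (y * y)))
    e = solve-∀
  fin : ∀ m S Q l₁ l₂ c₁ c₂ → + 24 * (m * m) * S + (m * l₁ + c₁) - (+ 6 * (m * m) * Q + (m * l₂ + c₂))
    ≡ + 6 * (+ 4 * S - Q) * (m * m) + (l₁ - l₂) * m + (c₁ - c₂)
  fin = solve-∀

-- For the five optimal vectors the linear coefficient in `m` is nonpositive and the constant at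
-- most 24, both by evaluation.
deviation-optimum : ∀ r m → + 0 ≤ m → deviation m (optimum r) ≤ + 6 * optimalValue r * (m * m) + + 24
deviation-optimum r m 0≤m = ≤-trans (≤-reflexive (deviation-expand m (optimum r)))
  (+-mono-≤ (≤-trans (+-monoʳ-≤ (+ 6 * quadratic (optimum r) * (m * m)) (≤-trans (≤-reflexive (*-comm (linearTerm (optimum r)) m))
      (≤-trans (*-monoˡ {m} 0≤m (decide-≤ {linearTerm (optimum r)} {+ 0} (allF-sound (λ r → linearTerm (optimum r) ≤ᵇ + 0) refl r))) (≤-reflexive (*-zeroʳ m)))))
    (≤-reflexive (trans (+-identityʳ _) (cong (λ q → + 6 * q * (m * m)) (≟-true {quadratic (optimum r)} {optimalValue r} (allF-sound (λ r → does (quadratic (optimum r) ≟ optimalValue r)) refl r))))))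
    (decide-≤ {constantTerm (optimum r)} {+ 24} (allF-sound (λ r → constantTerm (optimum r) ≤ᵇ + 24) refl r)))

-- The proof uses K = 65 and a = 78 with 6 K = 5 a; here 78 is the least multiple of 6 that is at
-- least 73. Then 6 K `quadratic y` - 73 `Σ² y` is at least a · `excess y`. If this excess surpasses
-- five times the optimal value by a unit, then 78 m² ≤ 24 · 65 follows, which is absurd for m ≥
-- 2340 = 36 · 65.
minimiser-optimal : ∀ r m (y : Fin 5 → ℤ) → ∑ y ≡ residue r → ∑ (optimum r) ≡ residue r → + 2340 ≤ m → (∀ i → - m ≤ + 65 * y i × + 65 * y i ≤ m) →
  cliqueCount (λ i → m + y i) ≤ cliqueCount (λ i → m + optimum r i) → Optimal r y
minimiser-optimal r m y s s* m≥ bounded h = by (optimal-or-large r y s)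
  where
  0≤m : + 0 ≤ m
  0≤m = ≤-trans 0≤k m≥
  deviation≤ : deviation m y ≤ deviation m (optimum r)
  deviation≤ = cancel (taylor m y) (taylor m (optimum r)) h
    where
    base = + 5 * falling 4 (+ 2 * m) - + 5 * falling 4 m
    slope = + 2 * (+ 32 * (m * (m * m)) - + 72 * (m * m) + + 44 * m - + 6) - (+ 4 * (m * (m * m)) - + 18 * (m * m) + + 22 * m - + 6)
    cancel : ∀ {u v} → u ≡ base + slope * ∑ y + deviation m y → v ≡ base + slope * ∑ (optimum r) + deviation m (optimum r) → u ≤ v → deviation m y ≤ deviation m (optimum r)
    cancel {u} {v} p q u≤v = ≤-from-diff (e (base + slope * ∑ y) (deviation m y) (deviation m (optimum r)))
      (i≤j⇒0≤j-i (≤-trans (≤-reflexive (sym p)) (≤-trans u≤v (≤-reflexive (trans q (cong (λ x → base + slope * x + deviation m (optimum r)) (trans s* (sym s))))))))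
      where
      e : ∀ b x y → y - x ≡ b + y - (b + x)
      e = solve-∀
  contradictory : ∀ a K M q q* S Φ Φ* → + 6 * K ≡ + 5 * a → + 73 ≤ a → + 0 ≤ M → + 0 ≤ S → + 0 ≤ K → + 0 ≤ a →
    M * (+ 6 * K * q - + 73 * S) ≤ K * Φ → Φ ≤ Φ* → Φ* ≤ + 6 * q* * M + + 24 → + 5 * q* + + 1 ≤ + 5 * q - S → a * M ≤ + 24 * K
  contradictory a K M q q* S Φ Φ* 6K≡ 73≤a 0≤M 0≤S 0≤K 0≤a h₁ h₂ h₃ h₄ = ≤-from-diff (e a K M q q* S Φ Φ* 6K≡)
    (0≤+ (i≤j⇒0≤j-i h₁) (0≤+ (0≤* {K} 0≤K (i≤j⇒0≤j-i h₂)) (0≤+ (0≤* {K} 0≤K (i≤j⇒0≤j-i h₃)) (0≤+ (0≤* {a * M} (0≤* {a} 0≤a 0≤M) (i≤j⇒0≤j-i h₄)) (0≤* {M} 0≤M (0≤* {a - + 73} (i≤j⇒0≤j-i 73≤a) 0≤S))))))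
    where
    e′ : ∀ a K M q q* S Φ Φ* → + 24 * K - a * M ≡ (K * Φ - M * (+ 6 * K * q - + 73 * S)) + (K * (Φ* - Φ) + (K * (+ 6 * q* * M + + 24 - Φ*)
      + (a * M * (+ 5 * q - S - (+ 5 * q* + + 1)) + M * ((a - + 73) * S)))) + (+ 6 * K - + 5 * a) * (M * q - M * q*)
    e′ = solve-∀
    e : ∀ a K M q q* S Φ Φ* → + 6 * K ≡ + 5 * a → + 24 * K - a * M ≡ (K * Φ - M * (+ 6 * K * q - + 73 * S)) + (K * (Φ* - Φ) + (K * (+ 6 * q* * M + + 24 - Φ*)
      + (a * M * (+ 5 * q - S - (+ 5 * q* + + 1)) + M * ((a - + 73) * S))))
    e a K M q q* S Φ Φ* p = trans (e′ a K M q q* S Φ Φ*) (trans (cong (λ x → rest + (x - + 5 * a) * (M * q - M * q*)) p) (zero-term rest (+ 5 * a) (M * q - M * q*)))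
      where
      rest = (K * Φ - M * (+ 6 * K * q - + 73 * S)) + (K * (Φ* - Φ) + (K * (+ 6 * q* * M + + 24 - Φ*)
        + (a * M * (+ 5 * q - S - (+ 5 * q* + + 1)) + M * ((a - + 73) * S))))
      zero-term : ∀ x y z → x + (y - y) * z ≡ x
      zero-term = solve-∀
  excess≡ : ∀ S Q → + 20 * S - + 6 * Q ≡ + 5 * (+ 4 * S - Q) - Q
  excess≡ = solve-∀
  too-small : + 78 * (m * m) ≤ + 24 * + 65 → ⊥
  too-small p = <⇒≱ {+ 24 * + 65} {+ 78 * + 2340} (decide-< refl) (≤-trans (*-monoˡ {+ 78} 0≤k (≤-trans m≥ (≤-from-diff (e m) (0≤* {m} 0≤m (≤-trans 0≤k (i≤j⇒0≤j-i (≤-trans (decide-≤ {+ 1} {+ 2340} refl) m≥))))))) p)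
    where
    e : ∀ m → m * m - m ≡ m * (m - + 1)
    e = solve-∀
  by : Optimal r y ⊎ (+ 5 * optimalValue r < excess y) → Optimal r y
  by (inj₁ o) = o
  by (inj₂ l) = ⊥-elim (too-small (contradictory (+ 78) (+ 65) (m * m) (quadratic y) (optimalValue r) (Σ² y) (deviation m y) (deviation m (optimum r))
    refl (decide-≤ refl) (0≤sq m) (∑-nonneg λ i → 0≤sq (y i)) 0≤k 0≤k (deviation-lower (+ 65) m y (decide-≤ refl) m≥ bounded) deviation≤ (deviation-optimum r m 0≤m)
    (≤-trans (≤-reflexive (+-comm (+ 5 * optimalValue r) (+ 1))) (≤-trans (i<j⇒suc[i]≤j l) (≤-reflexive (excess≡ (Σs² y) (Σ² y)))))))

-- Isomorphism of blow-ups with equal part sizes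

∑-punchIn : ∀ {n} v (f : Fin (suc n) → ℤ) → ∑ f ≡ f v + ∑ (λ i → f (punchIn v i))
∑-punchIn zero f = refl
∑-punchIn {suc n} (suc v) f = trans (cong (λ x → f zero + x) (∑-punchIn v (λ i → f (suc i))))
  (eq (f zero) (f (suc v)) (∑ λ i → f (suc (punchIn v i))))
  where
  eq : ∀ a b c → a + (b + c) ≡ b + (a + c)
  eq = solve-∀

insert-self : ∀ {n} (π : Fin n ↔ Fin n) j → insert zero j π ⟨$⟩ʳ zero ≡ j
insert-self π j = refl

-- Vertex `zero` is sent to any vertex `v` of its colour. Deleting both, the latter through
-- `punchIn v`, leaves classes of equal sizes for the induction.
matching : ∀ {n k} (c c′ : Fin n → Fin k) → (∀ j → size c j ≡ size c′ j) →
  Σ (Fin n ↔ Fin n) λ σ → ∀ u → c′ (Inverse.to σ u) ≡ c u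
matching {zero} c c′ h = ↔-id (Fin 0) , λ ()
matching {suc n} {k} c c′ h = extend (∑-pos⇒∃ (λ p → ι (c zero ≡ᵇ c′ p)) occurs)
  where
  occurs : + 0 < size c′ (c zero)
  occurs = <-≤-trans (+<+ (ℕ.s≤s ℕ.z≤n)) (≤-trans (≤-trans (≤-reflexive (sym (cong ι (≡ᵇ-refl (c zero)))))
    (term≤∑ (λ p → ι (c zero ≡ᵇ c p)) (λ p → 0≤ι (c zero ≡ᵇ c p)) zero)) (≤-reflexive (h (c zero))))
  extend : (∃ λ v → + 0 < ι (c zero ≡ᵇ c′ v)) → Σ (Fin (suc n) ↔ Fin (suc n)) λ σ → ∀ u → c′ (Inverse.to σ u) ≡ c u
  extend (v , pos) = insert zero v (proj₁ rest) , agree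
    where
    same-colour′ : c′ v ≡ c zero
    same-colour′ = sym (≡ᵇ⇒≡ (c zero) (c′ v) (positive (c zero ≡ᵇ c′ v) pos))
      where
      positive : ∀ b → + 0 < ι b → b ≡ true
      positive true _ = refl
      positive false (+<+ ())
    sizes′ : ∀ j → size (λ i → c (suc i)) j ≡ size (λ i → c′ (punchIn v i)) j
    sizes′ j = cancel (ι (j ≡ᵇ c zero)) (trans (h j) (trans (∑-punchIn v (λ p → ι (j ≡ᵇ c′ p))) (cong (λ i → ι (j ≡ᵇ i) + size (λ i → c′ (punchIn v i)) j) same-colour′)))
      where
      cancel : ∀ a {x y} → a + x ≡ a + y → x ≡ y
      cancel a {x} {y} p = +-cancelˡ a x y p
        where
        +-cancelˡ : ∀ a x y → a + x ≡ a + y → x ≡ y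
        +-cancelˡ a x y q = trans (e a x) (trans (cong (λ z → z - a) q) (sym (e a y)))
          where
          e : ∀ a x → x ≡ a + x - a
          e = solve-∀
    rest = matching (λ i → c (suc i)) (λ i → c′ (punchIn v i)) sizes′
    agree : ∀ u → c′ (Inverse.to (insert zero v (proj₁ rest)) u) ≡ c u
    agree zero = trans (cong c′ (insert-self (proj₁ rest) v)) same-colour′
    agree (suc u) = trans (cong c′ (insert-punchIn zero v (proj₁ rest) u)) (proj₂ rest u)

dihedral-far : ∀ k i j → far (dihedral k i) (dihedral k j) ≡ far i j
dihedral-far k i j = ⇔ᵇ-elim (checkF 2 (λ i j → far (dihedral k i) (dihedral k j) ⇔ᵇ far i j)
  (allF-sound (λ k → exhaustF 2 λ i j → far (dihedral k i) (dihedral k j) ⇔ᵇ far i j) refl k) i j)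

dihedral-injective : ∀ k i j → (dihedral k i ≡ᵇ dihedral k j) ≡ (i ≡ᵇ j)
dihedral-injective k i j = ⇔ᵇ-elim (checkF 2 (λ i j → (dihedral k i ≡ᵇ dihedral k j) ⇔ᵇ (i ≡ᵇ j))
  (allF-sound (λ k → exhaustF 2 λ i j → (dihedral k i ≡ᵇ dihedral k j) ⇔ᵇ (i ≡ᵇ j)) refl k) i j)

dihedral-surjective : ∀ k j → ∃ λ i → dihedral k i ≡ j
dihedral-surjective k j = read (anyF-sound (λ i → dihedral k i ≡ᵇ j) (allF-sound (λ j → anyF λ i → dihedral k i ≡ᵇ j)
    (allF-sound (λ k → allF λ j → anyF λ i → dihedral k i ≡ᵇ j) refl k) j))
  where
  read : (∃ λ i → (dihedral k i ≡ᵇ j) ≡ true) → ∃ λ i → dihedral k i ≡ j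
  read (i , e) = i , ≡ᵇ⇒≡ (dihedral k i) j e

optimum-sum : ∀ r → ∑ (optimum r) ≡ residue r
optimum-sum r = ≟-true {∑ (optimum r)} {residue r} (allF-sound (λ r → does (∑ (optimum r) ≟ residue r)) refl r)

-- An optimal deviation can be -1. One unit of the quotient is moved in here so that the part sizes
-- are sums of natural numbers.
optimum⁺ : Fin 5 → Fin 5 → ℕ
optimum⁺ r i = ∣ + 1 + optimum r i ∣

optimum⁺-value : ∀ r i → + optimum⁺ r i ≡ + 1 + optimum r i
optimum⁺-value r i = ≟-true {+ optimum⁺ r i} {+ 1 + optimum r i} (checkF 2 (λ r i → does (+ optimum⁺ r i ≟ + 1 + optimum r i)) refl r i)

optimum⁺-total : ∀ r → total (optimum⁺ r) ≡ 5 ℕ.+ toℕ r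
optimum⁺-total 0F = refl
optimum⁺-total 1F = refl
optimum⁺-total 2F = refl
optimum⁺-total 3F = refl
optimum⁺-total 4F = refl

optimal-colouring : ∀ {n} r m → n ≡ toℕ r ℕ.+ suc m ℕ.* 5 → Σ (Fin n → Fin 5) λ c → ∀ i → size c i ≡ + suc m + optimum r i
optimal-colouring {n} r m e = proj₁ col , λ i → trans (proj₂ col i) (trans (pos-+ m (optimum⁺ r i)) (trans (cong (λ x → + m + x) (optimum⁺-value r i)) (eq (+ m) (optimum r i))))
  where
  eq : ∀ m x → m + (+ 1 + x) ≡ + 1 + m + x
  eq = solve-∀
  col = colouring-of (λ i → m ℕ.+ optimum⁺ r i) (trans (total-shift m (optimum⁺ r)) (trans (cong (ℕ._+ m ℕ.* 5) (optimum⁺-total r)) (trans (arith (toℕ r) m) (sym e))))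
    where
    arith : ∀ r m → 5 ℕ.+ r ℕ.+ m ℕ.* 5 ≡ r ℕ.+ (5 ℕ.+ m ℕ.* 5)
    arith = ℕSolver.solve-∀

blowup-agrees : ∀ {n} (G : Graph n) τ → IsBlowup G τ → ∀ u w → adj G u w ≡ adj (blowup τ) u w
blowup-agrees G τ h u w with u ≡ᵇ w in eq
... | true rewrite ≡ᵇ⇒≡ u w eq = irrefl G w
... | false with adj G u w | h u w
... | true | e rewrite eq = trans (cong not e) refl
... | false | e rewrite eq = trans (cong not e) refl

T-blowup : ∀ {n} (G : Graph n) τ → IsBlowup G τ → T (adj G) 4 everything ≡ cliqueCount (size τ)
T-blowup G τ h = trans (T-cong {A = adj G} {adj (blowup τ)} 4 {everything} {everything} (blowup-agrees G τ h) (λ _ → refl)) (blowup-count τ)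

cliqueCount-cong : ∀ (w w′ : Fin 5 → ℤ) → (∀ i → w i ≡ w′ i) → cliqueCount w ≡ cliqueCount w′
cliqueCount-cong w w′ h = cong₂ _-_ (∑-cong {5} λ i → cong₂ (λ a b → falling 4 (a + b)) (h i) (h (succ5 i))) (∑-cong {5} λ i → cong (falling 4) (h i))

-- With δ at most N/390, 65 times the distance of `w` from N/5 is at most N/10, about m/2. The other
-- half of `m` covers the difference between N/5 and `m`.
scaled-deviation : ∀ N m r δ w → N ≡ r + + 5 * m → + 0 ≤ r → r ≤ + 4 → + 390 * δ ≤ N → + 2340 ≤ m → Near N δ w →
  - m ≤ + 65 * (w - m) × + 65 * (w - m) ≤ m
scaled-deviation _ m r δ w refl 0≤r r≤4 δ≤ m≥ (lo , hi) =
  *-cancelˡ-≤-pos (- m) (+ 65 * (w - m)) (+ 10) (≤-from-diff (e₁ m r δ w) (0≤+ (0≤* {+ 130} 0≤k (i≤j⇒0≤j-i lo))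
    (0≤+ (i≤j⇒0≤j-i δ≤) (0≤+ (0≤* {+ 5} 0≤k 0≤m) (0≤* {+ 129} 0≤k 0≤r))))) ,
  *-cancelˡ-≤-pos (+ 65 * (w - m)) m (+ 10) (≤-from-diff (e₂ m r δ w) (0≤+ (0≤* {+ 130} 0≤k (i≤j⇒0≤j-i hi))
    (0≤+ (i≤j⇒0≤j-i δ≤) (0≤+ (0≤* {+ 131} 0≤k (i≤j⇒0≤j-i r≤4)) (0≤+ (0≤* {+ 4} 0≤k 0≤m) (i≤j⇒0≤j-i (≤-trans (decide-≤ {+ 524} {+ 2340} refl) m≥)))))))
  where
  0≤m : + 0 ≤ m
  0≤m = ≤-trans 0≤k m≥
  e₁ : ∀ m r δ w → + 10 * (+ 65 * (w - m)) - + 10 * (- m) ≡ + 130 * (+ 5 * w - (r + + 5 * m) - - (+ 3 * δ)) + (r + + 5 * m - + 390 * δ + (+ 5 * m + + 129 * r))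
  e₁ = solve-∀
  e₂ : ∀ m r δ w → + 10 * m - + 10 * (+ 65 * (w - m)) ≡ + 130 * (+ 3 * δ - (+ 5 * w - (r + + 5 * m))) + (r + + 5 * m - + 390 * δ + (+ 131 * (+ 4 - r) + (+ 4 * m + (m - + 524))))
  e₂ = solve-∀

-- Composing the colouring with the dihedral symmetry found by `minimiser-optimal` makes the part
-- sizes depend on `n` alone; any two minimisers can then be matched part by part.
canonical-colouring : ∀ {n} (G : Graph n) → IsExtremal 4 3 G → ∀ r m μ → μ ≡ + suc m → n ≡ toℕ r ℕ.+ suc m ℕ.* 5 → + 2340 ≤ μ →
  (τ : Fin n → Fin 5) → IsBlowup G τ → (∀ p → Near (+ n) (+ (n ℕ./ 390)) (size τ p)) →
  Σ (Fin n → Fin 5) λ c → IsBlowup G c × (∀ j → size c j ≡ μ + optimum r j)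
canonical-colouring {n} G ext r m μ μ≡ n≡ m≥ τ blow near = recolour (minimiser-optimal r μ y y-sum (optimum-sum r) m≥ bounded minimal)
  where
  y : Fin 5 → ℤ
  y i = size τ i - μ
  N≡ : + n ≡ residue r + + 5 * μ
  N≡ = trans (cong +_ n≡) (trans (pos-+ (toℕ r) (suc m ℕ.* 5)) (cong (λ x → residue r + x) (trans (pos-* (suc m) 5) (trans (cong (_* + 5) (sym μ≡)) (*-comm μ (+ 5))))))
  w≡ : ∀ i → size τ i ≡ μ + y i
  w≡ i = e (size τ i) μ
    where
    e : ∀ w m → w ≡ m + (w - m)
    e = solve-∀
  size-total : ∑ (size τ) ≡ + n
  size-total = trans (∑-cong λ i → sym (*-identityʳ (size τ i))) (trans (sym (∑-colour τ (λ _ → + 1))) (trans (∑-const n (+ 1)) (*-identityʳ (+ n))))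
  y-sum : ∑ y ≡ residue r
  y-sum = trans (∑-minus {5} (size τ) (λ _ → μ)) (trans (cong₂ _-_ (trans size-total N≡) (∑-const 5 μ)) (e (residue r) (+ 5 * μ)))
    where
    e : ∀ r x → r + x - x ≡ r
    e = solve-∀
  r≤4 : residue r ≤ + 4
  r≤4 = decide-≤ {residue r} {+ 4} (allF-sound (λ r → residue r ≤ᵇ + 4) refl r)
  bounded : ∀ i → - μ ≤ + 65 * y i × + 65 * y i ≤ μ
  bounded i = scaled-deviation (+ n) μ (residue r) (+ (n ℕ./ 390)) (size τ i) N≡ 0≤k r≤4 (proj₁ (/-bounds n 390)) m≥ (near i)
  minimal : cliqueCount (λ i → μ + y i) ≤ cliqueCount (λ i → μ + optimum r i)
  minimal = ≤-trans (≤-reflexive (sym (trans (T-blowup G τ blow) (cliqueCount-cong (size τ) (λ i → μ + y i) w≡))))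
    (≤-trans (T₄-mono-t {G = G} {blowup c*} (proj₂ ext (blowup c*) (blowup-αLess c*))) (≤-reflexive (trans (blowup-count c*) (cliqueCount-cong (size c*) (λ i → μ + optimum r i) (λ i → trans (proj₂ best i) (cong (_+ optimum r i) (sym μ≡)))))))
    where
    best = optimal-colouring r m n≡
    c* = proj₁ best
  recolour : Optimal r y → Σ (Fin n → Fin 5) λ c → IsBlowup G c × (∀ j → size c j ≡ μ + optimum r j)
  recolour (k , opt) = (λ u → dihedral k (τ u)) , (λ u w → trans (blow u w) (sym (dihedral-far k (τ u) (τ w)))) , λ j → at-image j (dihedral-surjective k j)
    where
    at-image : ∀ j → (∃ λ i → dihedral k i ≡ j) → size (λ u → dihedral k (τ u)) j ≡ μ + optimum r j
    at-image _ (i , refl) = trans (∑-cong λ p → cong ι (dihedral-injective k i (τ p))) (trans (w≡ i) (cong (λ x → μ + x) (opt i)))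

isomorphic : ∀ {n} (G H : Graph n) (c c′ : Fin n → Fin 5) → IsBlowup G c → IsBlowup H c′ → (∀ j → size c j ≡ size c′ j) → G ≅ H
isomorphic {n} G H c c′ bG bH s = σ , λ u w → edge u w (u ≡ᵇ w) refl
  where
  match = matching c c′ s
  σ = proj₁ match
  to : Fin n → Fin n
  to = Inverse.to σ
  cmpl≡ : ∀ u w → cmpl G u w ≡ cmpl H (to u) (to w)
  cmpl≡ u w = trans (bG u w) (trans (sym (cong₂ far (proj₂ match u) (proj₂ match w))) (sym (bH (to u) (to w))))
  adj-of : ∀ {m} (F : Graph m) u w → u ≢ w → adj F u w ≡ not (cmpl F u w)
  adj-of F u w u≢w rewrite ≢⇒≡ᵇ u≢w with adj F u w
  ... | true = refl
  ... | false = refl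
  to-injective : ∀ {u w} → to u ≡ to w → u ≡ w
  to-injective {u} {w} e = trans (sym (Inverse.strictlyInverseʳ σ u)) (trans (cong (Inverse.from σ) e) (Inverse.strictlyInverseʳ σ w))
  edge : ∀ u w b → (u ≡ᵇ w) ≡ b → adj G u w ≡ adj H (to u) (to w)
  edge u w true e = trans (subst (λ x → adj G u x ≡ false) (≡ᵇ⇒≡ u w e) (irrefl G u)) (sym (subst (λ x → adj H (to u) (to x) ≡ false) (≡ᵇ⇒≡ u w e) (irrefl H (to u))))
  edge u w false e = trans (adj-of G u w u≢w) (trans (cong not (cmpl≡ u w)) (sym (adj-of H (to u) (to w) (u≢w ∘ to-injective))))
    where
    u≢w : u ≢ w
    u≢w refl = true≢false (≡ᵇ-refl u) e

-- Existence of a minimiser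

isIndependent? : ∀ {n} (G : Graph n) (S : Subset n) → Dec (IsIndependent G S)
isIndependent? G S = all? λ i → all? λ j →
  (i ∈? S) →-dec ((j ∈? S) →-dec (¬? (i ≟ᶠ j) →-dec (adj G i j ≟ᵇ false)))

αLess? : ∀ {n} (G : Graph n) l → Dec (αLess G l)
αLess? G l with anySubset? (λ S → (∥ S ∥ ℕₚ.≟ l) ×-dec isIndependent? G S)
... | yes (S , s , ind) = no λ α → α S s ind
... | no none = yes λ S s ind → none (S , s , ind)

-- Every subset of the ordered pairs yields a graph, an edge requiring both orders, so `anySubset?`
-- decides existential statements about graphs.
decode : ∀ {n} → Subset (n ℕ.* n) → Graph n
decode S .adj i j = not (i ≡ᵇ j) ∧ (Vec.lookup S (combine i j) ∧ Vec.lookup S (combine j i))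
decode S .adj-sym i j = cong₂ (λ a b → not a ∧ b) (≡ᵇ-sym i j) (∧-comm (Vec.lookup S (combine i j)) (Vec.lookup S (combine j i)))
decode S .irrefl i rewrite ≡ᵇ-refl i = refl

encode : ∀ {n} → Graph n → Subset (n ℕ.* n)
encode {n} G = Vec.tabulate λ k → adj G (proj₁ (remQuot n k)) (proj₂ (remQuot {n} n k))

decode-encode : ∀ {n} (G : Graph n) i j → adj (decode (encode G)) i j ≡ adj G i j
decode-encode {n} G i j = trans (cong (not (i ≡ᵇ j) ∧_) (cong₂ _∧_ (look i j) (trans (look j i) (adj-sym G j i)))) (simplify (i ≡ᵇ j) refl)
  where
  look : ∀ i j → Vec.lookup (encode G) (combine i j) ≡ adj G i j
  look i j = trans (lookup∘tabulate (λ k → adj G (proj₁ (remQuot n k)) (proj₂ (remQuot {n} n k))) (combine i j))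
    (cong (λ p → adj G (proj₁ p) (proj₂ p)) (remQuot-combine i j))
  idem : ∀ b → b ∧ b ≡ b
  idem true = refl
  idem false = refl
  simplify : ∀ b → (i ≡ᵇ j) ≡ b → not (i ≡ᵇ j) ∧ (adj G i j ∧ adj G i j) ≡ adj G i j
  simplify false e = trans (cong (λ b → not b ∧ (adj G i j ∧ adj G i j)) e) (idem (adj G i j))
  simplify true e = trans (cong (λ b → not b ∧ (adj G i j ∧ adj G i j)) e)
    (sym (subst (λ x → adj G i x ≡ false) (≡ᵇ⇒≡ i j e) (irrefl G i)))

αLess-resp : ∀ {n} {G H : Graph n} {l} → (∀ i j → adj G i j ≡ adj H i j) → αLess H l → αLess G l
αLess-resp e α S s ind = α S s λ i j p q i≢j → trans (sym (e i j)) (ind i j p q i≢j)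

t₄-resp : ∀ {n} (G H : Graph n) → (∀ i j → adj G i j ≡ adj H i j) → t 4 G ≡ t 4 H
t₄-resp G H e = +-injective (*-cancelˡ-≡ (+ 24) (+ t 4 G) (+ t 4 H)
  (trans (sym (T≡t G 4)) (trans (T-cong {A = adj G} {adj H} 4 {everything} {everything} e (λ _ → refl)) (T≡t H 4))))

-- Descent from the complete graph, the blow-up with a single nonempty part. At each bound a
-- decidable search either finds an admissible graph with fewer 4-cliques or certifies minimality;
-- it is carried over to an arbitrary graph by agreement of adjacencies, since `decode (encode H)`
-- equals `H` only pointwise.
extremal-exists : ∀ n → Σ (Graph n) (IsExtremal 4 3)
extremal-exists n = search (t 4 start) start (blowup-αLess (λ _ → 0F)) ℕₚ.≤-refl
  where
  start : Graph n
  start = blowup (λ _ → 0F)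
  search : ∀ k (G : Graph n) → αLess G 3 → t 4 G ℕ.≤ k → Σ (Graph n) (IsExtremal 4 3)
  search zero G α h = G , α , λ H _ → ℕₚ.≤-trans h ℕ.z≤n
  search (suc k) G α h with anySubset? (λ S → αLess? (decode {n} S) 3 ×-dec (t 4 (decode {n} S) ℕ.≤? k))
  ... | yes (S , α′ , h′) = search k (decode S) α′ h′
  ... | no none = G , α , λ H αH → ℕₚ.≮⇒≥ λ H<G → none (encode H ,
    αLess-resp {G = decode (encode H)} {H} (decode-encode H) αH ,
    ℕₚ.≤-trans (ℕₚ.≤-reflexive (t₄-resp (decode (encode H)) H (decode-encode H))) (ℕₚ.≤-pred (ℕₚ.<-≤-trans H<G h)))

-- Part sizes in the stated form and conclusion

partSize≡size : ∀ {n} (c : Fin n → Fin 5) i → + partSize c i ≡ size c i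
partSize≡size {n} c i = trans (go (λ p → p)) (∑-cong λ p → cong ι (does-≡ (c p ≟ᶠ i) (i ≡ᵇ c p)
    (λ e → subst (λ x → (i ≡ᵇ x) ≡ true) (sym e) (≡ᵇ-refl i)) (λ e → sym (≡ᵇ⇒≡ i (c p) e))))
  where
  -- `allFin` is `tabulate` of the identity; the induction needs an arbitrary function in its place.
  go : ∀ {m} (f : Fin m → Fin n) → + List.length (List.filter (λ u → c u ≟ᶠ i) (List.tabulate f)) ≡ ∑ (λ p → ι (does (c (f p) ≟ᶠ i)))
  go {zero} f = refl
  go {suc m} f with does (c (f zero) ≟ᶠ i)
  ... | true = trans (pos-+ 1 _) (cong (λ x → + 1 + x) (go (λ p → f (suc p))))
  ... | false = trans (go (λ p → f (suc p))) (sym (+-identityˡ _))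

near-bounds : ∀ D N δ s → D * δ ≤ N → + 0 ≤ D → + 0 ≤ N → Near N δ s →
  (+ 5 * D * s ≤ D * N + + 5 * N) × (D * N ≤ + 5 * D * s + + 5 * N)
near-bounds D N δ s δ≤ 0≤D 0≤N (lo , hi) =
  ≤-from-diff (e₁ D N δ s) (0≤+ (0≤* {D} 0≤D (i≤j⇒0≤j-i hi)) (0≤+ (0≤* {+ 3} 0≤k (i≤j⇒0≤j-i δ≤)) (0≤* {+ 2} 0≤k 0≤N))) ,
  ≤-from-diff (e₂ D N δ s) (0≤+ (0≤* {D} 0≤D (i≤j⇒0≤j-i lo)) (0≤+ (0≤* {+ 3} 0≤k (i≤j⇒0≤j-i δ≤)) (0≤* {+ 2} 0≤k 0≤N)))
  where
  e₁ : ∀ D N δ s → D * N + + 5 * N - + 5 * D * s ≡ D * (+ 3 * δ - (+ 5 * s - N)) + (+ 3 * (N - D * δ) + + 2 * N)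
  e₁ = solve-∀
  e₂ : ∀ D N δ s → + 5 * D * s + + 5 * N - D * N ≡ D * (+ 5 * s - N - - (+ 3 * δ)) + (+ 3 * (N - D * δ) + + 2 * N)
  e₂ = solve-∀

part-sizes : ∀ D .{{_ : ℕ.NonZero D}} n (c : Fin n → Fin 5) → (∀ p → Near (+ n) (+ (n ℕ./ D)) (size c p)) → ∀ i →
  (5 ℕ.* D ℕ.* partSize c i ℕ.≤ D ℕ.* n ℕ.+ 5 ℕ.* n) × (D ℕ.* n ℕ.≤ 5 ℕ.* D ℕ.* partSize c i ℕ.+ 5 ℕ.* n)
part-sizes D n c near i =
  drop‿+≤+ (≤-trans (≤-reflexive lhs) (≤-trans (proj₁ bounds) (≤-reflexive (sym (trans (pos-+ (D ℕ.* n) (5 ℕ.* n)) (cong₂ _+_ (pos-* D n) (pos-* 5 n))))))) ,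
  drop‿+≤+ (≤-trans (≤-reflexive (pos-* D n)) (≤-trans (proj₂ bounds) (≤-reflexive (sym (trans (pos-+ (5 ℕ.* D ℕ.* partSize c i) (5 ℕ.* n)) (cong₂ _+_ lhs (pos-* 5 n)))))))
  where
  bounds = near-bounds (+ D) (+ n) (+ (n ℕ./ D)) (size c i) (proj₁ (/-bounds n D)) 0≤k 0≤k (near i)
  lhs : + (5 ℕ.* D ℕ.* partSize c i) ≡ + 5 * + D * size c i
  lhs = trans (pos-* (5 ℕ.* D) (partSize c i)) (cong₂ _*_ (pos-* 5 D) (partSize≡size c i))

Structured : ℕ → Set
Structured D = Σ ℕ λ n₀ → ∀ n → n₀ ℕ.≤ n → (G : Graph n) → IsExtremal 4 3 G →
  Σ (Fin n → Fin 5) λ τ → IsBlowup G τ × (∀ p → Near (+ n) (+ (n ℕ./ suc D)) (size τ p))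

-- `Structured 389` speaks of n/390, the precision required by `scaled-deviation`; adding 5 · 2340
-- to the threshold makes the quotient n/5 at least 2340.
canonical : Structured 389 → Σ ℕ λ n₀ → ∀ n → n₀ ℕ.≤ n → Σ (Fin 5 → ℤ) λ w → ∀ (G : Graph n) → IsExtremal 4 3 G →
  Σ (Fin n → Fin 5) λ c → IsBlowup G c × (∀ j → size c j ≡ w j)
canonical (n₁ , structured) = n₁ ℕ.+ 5 ℕ.* 2340 , λ n n≥ → decompose n (ℕₚ.≤-trans (ℕₚ.m≤m+n n₁ (5 ℕ.* 2340)) n≥)
    (/-lower n 5 2340 (ℕₚ.≤-trans (ℕₚ.m≤n+m (5 ℕ.* 2340) n₁) n≥))
  where
  decompose : ∀ n → n₁ ℕ.≤ n → 2340 ℕ.≤ n ℕ./ 5 → Σ (Fin 5 → ℤ) λ w → ∀ (G : Graph n) → IsExtremal 4 3 G →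
    Σ (Fin n → Fin 5) λ c → IsBlowup G c × (∀ j → size c j ≡ w j)
  decompose n n≥ q≥ = (λ j → + (n ℕ./ 5) + optimum r j) , λ G ext → use G ext (structured n n≥ G ext)
    where
    r : Fin 5
    r = fromℕ< (DivMod.m%n<n n 5)
    positive : ∀ q → 2340 ℕ.≤ q → q ≡ suc (ℕ.pred q)
    positive (suc q) _ = refl
    n≡ : n ≡ toℕ r ℕ.+ suc (ℕ.pred (n ℕ./ 5)) ℕ.* 5
    n≡ = trans (DivMod.m≡m%n+[m/n]*n n 5) (cong₂ (λ x q → x ℕ.+ q ℕ.* 5) (sym (toℕ-fromℕ< (DivMod.m%n<n n 5))) (positive (n ℕ./ 5) q≥))
    use : ∀ (G : Graph n) → IsExtremal 4 3 G →
      (Σ (Fin n → Fin 5) λ τ → IsBlowup G τ × (∀ p → Near (+ n) (+ (n ℕ./ 390)) (size τ p))) →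
      Σ (Fin n → Fin 5) λ c → IsBlowup G c × (∀ j → size c j ≡ + (n ℕ./ 5) + optimum r j)
    use G ext (τ , blow , near) = canonical-colouring G ext r (ℕ.pred (n ℕ./ 5)) (+ (n ℕ./ 5)) (cong +_ (positive (n ℕ./ 5) q≥)) n≡ (+≤+ q≥) τ blow near

theorem1p1 :
  ((n : ℕ) → Σ (Graph n) (IsExtremal 4 3))
  × Σ ℕ (λ K → (n : ℕ) (G : Graph n) → IsExtremal 4 3 G →
      (25 ℕ.* t 4 G ℕ.≤ 3 ℕ.* (n C 4) ℕ.+ K ℕ.* n ℕ.^ 3)
      × (3 ℕ.* (n C 4) ℕ.≤ 25 ℕ.* t 4 G ℕ.+ K ℕ.* n ℕ.^ 3))
  × ((m : ℕ) → Σ ℕ (λ n₁ → (n : ℕ) → n₁ ℕ.≤ n → (G : Graph n) → IsExtremal 4 3 G →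
      Σ (Fin n → Fin 5) (λ part → IsC5BlowupPartition G part
        × ((i : Fin 5) →
            (5 ℕ.* suc m ℕ.* partSize part i ℕ.≤ suc m ℕ.* n ℕ.+ 5 ℕ.* n)
            × (suc m ℕ.* n ℕ.≤ 5 ℕ.* suc m ℕ.* partSize part i ℕ.+ 5 ℕ.* n)))))
  × Σ ℕ (λ n₀ → (n : ℕ) → n₀ ℕ.≤ n →
      ((G H : Graph n) → IsExtremal 4 3 G → IsExtremal 4 3 H → G ≅ H)
      × ((G : Graph n) → IsExtremal 4 3 G → IsC5Blowup G))
theorem1p1 = extremal-exists , (162 , density-bounds) , partitions (λ m → structure (suc m)) , uniqueness (canonical (structure 390))
  where
  partition : ∀ m n (G : Graph n) →
    (Σ (Fin n → Fin 5) λ τ → IsBlowup G τ × (∀ p → Near (+ n) (+ (n ℕ./ suc m)) (size τ p))) →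
    Σ (Fin n → Fin 5) (λ part → IsC5BlowupPartition G part × ((i : Fin 5) →
      (5 ℕ.* suc m ℕ.* partSize part i ℕ.≤ suc m ℕ.* n ℕ.+ 5 ℕ.* n) × (suc m ℕ.* n ℕ.≤ 5 ℕ.* suc m ℕ.* partSize part i ℕ.+ 5 ℕ.* n)))
  partition m n G (τ , blow , near) = τ , IsBlowup⇒Partition G τ blow , part-sizes (suc m) n τ near
  partitions : (∀ m → Structured m) → (m : ℕ) → Σ ℕ (λ n₁ → (n : ℕ) → n₁ ℕ.≤ n → (G : Graph n) → IsExtremal 4 3 G →
    Σ (Fin n → Fin 5) (λ part → IsC5BlowupPartition G part × ((i : Fin 5) →
      (5 ℕ.* suc m ℕ.* partSize part i ℕ.≤ suc m ℕ.* n ℕ.+ 5 ℕ.* n) × (suc m ℕ.* n ℕ.≤ 5 ℕ.* suc m ℕ.* partSize part i ℕ.+ 5 ℕ.* n))))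
  partitions S m = proj₁ (S m) , λ n n≥ G ext → partition m n G (proj₂ (S m) n n≥ G ext)
  unique : ∀ n → (Σ (Fin 5 → ℤ) λ w → ∀ (G : Graph n) → IsExtremal 4 3 G → Σ (Fin n → Fin 5) λ c → IsBlowup G c × (∀ j → size c j ≡ w j)) →
    ((G H : Graph n) → IsExtremal 4 3 G → IsExtremal 4 3 H → G ≅ H) × ((G : Graph n) → IsExtremal 4 3 G → IsC5Blowup G)
  unique n (w , colour) =
    (λ G H extG extH → same G H (colour G extG) (colour H extH)) ,
    (λ G ext → proj₁ (colour G ext) , IsBlowup⇒Partition G (proj₁ (colour G ext)) (proj₁ (proj₂ (colour G ext))))
    where
    same : ∀ G H → (Σ (Fin n → Fin 5) λ c → IsBlowup G c × (∀ j → size c j ≡ w j)) → (Σ (Fin n → Fin 5) λ c → IsBlowup H c × (∀ j → size c j ≡ w j)) → G ≅ H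
    same G H (c , blow , s) (c′ , blow′ , s′) = isomorphic G H c c′ blow blow′ (λ j → trans (s j) (sym (s′ j)))
  uniqueness : (Σ ℕ λ n₀ → ∀ n → n₀ ℕ.≤ n → Σ (Fin 5 → ℤ) λ w → ∀ (G : Graph n) → IsExtremal 4 3 G → Σ (Fin n → Fin 5) λ c → IsBlowup G c × (∀ j → size c j ≡ w j)) →
    Σ ℕ (λ n₀ → (n : ℕ) → n₀ ℕ.≤ n → ((G H : Graph n) → IsExtremal 4 3 G → IsExtremal 4 3 H → G ≅ H) × ((G : Graph n) → IsExtremal 4 3 G → IsC5Blowup G))
  uniqueness (n₀ , colourings) = n₀ , λ n n≥ → unique n (colourings n n≥)
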